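{- Let $F\in\mathbb Z[x]$ satisfy $M_{15}(F)=3^2m$ or $M_{15}(F)=5^2m$ for some integer $m$ with $\gcd(15,m)=1$. Then either $N_{15}(F)$ is 15-norm good, or $p\mid N_3(F)$ for some prime $p\equiv 7$ or $13\pmod{15}$, or $p\mid N_5(F)$ for some prime $p\equiv 11\pmod{15}$.
   Context: $\omega_d=e^{2\pi i/d}$; $M_{15}(F)=\prod_{j=1}^{15}F(\omega_{15}^j)$ and $N_d(F)=\prod_{1\le j\le d,\gcd(j,d)=1}F(\omega_d^j)$; $\Phi_d$ is the $d$-th cyclotomic polynomial. An element $\xi\in\mathbb Z[\omega_{15}]$ is good if $\xi=uG(\omega_{15})$ with $u$ a unit of $\mathbb Z[\omega_{15}]$ and $G(x)=(x^5-1)\pm x^j\Phi_3(x)+(x-1)\Phi_3(x)\Phi_5(x)g(x)$ for some $0\le j<15$, sign and $g\in\mathbb Z[x]$. An integer $k$ coprime to 15 is 15-norm good if $k$ is the norm (from $\mathbb Q(\omega_{15})$ to $\mathbb Q$) of a good $\xi\in\mathbb Z[\omega_{15}]$. -}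

module Defs where

open import Data.Nat as ℕ using (ℕ; zero; suc)
open import Data.Nat.GCD using (gcd)
open import Data.Nat.Coprimality using (Coprime)
open import Data.Integer as ℤ using (ℤ; +_; -[1+_]; ∣_∣)
open import Data.List using (List; []; _∷_; [_]; map; foldr; filter; upTo)
open import Data.Product using (Σ; ∃; _×_; _,_)
open import Data.Sum using (_⊎_)
open import Relation.Binary.PropositionalEquality using (_≡_)

-- Integer polynomials Z[x], as coefficient lists (lowest degree first).
Poly : Set
Poly = List ℤ

infixl 6 _+ₚ_
infixl 7 _*ₚ_

_+ₚ_ : Poly → Poly → Poly
[] +ₚ q = q
p +ₚ [] = p
(a ∷ p) +ₚ (b ∷ q) = (a ℤ.+ b) ∷ (p +ₚ q)

-ₚ_ : Poly → Poly
-ₚ p = map ℤ.-_ p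

_-ₚ_ : Poly → Poly → Poly
p -ₚ q = p +ₚ (-ₚ q)

_*ₚ_ : Poly → Poly → Poly
[] *ₚ q = []
(a ∷ p) *ₚ q = map (a ℤ.*_) q +ₚ (+ 0 ∷ (p *ₚ q))

cst : ℤ → Poly
cst k = [ k ]

X^ : ℕ → Poly
X^ zero = [ + 1 ]
X^ (suc n) = + 0 ∷ X^ n

coeff : Poly → ℕ → ℤ
coeff [] n = + 0
coeff (a ∷ p) zero = a
coeff (a ∷ p) (suc n) = coeff p n

_≐_ : Poly → Poly → Set
p ≐ q = ∀ n → coeff p n ≡ coeff q n

_∘x^_ : Poly → ℕ → Poly
p ∘x^ j = foldr (λ c acc → cst c +ₚ X^ j *ₚ acc) [] p

prodₚ : List Poly → Poly
prodₚ = foldr _*ₚ_ [ + 1 ]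

Φ3 Φ5 Φ15 : Poly
Φ3 = + 1 ∷ + 1 ∷ + 1 ∷ []
Φ5 = + 1 ∷ + 1 ∷ + 1 ∷ + 1 ∷ + 1 ∷ []
Φ15 = + 1 ∷ -[1+ 0 ] ∷ + 0 ∷ + 1 ∷ -[1+ 0 ] ∷ + 1 ∷ + 0 ∷ -[1+ 0 ] ∷ + 1 ∷ []

-- Z[ω15] ≅ Z[x]/(Φ15): a polynomial p represents p(ω15), and
-- p(ω15) = q(ω15) iff Φ15 divides p - q in Z[x].
_≈ω_ : Poly → Poly → Set
p ≈ω q = ∃ λ h → (p -ₚ q) ≐ (Φ15 *ₚ h)

oneTo : ℕ → List ℕ
oneTo n = map suc (upTo n)

-- M_15(F) = ∏_{j=1}^{15} F(ω15^j)
M15 : Poly → Poly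
M15 F = prodₚ (map (λ j → F ∘x^ j) (oneTo 15))

-- For d ∣ 15 with e = 15/d (so ω_d = ω15^e):
-- N_d(F) = ∏_{1≤j≤d, gcd(j,d)=1} F(ω_d^j) = ∏ F(ω15^(e*j))
Nprod : (d e : ℕ) → Poly → Poly
Nprod d e F = prodₚ (map (λ j → F ∘x^ (e ℕ.* j)) (filter (λ j → gcd j d ℕ.≟ 1) (oneTo d)))

N3 N5 N15 : Poly → Poly
N3 = Nprod 3 5
N5 = Nprod 5 3
N15 = Nprod 15 1

Norm : Poly → Poly
Norm = N15

IsUnit : Poly → Set
IsUnit u = ∃ λ v → (u *ₚ v) ≈ω cst (+ 1)

Gpoly : ℤ → ℕ → Poly → Poly
Gpoly s j g = (X^ 5 -ₚ cst (+ 1)) +ₚ (cst s *ₚ X^ j *ₚ Φ3)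
              +ₚ ((X^ 1 -ₚ cst (+ 1)) *ₚ Φ3 *ₚ Φ5 *ₚ g)

IsSign : ℤ → Set
IsSign s = (s ≡ + 1) ⊎ (s ≡ -[1+ 0 ])

Good : Poly → Set
Good ξ = ∃ λ u → IsUnit u × ∃ λ j → (j ℕ.< 15) × ∃ λ s → IsSign s ×
           ∃ λ g → ξ ≈ω (u *ₚ Gpoly s j g)

NormGood15 : ℤ → Set
NormGood15 k = Coprime ∣ k ∣ 15 × ∃ λ ξ → Good ξ × (Norm ξ ≈ω cst k)

{-# OPTIONS --safe #-}
-- In fact F(ω₁₅) itself is good unless one of the exceptional primes occurs. Modulo 1 - ω₅ and
-- 1 - ω₃ the ring ℤ[ω₁₅] becomes the fields F₂₅ and F₈₁, where F(ω₁₅) reduces to F(ω₃) and F(ω₅).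
-- Being good depends only on this pair of residues, and the units of ℤ[ω₁₅] act on such pairs with
-- exactly two orbits, told apart by the product of the quadratic characters, that is, by the
-- Legendre symbols of N₃(F) modulo 5 and of N₅(F) modulo 3.
--
-- For d = 3, 5 a prime p ≢ 0, 1 mod d occurs in N_d(F) only through squares: some power q of p is
-- ≡ -1 mod d, so by Frobenius F(ω)^q is the complex conjugate of F(ω) modulo p, and a prime of the
-- real subfield that divides the product of the two divides F(ω). For d = 5 the real subring is the
-- Euclidean ring ℤ[φ], φ the golden ratio. Hence N_d(F) is a square times a power of d times
-- primes ≡ 1 mod d, and if none of these is exceptional the two Legendre symbols are as required.
module Submission where

-- The polynomial G of a good element has the residues ω₃² - 1 in F₂₅ and ±ω₅ʲΦ₃(ω₅) in F₈₁, of
-- norms 3, a nonsquare modulo 5, and ±1-free 1, a square modulo 3. If M₁₅(F) = 9m, comparing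
-- valuations forces N₃(F) = 3u with u prime to 3, and N₅(F) prime to 15; without exceptional primes
-- u is a square modulo 5 and N₅(F) ≡ 1 modulo 3, so both symbols already agree with those of G. If
-- M₁₅(F) = 25m, then N₃(F) is a square modulo 5 and N₅(F) = 5u with u ≡ 1 modulo 3: both symbols
-- are opposite, and the unit ω₁₅ - 1, for which N₃ = 3 and N₅ = 5, flips both.
--
-- The norms are integer forms computed by Horner reduction, and their product formulas are proved
-- over every ring with a root of Φ₃ or Φ₅. Rings in which such a root degenerates (1 is a root of
-- Φ₃ modulo 3) then give the congruences between N₁, N₃, N₅ and N₁₅ that control the valuations.
--
-- Prime factorisation in ℤ[ω₅] is avoided: the gcd of F(ω₅) times its conjugate with p, taken in
-- ℤ[φ], stands in for a prime above p, whether p is inert or split there.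

open import Defs
open import Algebra.Bundles using (CommutativeRing)
import Algebra.Solver.CommutativeMonoid
import Algebra.Solver.Ring
open import Algebra.Solver.Ring.AlmostCommutativeRing using (fromCommutativeRing; _-Raw-AlmostCommutative⟶_)
open import Data.Fin using (Fin; zero; suc; toℕ; fromℕ; fromℕ<; inject₁)
import Data.Fin.Properties as Fin
open import Data.Integer as ℤ using (ℤ; +_; -[1+_]; ∣_∣)
import Data.Integer.DivMod as ℤ
import Data.Integer.Divisibility.Signed as ℤ
import Data.Integer.Properties as ℤ
open import Data.Integer.Solver using (module +-*-Solver)
open import Data.Integer.Tactic.RingSolver using (solve-∀)
open import Data.List using (List; []; _∷_; [_]; map; length; foldr)
open import Data.List.Relation.Unary.All using (All; []; _∷_; all?)
open import Data.Maybe using (Maybe; just; nothing)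
open import Data.Nat as ℕ using (ℕ; zero; suc; _!)
open import Data.Nat.Combinatorics using (_C_; nCk≡n!/k![n-k]!; k![n∸k]!∣n!; nCn≡1)
open import Data.Nat.Coprimality using (Coprime; coprime-divisor)
import Data.Nat.DivMod as ℕ
import Data.Nat.Divisibility as ℕ
open import Data.Nat.Induction using (<-rec)
open import Data.Nat.ListAction using (product)
open import Data.Nat.ListAction.Properties using (∈⇒∣product)
open import Data.Nat.Primality using (Prime; prime?; euclidsLemma; prime⇒irreducible; prime⇒nonTrivial)
import Data.Nat.Properties as ℕ
import Data.Nat.Tactic.RingSolver as ℕSolver
open import Data.Product using (∃; _×_; _,_; proj₁; proj₂)
open import Data.Sum as Sum using (_⊎_; inj₁; inj₂; [_,_]′)
open import Data.Vec.Functional using (replicate)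
open import Level using (0ℓ)
open import Relation.Binary.Bundles using (Setoid)
open import Relation.Binary.PropositionalEquality as ≡ using (_≡_; _≢_; cong; cong₂)
open import Relation.Nullary using (¬_; contradiction; Dec; yes; no)
open import Relation.Nullary.Decidable using (True; toWitness; from-yes; ¬?; _×-dec_; _⊎-dec_; _→-dec_)

-- The polynomial ring ℤ[X]

-- Wrapping _≐_ in a record lets Agda infer the two polynomials from a proof.
record _≑_ (p q : Poly) : Set where
  constructor mk
  field coeffs : p ≐ q
open _≑_

infix 4 _≑_

scale : ℤ → Poly → Poly
scale a = map (a ℤ.*_)

coeff-+ : ∀ p q n → coeff (p +ₚ q) n ≡ coeff p n ℤ.+ coeff q n
coeff-+ [] q n = ≡.sym (ℤ.+-identityˡ _)
coeff-+ (a ∷ p) [] n = ≡.sym (ℤ.+-identityʳ _)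
coeff-+ (a ∷ p) (b ∷ q) zero = ≡.refl
coeff-+ (a ∷ p) (b ∷ q) (suc n) = coeff-+ p q n

coeff-neg : ∀ p n → coeff (-ₚ p) n ≡ ℤ.- coeff p n
coeff-neg [] n = ≡.refl
coeff-neg (a ∷ p) zero = ≡.refl
coeff-neg (a ∷ p) (suc n) = coeff-neg p n

coeff-scale : ∀ a p n → coeff (scale a p) n ≡ a ℤ.* coeff p n
coeff-scale a [] n = ≡.sym (ℤ.*-zeroʳ a)
coeff-scale a (b ∷ p) zero = ≡.refl
coeff-scale a (b ∷ p) (suc n) = coeff-scale a p n

≑-refl : ∀ {p} → p ≑ p
≑-refl = mk λ _ → ≡.refl

≑-sym : ∀ {p q} → p ≑ q → q ≑ p
≑-sym (mk e) = mk λ n → ≡.sym (e n)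

≑-trans : ∀ {p q r} → p ≑ q → q ≑ r → p ≑ r
≑-trans (mk e) (mk e′) = mk λ n → ≡.trans (e n) (e′ n)

polySetoid : Setoid 0ℓ 0ℓ
polySetoid = record
  { Carrier = Poly ; _≈_ = _≑_ ; isEquivalence = record { refl = ≑-refl ; sym = ≑-sym ; trans = ≑-trans } }

+ₚ-cong : ∀ {p p′ q q′} → p ≑ p′ → q ≑ q′ → p +ₚ q ≑ p′ +ₚ q′
+ₚ-cong {p} {p′} {q} {q′} (mk e) (mk e′) = mk λ n →
  ≡.trans (coeff-+ p q n) (≡.trans (cong₂ ℤ._+_ (e n) (e′ n)) (≡.sym (coeff-+ p′ q′ n)))

+ₚ-congˡ : ∀ p {q q′} → q ≑ q′ → p +ₚ q ≑ p +ₚ q′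
+ₚ-congˡ p e = +ₚ-cong {p} {p} ≑-refl e

-ₚ-cong : ∀ {p q} → p ≑ q → -ₚ p ≑ -ₚ q
-ₚ-cong {p} {q} (mk e) = mk λ n →
  ≡.trans (coeff-neg p n) (≡.trans (cong ℤ.-_ (e n)) (≡.sym (coeff-neg q n)))

scale-cong : ∀ a {p q} → p ≑ q → scale a p ≑ scale a q
scale-cong a {p} {q} (mk e) = mk λ n →
  ≡.trans (coeff-scale a p n) (≡.trans (cong (a ℤ.*_) (e n)) (≡.sym (coeff-scale a q n)))

∷-cong : ∀ {a b p q} → a ≡ b → p ≑ q → (a ∷ p) ≑ (b ∷ q)
∷-cong ≡.refl (mk e) = mk λ where
  zero → ≡.refl
  (suc n) → e n

tail-cong : ∀ {a b p q} → (a ∷ p) ≑ (b ∷ q) → p ≑ q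
tail-cong (mk e) = mk λ n → e (suc n)

0∷[]≑[] : (+ 0 ∷ []) ≑ []
0∷[]≑[] = mk λ where
  zero → ≡.refl
  (suc n) → ≡.refl

+ₚ-comm : ∀ p q → p +ₚ q ≑ q +ₚ p
+ₚ-comm p q = mk λ n →
  ≡.trans (coeff-+ p q n) (≡.trans (ℤ.+-comm (coeff p n) _) (≡.sym (coeff-+ q p n)))

+ₚ-assoc : ∀ p q r → (p +ₚ q) +ₚ r ≑ p +ₚ (q +ₚ r)
+ₚ-assoc p q r = mk λ n → begin
  coeff ((p +ₚ q) +ₚ r) n                  ≡⟨ coeff-+ (p +ₚ q) r n ⟩
  coeff (p +ₚ q) n ℤ.+ coeff r n           ≡⟨ cong (ℤ._+ coeff r n) (coeff-+ p q n) ⟩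
  coeff p n ℤ.+ coeff q n ℤ.+ coeff r n    ≡⟨ ℤ.+-assoc (coeff p n) _ _ ⟩
  coeff p n ℤ.+ (coeff q n ℤ.+ coeff r n)  ≡⟨ cong (λ z → coeff p n ℤ.+ z) (coeff-+ q r n) ⟨
  coeff p n ℤ.+ coeff (q +ₚ r) n           ≡⟨ coeff-+ p (q +ₚ r) n ⟨
  coeff (p +ₚ (q +ₚ r)) n                  ∎
  where open ≡.≡-Reasoning

+ₚ-identityʳ : ∀ p → p +ₚ [] ≑ p
+ₚ-identityʳ p = +ₚ-comm p []

-ₚ-inverseʳ : ∀ p → p +ₚ (-ₚ p) ≑ []
-ₚ-inverseʳ p = mk λ n →
  ≡.trans (coeff-+ p (-ₚ p) n)
    (≡.trans (cong (λ z → coeff p n ℤ.+ z) (coeff-neg p n)) (ℤ.+-inverseʳ (coeff p n)))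

+ₚ-interchange : ∀ p q r s → (p +ₚ q) +ₚ (r +ₚ s) ≑ (p +ₚ r) +ₚ (q +ₚ s)
+ₚ-interchange p q r s = mk λ n → begin
  coeff ((p +ₚ q) +ₚ (r +ₚ s)) n                               ≡⟨ split p q r s n ⟩
  (coeff p n ℤ.+ coeff q n) ℤ.+ (coeff r n ℤ.+ coeff s n)      ≡⟨ rearrange (coeff p n) (coeff q n) (coeff r n) (coeff s n) ⟩
  (coeff p n ℤ.+ coeff r n) ℤ.+ (coeff q n ℤ.+ coeff s n)      ≡⟨ split p r q s n ⟨
  coeff ((p +ₚ r) +ₚ (q +ₚ s)) n                               ∎
  where
  open ≡.≡-Reasoning
  split : ∀ p q r s n → coeff ((p +ₚ q) +ₚ (r +ₚ s)) n ≡
          (coeff p n ℤ.+ coeff q n) ℤ.+ (coeff r n ℤ.+ coeff s n)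
  split p q r s n = ≡.trans (coeff-+ (p +ₚ q) (r +ₚ s) n) (cong₂ ℤ._+_ (coeff-+ p q n) (coeff-+ r s n))
  rearrange : ∀ a b c d → (a ℤ.+ b) ℤ.+ (c ℤ.+ d) ≡ (a ℤ.+ c) ℤ.+ (b ℤ.+ d)
  rearrange = solve-∀

scale-distrib-+ₚ : ∀ a p q → scale a (p +ₚ q) ≑ scale a p +ₚ scale a q
scale-distrib-+ₚ a p q = mk λ n → begin
  coeff (scale a (p +ₚ q)) n                 ≡⟨ coeff-scale a (p +ₚ q) n ⟩
  a ℤ.* coeff (p +ₚ q) n                     ≡⟨ cong (a ℤ.*_) (coeff-+ p q n) ⟩
  a ℤ.* (coeff p n ℤ.+ coeff q n)            ≡⟨ ℤ.*-distribˡ-+ a _ _ ⟩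
  a ℤ.* coeff p n ℤ.+ a ℤ.* coeff q n        ≡⟨ cong₂ ℤ._+_ (coeff-scale a p n) (coeff-scale a q n) ⟨
  coeff (scale a p) n ℤ.+ coeff (scale a q) n ≡⟨ coeff-+ (scale a p) (scale a q) n ⟨
  coeff (scale a p +ₚ scale a q) n           ∎
  where open ≡.≡-Reasoning

scale-scale : ∀ a b p → scale (a ℤ.* b) p ≑ scale a (scale b p)
scale-scale a b p = mk λ n → begin
  coeff (scale (a ℤ.* b) p) n   ≡⟨ coeff-scale (a ℤ.* b) p n ⟩
  a ℤ.* b ℤ.* coeff p n         ≡⟨ ℤ.*-assoc a b _ ⟩
  a ℤ.* (b ℤ.* coeff p n)       ≡⟨ cong (a ℤ.*_) (coeff-scale b p n) ⟨
  a ℤ.* coeff (scale b p) n     ≡⟨ coeff-scale a (scale b p) n ⟨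
  coeff (scale a (scale b p)) n ∎
  where open ≡.≡-Reasoning

scale-0 : ∀ p → scale (+ 0) p ≑ []
scale-0 p = mk λ n → ≡.trans (coeff-scale (+ 0) p n) (ℤ.*-zeroˡ (coeff p n))

scale-1 : ∀ p → scale (+ 1) p ≑ p
scale-1 p = mk λ n → ≡.trans (coeff-scale (+ 1) p n) (ℤ.*-identityˡ (coeff p n))

*ₚ-zeroʳ : ∀ p → p *ₚ [] ≑ []
*ₚ-zeroʳ [] = ≑-refl
*ₚ-zeroʳ (a ∷ p) = ≑-trans (∷-cong ≡.refl (*ₚ-zeroʳ p)) 0∷[]≑[]

*ₚ-congʳ : ∀ p {q q′} → q ≑ q′ → p *ₚ q ≑ p *ₚ q′
*ₚ-congʳ [] e = ≑-refl
*ₚ-congʳ (a ∷ p) e = +ₚ-cong (scale-cong a e) (∷-cong ≡.refl (*ₚ-congʳ p e))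

-- `_*ₚ_` recurses on its first factor; commutativity needs the mirror recursion on the second.
*ₚ-∷ : ∀ p b q → p *ₚ (b ∷ q) ≑ scale b p +ₚ (+ 0 ∷ (p *ₚ q))
*ₚ-∷ [] b q = ≑-sym 0∷[]≑[]
*ₚ-∷ (a ∷ p) b q = ∷-cong (cong (ℤ._+ + 0) (ℤ.*-comm a b)) (begin
  scale a q +ₚ (p *ₚ (b ∷ q))                   ≈⟨ +ₚ-congˡ (scale a q) (*ₚ-∷ p b q) ⟩
  scale a q +ₚ (scale b p +ₚ (+ 0 ∷ (p *ₚ q)))  ≈⟨ +ₚ-assoc (scale a q) (scale b p) _ ⟨
  (scale a q +ₚ scale b p) +ₚ (+ 0 ∷ (p *ₚ q))  ≈⟨ +ₚ-cong (+ₚ-comm (scale a q) (scale b p)) ≑-refl ⟩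
  (scale b p +ₚ scale a q) +ₚ (+ 0 ∷ (p *ₚ q))  ≈⟨ +ₚ-assoc (scale b p) (scale a q) _ ⟩
  scale b p +ₚ (scale a q +ₚ (+ 0 ∷ (p *ₚ q)))  ∎)
  where open import Relation.Binary.Reasoning.Setoid polySetoid

*ₚ-comm : ∀ p q → p *ₚ q ≑ q *ₚ p
*ₚ-comm [] q = ≑-sym (*ₚ-zeroʳ q)
*ₚ-comm (a ∷ p) q = ≑-trans (+ₚ-congˡ (scale a q) (∷-cong ≡.refl (*ₚ-comm p q))) (≑-sym (*ₚ-∷ q a p))

*ₚ-cong : ∀ {p p′ q q′} → p ≑ p′ → q ≑ q′ → p *ₚ q ≑ p′ *ₚ q′
*ₚ-cong {p} {p′} {q} {q′} e e′ =
  ≑-trans (*ₚ-congʳ p e′) (≑-trans (*ₚ-comm p q′) (≑-trans (*ₚ-congʳ q′ e) (*ₚ-comm q′ p′)))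

*ₚ-distribˡ-+ₚ : ∀ p q r → p *ₚ (q +ₚ r) ≑ p *ₚ q +ₚ p *ₚ r
*ₚ-distribˡ-+ₚ [] q r = ≑-refl
*ₚ-distribˡ-+ₚ (a ∷ p) q r =
  ≑-trans (+ₚ-cong (scale-distrib-+ₚ a q r) (∷-cong ≡.refl (*ₚ-distribˡ-+ₚ p q r)))
          (+ₚ-interchange (scale a q) (scale a r) (+ 0 ∷ p *ₚ q) (+ 0 ∷ p *ₚ r))

*ₚ-distribʳ-+ₚ : ∀ p q r → (q +ₚ r) *ₚ p ≑ q *ₚ p +ₚ r *ₚ p
*ₚ-distribʳ-+ₚ p q r =
  ≑-trans (*ₚ-comm (q +ₚ r) p)
    (≑-trans (*ₚ-distribˡ-+ₚ p q r) (+ₚ-cong (*ₚ-comm p q) (*ₚ-comm p r)))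

0∷-*ₚ : ∀ p q → (+ 0 ∷ p) *ₚ q ≑ (+ 0 ∷ p *ₚ q)
0∷-*ₚ p q = +ₚ-cong (scale-0 q) ≑-refl

scale-*ₚ : ∀ a p q → scale a p *ₚ q ≑ scale a (p *ₚ q)
scale-*ₚ a [] q = ≑-refl
scale-*ₚ a (b ∷ p) q =
  ≑-trans (+ₚ-cong (scale-scale a b q) (∷-cong (≡.sym (ℤ.*-zeroʳ a)) (scale-*ₚ a p q)))
          (≑-sym (scale-distrib-+ₚ a (scale b q) (+ 0 ∷ p *ₚ q)))

*ₚ-assoc : ∀ p q r → (p *ₚ q) *ₚ r ≑ p *ₚ (q *ₚ r)
*ₚ-assoc [] q r = ≑-refl
*ₚ-assoc (a ∷ p) q r =
  ≑-trans (*ₚ-distribʳ-+ₚ r (scale a q) (+ 0 ∷ p *ₚ q))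
    (+ₚ-cong (scale-*ₚ a q r) (≑-trans (0∷-*ₚ (p *ₚ q) r) (∷-cong ≡.refl (*ₚ-assoc p q r))))

*ₚ-identityˡ : ∀ p → [ + 1 ] *ₚ p ≑ p
*ₚ-identityˡ p = ≑-trans (+ₚ-cong (scale-1 p) 0∷[]≑[]) (+ₚ-identityʳ p)

polyRing : CommutativeRing 0ℓ 0ℓ
polyRing = record
  { Carrier = Poly ; _≈_ = _≑_ ; _+_ = _+ₚ_ ; _*_ = _*ₚ_ ; -_ = -ₚ_ ; 0# = [] ; 1# = [ + 1 ]
  ; isCommutativeRing = record
    { isRing = record
      { +-isAbelianGroup = record
        { isGroup = record
          { isMonoid = record
            { isSemigroup = record
              { isMagma = record
                { isEquivalence = Setoid.isEquivalence polySetoid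
                ; ∙-cong = +ₚ-cong }
              ; assoc = +ₚ-assoc }
            ; identity = (λ p → ≑-refl) , +ₚ-identityʳ }
          ; inverse = (λ p → ≑-trans (+ₚ-comm (-ₚ p) p) (-ₚ-inverseʳ p)) , -ₚ-inverseʳ
          ; ⁻¹-cong = -ₚ-cong }
        ; comm = +ₚ-comm }
      ; *-cong = *ₚ-cong
      ; *-assoc = *ₚ-assoc
      ; *-identity = *ₚ-identityˡ , λ p → ≑-trans (*ₚ-comm p [ + 1 ]) (*ₚ-identityˡ p)
      ; distrib = *ₚ-distribˡ-+ₚ , *ₚ-distribʳ-+ₚ }
    ; *-comm = *ₚ-comm } }

-- Commutative rings with a homomorphism from ℤ

-- The ring determines `ι` up to its equality, but as a field it can be given the form in which each
-- instance computes, such as constant polynomials, and the ring solver can take its coefficients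
-- from ℤ.
record ℤAlgebra : Set₁ where
  field
    commutativeRing : CommutativeRing 0ℓ 0ℓ
  open CommutativeRing commutativeRing hiding (zero) public
  field
    ι : ℤ → Carrier
    ι-+ : ∀ a b → ι (a ℤ.+ b) ≈ ι a + ι b
    ι-* : ∀ a b → ι (a ℤ.* b) ≈ ι a * ι b
    ι-neg : ∀ a → ι (ℤ.- a) ≈ - ι a
    ι-0 : ι (+ 0) ≈ 0#
    ι-1 : ι (+ 1) ≈ 1#

  ι-cong : ∀ {a b} → a ≡ b → ι a ≈ ι b
  ι-cong ≡.refl = refl

  open import Algebra.Properties.Semiring.Exp semiring public
  open import Algebra.Properties.Ring ring public using (-0#≈0#)

  ι-- : ∀ a b → ι (a ℤ.- b) ≈ ι a - ι b
  ι-- a b = trans (ι-+ a (ℤ.- b)) (+-congˡ (ι-neg b))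

  infixl 6 _⟨+⟩_ _⟨-⟩_
  infixl 7 _⟨*⟩_

  _⟨+⟩_ : ∀ {a b x y} → ι a ≈ x → ι b ≈ y → ι (a ℤ.+ b) ≈ x + y
  p ⟨+⟩ q = trans (ι-+ _ _) (+-cong p q)

  _⟨-⟩_ : ∀ {a b x y} → ι a ≈ x → ι b ≈ y → ι (a ℤ.- b) ≈ x - y
  p ⟨-⟩ q = trans (ι-- _ _) (+-cong p (-‿cong q))

  _⟨*⟩_ : ∀ {a b x y} → ι a ≈ x → ι b ≈ y → ι (a ℤ.* b) ≈ x * y
  p ⟨*⟩ q = trans (ι-* _ _) (*-cong p q)

  x≈y⇒x-y≈0 : ∀ {x y} → x ≈ y → x - y ≈ 0#
  x≈y⇒x-y≈0 {x} {y} e = trans (+-congʳ e) (-‿inverseʳ y)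

  -- This is how a relation such as 1 + w + w² = 0 enters a computation: the solver proves an
  -- identity containing an explicit multiple `z * t` of the relation, with the cofactor `t` found
  -- by polynomial division, and the multiple is then dropped.
  drop-multiple : ∀ {z x y} t → z ≈ 0# → x ≈ y + z * t → x ≈ y
  drop-multiple {z} {x} {y} t z≈0 e = trans e (trans (+-congˡ (trans (*-congʳ z≈0) (zeroˡ t))) (+-identityʳ y))

  1^n≈1 : ∀ n → 1# ^ n ≈ 1#
  1^n≈1 zero = refl
  1^n≈1 (suc n) = trans (*-identityˡ _) (1^n≈1 n)

  ^-reduce : ∀ {x n} → x ^ n ≈ 1# → ∀ k m → x ^ (m ℕ.+ k ℕ.* n) ≈ x ^ m
  ^-reduce {x} {n} e k m = begin
    x ^ (m ℕ.+ k ℕ.* n)      ≈⟨ ^-homo-* x m (k ℕ.* n) ⟩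
    x ^ m * x ^ (k ℕ.* n)    ≈⟨ *-congˡ (^-congʳ x (ℕ.*-comm k n)) ⟩
    x ^ m * x ^ (n ℕ.* k)    ≈⟨ *-congˡ (sym (^-assocʳ x n k)) ⟩
    x ^ m * (x ^ n) ^ k      ≈⟨ *-congˡ (^-congˡ k e) ⟩
    x ^ m * 1# ^ k           ≈⟨ *-congˡ (1^n≈1 k) ⟩
    x ^ m * 1#               ≈⟨ *-identityʳ _ ⟩
    x ^ m                    ∎
    where open import Relation.Binary.Reasoning.Setoid setoid

module IntegerSolver (A : ℤAlgebra) where
  open ℤAlgebra A

  morphism : CommutativeRing.rawRing ℤ.+-*-commutativeRing -Raw-AlmostCommutative⟶ fromCommutativeRing commutativeRing
  morphism = record
    { ⟦_⟧ = ι ; +-homo = ι-+ ; *-homo = ι-* ; -‿homo = ι-neg ; 0-homo = ι-0 ; 1-homo = ι-1 }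

  ι-≟ : ∀ a b → Maybe (ι a ≈ ι b)
  ι-≟ a b with a ℤ.≟ b
  ... | yes e = just (ι-cong e)
  ... | no _ = nothing

  open Algebra.Solver.Ring _ (fromCommutativeRing commutativeRing) morphism ι-≟ public

-- Two generators cover every ring below: a cyclotomic polynomial together with an integer, with an
-- element of ℤ[φ], or with 0. The carrier is kept and only equality changes, so representatives
-- still compute.
module Quotient (A : ℤAlgebra) (f c : ℤAlgebra.Carrier A) where
  open ℤAlgebra A
  open IntegerSolver A
  open import Relation.Binary.Reasoning.Setoid setoid

  infix 4 _~_
  record _~_ (p q : Carrier) : Set where
    constructor ideal
    field
      {h k} : Carrier
      difference : p - q ≈ f * h + c * k

  ~-lift : ∀ {p q} → p ≈ q → p ~ q
  ~-lift {p} {q} e = ideal (begin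
    p - q                      ≈⟨ x≈y⇒x-y≈0 e ⟩
    0#                         ≈⟨ ι-0 ⟨
    ι (+ 0)                    ≈⟨ solve 2 (λ f c → con (+ 0) := f :* con (+ 0) :+ c :* con (+ 0)) refl f c ⟩
    f * ι (+ 0) + c * ι (+ 0)  ∎)

  ~-refl : ∀ {p} → p ~ p
  ~-refl = ~-lift refl

  ~-sym : ∀ {p q} → p ~ q → q ~ p
  ~-sym {p} {q} (ideal {h} {k} e) = ideal (begin
    q - p                ≈⟨ solve 2 (λ p q → q :- p := :- (p :- q)) refl p q ⟩
    - (p - q)            ≈⟨ -‿cong e ⟩
    - (f * h + c * k)    ≈⟨ solve 4 (λ f h c k → :- (f :* h :+ c :* k) := f :* (:- h) :+ c :* (:- k)) refl f h c k ⟩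
    f * (- h) + c * - k  ∎)

  ~-trans : ∀ {p q r} → p ~ q → q ~ r → p ~ r
  ~-trans {p} {q} {r} (ideal {h} {k} e) (ideal {h′} {k′} e′) = ideal (begin
    p - r                              ≈⟨ solve 3 (λ p q r → p :- r := (p :- q) :+ (q :- r)) refl p q r ⟩
    (p - q) + (q - r)                  ≈⟨ +-cong e e′ ⟩
    (f * h + c * k) + (f * h′ + c * k′) ≈⟨ solve 6 (λ f h c k h′ k′ → (f :* h :+ c :* k) :+ (f :* h′ :+ c :* k′)
                                                := f :* (h :+ h′) :+ c :* (k :+ k′)) refl f h c k h′ k′ ⟩
    f * (h + h′) + c * (k + k′)        ∎)

  ~-+-cong : ∀ {p p′ q q′} → p ~ p′ → q ~ q′ → p + q ~ p′ + q′
  ~-+-cong {p} {p′} {q} {q′} (ideal {h} {k} e) (ideal {h′} {k′} e′) = ideal (begin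
    p + q - (p′ + q′)                   ≈⟨ solve 4 (λ p p′ q q′ → (p :+ q) :- (p′ :+ q′) := (p :- p′) :+ (q :- q′)) refl p p′ q q′ ⟩
    (p - p′) + (q - q′)                 ≈⟨ +-cong e e′ ⟩
    (f * h + c * k) + (f * h′ + c * k′) ≈⟨ solve 6 (λ f h c k h′ k′ → (f :* h :+ c :* k) :+ (f :* h′ :+ c :* k′)
                                                 := f :* (h :+ h′) :+ c :* (k :+ k′)) refl f h c k h′ k′ ⟩
    f * (h + h′) + c * (k + k′)         ∎)

  ~-neg-cong : ∀ {p q} → p ~ q → - p ~ - q
  ~-neg-cong {p} {q} (ideal {h} {k} e) = ideal (begin
    - p - - q            ≈⟨ solve 2 (λ p q → :- p :- :- q := :- (p :- q)) refl p q ⟩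
    - (p - q)            ≈⟨ -‿cong e ⟩
    - (f * h + c * k)    ≈⟨ solve 4 (λ f h c k → :- (f :* h :+ c :* k) := f :* (:- h) :+ c :* (:- k)) refl f h c k ⟩
    f * (- h) + c * - k  ∎)

  ~-*-cong : ∀ {p p′ q q′} → p ~ p′ → q ~ q′ → p * q ~ p′ * q′
  ~-*-cong {p} {p′} {q} {q′} (ideal {h} {k} e) (ideal {h′} {k′} e′) = ideal (begin
    p * q - p′ * q′                               ≈⟨ solve 4 (λ p p′ q q′ → p :* q :- p′ :* q′ := (p :- p′) :* q :+ p′ :* (q :- q′)) refl p p′ q q′ ⟩
    (p - p′) * q + p′ * (q - q′)                  ≈⟨ +-cong (*-congʳ e) (*-congˡ e′) ⟩
    (f * h + c * k) * q + p′ * (f * h′ + c * k′)  ≈⟨ solve 8 (λ f h c k h′ k′ q p′ → (f :* h :+ c :* k) :* q :+ p′ :* (f :* h′ :+ c :* k′)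
                                                           := f :* (h :* q :+ p′ :* h′) :+ c :* (k :* q :+ p′ :* k′)) refl f h c k h′ k′ q p′ ⟩
    f * (h * q + p′ * h′) + c * (k * q + p′ * k′) ∎)

  generator₁≈0 : f ~ 0#
  generator₁≈0 = ideal (begin
    f - 0#                     ≈⟨ +-congˡ -0#≈0# ⟩
    f + 0#                     ≈⟨ +-identityʳ f ⟩
    f                          ≈⟨ solve 2 (λ f c → f := f :* con (+ 1) :+ c :* con (+ 0)) refl f c ⟩
    f * ι (+ 1) + c * ι (+ 0)  ∎)

  generator₂≈0 : c ~ 0#
  generator₂≈0 = ideal (begin
    c - 0#                     ≈⟨ +-congˡ -0#≈0# ⟩
    c + 0#                     ≈⟨ +-identityʳ c ⟩
    c                          ≈⟨ solve 2 (λ f c → c := f :* con (+ 0) :+ c :* con (+ 1)) refl f c ⟩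
    f * ι (+ 0) + c * ι (+ 1)  ∎)

  quotient : ℤAlgebra
  quotient = record
    { commutativeRing = record
      { Carrier = Carrier ; _≈_ = _~_ ; _+_ = _+_ ; _*_ = _*_ ; -_ = -_ ; 0# = 0# ; 1# = 1#
      ; isCommutativeRing = record
        { isRing = record
          { +-isAbelianGroup = record
            { isGroup = record
              { isMonoid = record
                { isSemigroup = record
                  { isMagma = record
                    { isEquivalence = record { refl = ~-refl ; sym = ~-sym ; trans = ~-trans }
                    ; ∙-cong = ~-+-cong }
                  ; assoc = λ p q r → ~-lift (+-assoc p q r) }
                ; identity = (λ p → ~-lift (+-identityˡ p)) , (λ p → ~-lift (+-identityʳ p)) }
              ; inverse = (λ p → ~-lift (-‿inverseˡ p)) , (λ p → ~-lift (-‿inverseʳ p))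
              ; ⁻¹-cong = ~-neg-cong }
            ; comm = λ p q → ~-lift (+-comm p q) }
          ; *-cong = ~-*-cong
          ; *-assoc = λ p q r → ~-lift (*-assoc p q r)
          ; *-identity = (λ p → ~-lift (*-identityˡ p)) , (λ p → ~-lift (*-identityʳ p))
          ; distrib = (λ p q r → ~-lift (distribˡ p q r)) , (λ p q r → ~-lift (distribʳ p q r)) }
        ; *-comm = λ p q → ~-lift (*-comm p q) } }
    ; ι = ι
    ; ι-+ = λ a b → ~-lift (ι-+ a b)
    ; ι-* = λ a b → ~-lift (ι-* a b)
    ; ι-neg = λ a → ~-lift (ι-neg a)
    ; ι-0 = ~-lift ι-0
    ; ι-1 = ~-lift ι-1 }

-- Evaluation of integer polynomials

module Evaluation (A : ℤAlgebra) where
  open ℤAlgebra A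
  open IntegerSolver A
  open import Relation.Binary.Reasoning.Setoid setoid

  eval : Poly → Carrier → Carrier
  eval [] r = 0#
  eval (c ∷ p) r = ι c + r * eval p r

  eval-congʳ : ∀ p {r s} → r ≈ s → eval p r ≈ eval p s
  eval-congʳ [] e = refl
  eval-congʳ (c ∷ p) e = +-congˡ (*-cong e (eval-congʳ p e))

  eval-≑[] : ∀ p r → p ≑ [] → eval p r ≈ 0#
  eval-≑[] [] r e = refl
  eval-≑[] (c ∷ p) r (mk e) = begin
    ι c + r * eval p r  ≈⟨ +-cong (trans (ι-cong (e 0)) ι-0) (*-congˡ (eval-≑[] p r (mk λ n → e (suc n)))) ⟩
    0# + r * 0#         ≈⟨ +-identityˡ _ ⟩
    r * 0#              ≈⟨ zeroʳ r ⟩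
    0#                  ∎

  eval-congˡ : ∀ {p q} r → p ≑ q → eval p r ≈ eval q r
  eval-congˡ {[]} {q} r e = sym (eval-≑[] q r (≑-sym e))
  eval-congˡ {c ∷ p} {[]} r e = eval-≑[] (c ∷ p) r e
  eval-congˡ {c ∷ p} {d ∷ q} r e = +-cong (ι-cong (_≑_.coeffs e 0)) (*-congˡ (eval-congˡ r (tail-cong e)))

  eval-+ : ∀ p q r → eval (p +ₚ q) r ≈ eval p r + eval q r
  eval-+ [] q r = sym (+-identityˡ _)
  eval-+ (c ∷ p) [] r = sym (+-identityʳ _)
  eval-+ (c ∷ p) (d ∷ q) r = begin
    ι (c ℤ.+ d) + r * eval (p +ₚ q) r           ≈⟨ +-cong (ι-+ c d) (*-congˡ (eval-+ p q r)) ⟩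
    (ι c + ι d) + r * (eval p r + eval q r)     ≈⟨ solve 5 (λ c d r x y → (c :+ d) :+ r :* (x :+ y) := (c :+ r :* x) :+ (d :+ r :* y)) refl
                                                     (ι c) (ι d) r (eval p r) (eval q r) ⟩
    (ι c + r * eval p r) + (ι d + r * eval q r) ∎

  eval-neg : ∀ p r → eval (-ₚ p) r ≈ - eval p r
  eval-neg [] r = sym -0#≈0#
  eval-neg (c ∷ p) r = begin
    ι (ℤ.- c) + r * eval (-ₚ p) r ≈⟨ +-cong (ι-neg c) (*-congˡ (eval-neg p r)) ⟩
    - ι c + r * - eval p r        ≈⟨ solve 3 (λ c r x → :- c :+ r :* :- x := :- (c :+ r :* x)) refl (ι c) r (eval p r) ⟩
    - (ι c + r * eval p r)        ∎

  eval-scale : ∀ a p r → eval (scale a p) r ≈ ι a * eval p r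
  eval-scale a [] r = sym (zeroʳ _)
  eval-scale a (c ∷ p) r = begin
    ι (a ℤ.* c) + r * eval (scale a p) r ≈⟨ +-cong (ι-* a c) (*-congˡ (eval-scale a p r)) ⟩
    ι a * ι c + r * (ι a * eval p r)     ≈⟨ solve 4 (λ a c r x → a :* c :+ r :* (a :* x) := a :* (c :+ r :* x)) refl (ι a) (ι c) r (eval p r) ⟩
    ι a * (ι c + r * eval p r)           ∎

  eval-* : ∀ p q r → eval (p *ₚ q) r ≈ eval p r * eval q r
  eval-* [] q r = sym (zeroˡ _)
  eval-* (c ∷ p) q r = begin
    eval (scale c q +ₚ (+ 0 ∷ p *ₚ q)) r             ≈⟨ eval-+ (scale c q) (+ 0 ∷ p *ₚ q) r ⟩
    eval (scale c q) r + (ι (+ 0) + r * eval (p *ₚ q) r) ≈⟨ +-cong (eval-scale c q r) (+-congˡ (*-congˡ (eval-* p q r))) ⟩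
    ι c * eval q r + (ι (+ 0) + r * (eval p r * eval q r)) ≈⟨ solve 4 (λ c r x y → c :* y :+ (con (+ 0) :+ r :* (x :* y)) := (c :+ r :* x) :* y) refl
                                                            (ι c) r (eval p r) (eval q r) ⟩
    (ι c + r * eval p r) * eval q r                  ∎

  eval-cst : ∀ c r → eval (cst c) r ≈ ι c
  eval-cst c r = trans (+-congˡ (zeroʳ r)) (+-identityʳ _)

  eval-X^ : ∀ n r → eval (X^ n) r ≈ r ^ n
  eval-X^ zero r = trans (eval-cst (+ 1) r) ι-1
  eval-X^ (suc n) r = trans (+-cong ι-0 (*-congˡ (eval-X^ n r))) (+-identityˡ _)

-- Norm forms

-- Horner's scheme with ω₃² = -1 - ω₃: the coordinates of p(ω₃) on 1, ω₃.
co3 : Poly → ℤ × ℤ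
co3 [] = + 0 , + 0
co3 (c ∷ p) = let (a , b) = co3 p in c ℤ.- b , a ℤ.- b

form3 : ℤ × ℤ → ℤ
form3 (a , b) = a ℤ.* a ℤ.- a ℤ.* b ℤ.+ b ℤ.* b

n3 : Poly → ℤ
n3 p = form3 (co3 p)

-- Horner's scheme with ω₅⁴ = -1 - ω₅ - ω₅² - ω₅³.
co5 : Poly → ℤ × ℤ × ℤ × ℤ
co5 [] = + 0 , + 0 , + 0 , + 0
co5 (c ∷ p) = let (a₀ , a₁ , a₂ , a₃) = co5 p in c ℤ.- a₃ , a₀ ℤ.- a₃ , a₁ ℤ.- a₃ , a₂ ℤ.- a₃

-- With φ = -(ω² + ω³), where ω = ω₅, this is α ᾱ = s + t φ for α = a₀ + a₁ω + a₂ω² + a₃ω³.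
relNorm5 : ℤ × ℤ × ℤ × ℤ → ℤ × ℤ
relNorm5 (a₀ , a₁ , a₂ , a₃) = S₀ ℤ.- S₁ , S₁ ℤ.- S₂
  where
  S₀ S₁ S₂ : ℤ
  S₀ = a₀ ℤ.* a₀ ℤ.+ a₁ ℤ.* a₁ ℤ.+ a₂ ℤ.* a₂ ℤ.+ a₃ ℤ.* a₃
  S₁ = a₀ ℤ.* a₁ ℤ.+ a₁ ℤ.* a₂ ℤ.+ a₂ ℤ.* a₃
  S₂ = a₀ ℤ.* a₂ ℤ.+ a₁ ℤ.* a₃ ℤ.+ a₀ ℤ.* a₃

-- The norm of s + tφ from ℤ[φ] to ℤ, where φ² = φ + 1.
Nφ : ℤ × ℤ → ℤ
Nφ (s , t) = s ℤ.* s ℤ.+ s ℤ.* t ℤ.- t ℤ.* t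

n5 : Poly → ℤ
n5 p = Nφ (relNorm5 (co5 p))

-- ω₁₅ = ω₃² ω₅² for ω₃ = ω₁₅⁵ and ω₅ = ω₁₅³, so ω₁₅ (a + b ω₃) = ω₅² (b - a) - ω₅² a ω₃.
split15 : Poly → Poly × Poly
split15 [] = [] , []
split15 (c ∷ p) = let (a , b) = split15 p in cst c +ₚ X^ 2 *ₚ (b -ₚ a) , -ₚ (X^ 2 *ₚ a)

-- The norm of a + bω₃ from ℤ[ω₁₅] to ℤ[ω₅], as a polynomial in ω₅.
relNorm15 : Poly → Poly
relNorm15 p = let (a , b) = split15 p in ((a *ₚ a) -ₚ (a *ₚ b)) +ₚ b *ₚ b

n15 : Poly → ℤ
n15 p = n5 (relNorm15 p)

-- The roots live in an arbitrary algebra, where `Root3 w` says only that Φ₃(w) = 0. This admits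
-- degenerate roots such as 1 modulo 3, at which the same product formulas become congruences
-- between norms of different levels.
module Norms (A : ℤAlgebra) where
  open ℤAlgebra A
  open IntegerSolver A
  open Evaluation A
  open import Relation.Binary.Reasoning.Setoid setoid

  Root3 Root5 : Carrier → Set
  Root3 w = ι (+ 1) + w + w ^ 2 ≈ 0#
  Root5 w = ι (+ 1) + w + w ^ 2 + w ^ 3 + w ^ 4 ≈ 0#

  root3-^2 : ∀ {w} → Root3 w → Root3 (w ^ 2)
  root3-^2 {w} e = drop-multiple (ι (+ 1) - w + w ^ 2) e (trans
    (solve 1 (λ w → con (+ 1) :+ w :^ 2 :+ (w :^ 2) :^ 2 := con (+ 0) :+ (con (+ 1) :+ w :+ w :^ 2) :* (con (+ 1) :- w :+ w :^ 2)) refl w)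
    (+-congʳ ι-0))

  root3-^3 : ∀ {w} → Root3 w → w ^ 3 ≈ 1#
  root3-^3 {w} e = drop-multiple (w - ι (+ 1)) e (trans
    (solve 1 (λ w → w :^ 3 := con (+ 1) :+ (con (+ 1) :+ w :+ w :^ 2) :* (w :- con (+ 1))) refl w)
    (+-congʳ ι-1))

  root5-^2 : ∀ {w} → Root5 w → Root5 (w ^ 2)
  root5-^2 {w} e = drop-multiple (ι (+ 1) - w + w ^ 2 - w ^ 3 + w ^ 4) e (trans
    (solve 1 (λ w → con (+ 1) :+ w :^ 2 :+ (w :^ 2) :^ 2 :+ (w :^ 2) :^ 3 :+ (w :^ 2) :^ 4
      := con (+ 0) :+ (con (+ 1) :+ w :+ w :^ 2 :+ w :^ 3 :+ w :^ 4) :* (con (+ 1) :- w :+ w :^ 2 :- w :^ 3 :+ w :^ 4)) refl w)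
    (+-congʳ ι-0))

  root5-^5 : ∀ {w} → Root5 w → w ^ 5 ≈ 1#
  root5-^5 {w} e = drop-multiple (w - ι (+ 1)) e (trans
    (solve 1 (λ w → w :^ 5 := con (+ 1) :+ (con (+ 1) :+ w :+ w :^ 2 :+ w :^ 3 :+ w :^ 4) :* (w :- con (+ 1))) refl w)
    (+-congʳ ι-1))

  lin3 : ℤ × ℤ → Carrier → Carrier
  lin3 (a , b) w = ι a + ι b * w

  eval-co3 : ∀ p {w} → Root3 w → eval p w ≈ lin3 (co3 p) w
  eval-co3 [] {w} e = sym (trans (+-cong ι-0 (trans (*-congʳ ι-0) (zeroˡ w))) (+-identityˡ _))
  eval-co3 (c ∷ p) {w} e = let (a , b) = co3 p in drop-multiple (ι b) e (begin
    ι c + w * eval p w           ≈⟨ +-congˡ (*-congˡ (eval-co3 p e)) ⟩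
    ι c + w * (ι a + ι b * w)    ≈⟨ solve 4 (λ c w a b → c :+ w :* (a :+ b :* w)
                                      := (c :- b) :+ (a :- b) :* w :+ (con (+ 1) :+ w :+ w :^ 2) :* b) refl (ι c) w (ι a) (ι b) ⟩
    (ι c - ι b) + (ι a - ι b) * w + (ι (+ 1) + w + w ^ 2) * ι b
      ≈⟨ +-congʳ (+-cong (ι-- c b) (*-congʳ (ι-- a b))) ⟨
    ι (c ℤ.- b) + ι (a ℤ.- b) * w + (ι (+ 1) + w + w ^ 2) * ι b ∎)

  norm3 : ∀ p {w} → Root3 w → eval p w * eval p (w ^ 2) ≈ ι (n3 p)
  norm3 p {w} e = let (a , b) = co3 p in drop-multiple (ι a * ι b + ι b * ι b * (w - ι (+ 1))) e (begin
    eval p w * eval p (w ^ 2)  ≈⟨ *-cong (eval-co3 p e) (eval-co3 p (root3-^2 e)) ⟩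
    (ι a + ι b * w) * (ι a + ι b * w ^ 2)
      ≈⟨ solve 3 (λ w a b → (a :+ b :* w) :* (a :+ b :* w :^ 2)
           := (a :* a :- a :* b :+ b :* b) :+ (con (+ 1) :+ w :+ w :^ 2) :* (a :* b :+ b :* b :* (w :- con (+ 1)))) refl w (ι a) (ι b) ⟩
    (ι a * ι a - ι a * ι b + ι b * ι b) + (ι (+ 1) + w + w ^ 2) * (ι a * ι b + ι b * ι b * (w - ι (+ 1)))
      ≈⟨ +-congʳ (ι-* a a ⟨-⟩ ι-* a b ⟨+⟩ ι-* b b) ⟨
    ι (form3 (a , b)) + _ ∎)

  lin5 : ℤ × ℤ × ℤ × ℤ → Carrier → Carrier
  lin5 (a₀ , a₁ , a₂ , a₃) w = ι a₀ + ι a₁ * w + ι a₂ * w ^ 2 + ι a₃ * w ^ 3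

  eval-co5 : ∀ p {w} → Root5 w → eval p w ≈ lin5 (co5 p) w
  eval-co5 [] {w} e = begin
    0#       ≈⟨ ι-0 ⟨
    ι (+ 0)  ≈⟨ solve 1 (λ w → con (+ 0) := con (+ 0) :+ con (+ 0) :* w :+ con (+ 0) :* w :^ 2 :+ con (+ 0) :* w :^ 3) refl w ⟩
    ι (+ 0) + ι (+ 0) * w + ι (+ 0) * w ^ 2 + ι (+ 0) * w ^ 3 ∎
  eval-co5 (c ∷ p) {w} e = let (a₀ , a₁ , a₂ , a₃) = co5 p in drop-multiple (ι a₃) e (begin
    ι c + w * eval p w             ≈⟨ +-congˡ (*-congˡ (eval-co5 p e)) ⟩
    ι c + w * lin5 (co5 p) w       ≈⟨ solve 6 (λ c w a₀ a₁ a₂ a₃ → c :+ w :* (a₀ :+ a₁ :* w :+ a₂ :* w :^ 2 :+ a₃ :* w :^ 3)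
                                        := (c :- a₃) :+ (a₀ :- a₃) :* w :+ (a₁ :- a₃) :* w :^ 2 :+ (a₂ :- a₃) :* w :^ 3
                                           :+ (con (+ 1) :+ w :+ w :^ 2 :+ w :^ 3 :+ w :^ 4) :* a₃) refl
                                        (ι c) w (ι a₀) (ι a₁) (ι a₂) (ι a₃) ⟩
    _                              ≈⟨ +-congʳ (+-cong (+-cong (+-cong (ι-- c a₃) (*-congʳ (ι-- a₀ a₃))) (*-congʳ (ι-- a₁ a₃))) (*-congʳ (ι-- a₂ a₃))) ⟨
    lin5 (co5 (c ∷ p)) w + _       ∎)

  phi : Carrier → Carrier
  phi w = - (w ^ 2 + w ^ 3)

  embedφ : ℤ × ℤ → Carrier → Carrier
  embedφ (s , t) w = ι s + ι t * phi w

  -- Here `v` plays the complex conjugate of `w`. Since vw = 1, the terms in aᵢaⱼ depend on the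
  -- exponents only through the difference i - j.
  lin5-product : ∀ a₀ a₁ a₂ a₃ {w v} → v * w - ι (+ 1) ≈ 0# →
    (a₀ + a₁ * w + a₂ * w ^ 2 + a₃ * w ^ 3) * (a₀ + a₁ * v + a₂ * v ^ 2 + a₃ * v ^ 3) ≈
    (a₀ * a₀ + a₁ * a₁ + a₂ * a₂ + a₃ * a₃) + (a₀ * a₁ + a₁ * a₂ + a₂ * a₃) * (w + v)
      + (a₀ * a₂ + a₁ * a₃) * (w ^ 2 + v ^ 2) + a₀ * a₃ * (w ^ 3 + v ^ 3)
  lin5-product a₀ a₁ a₂ a₃ {w} {v} e = drop-multiple _ e
    (solve 6 (λ a₀ a₁ a₂ a₃ w v →
       (a₀ :+ a₁ :* w :+ a₂ :* w :^ 2 :+ a₃ :* w :^ 3) :* (a₀ :+ a₁ :* v :+ a₂ :* v :^ 2 :+ a₃ :* v :^ 3)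
       := (a₀ :* a₀ :+ a₁ :* a₁ :+ a₂ :* a₂ :+ a₃ :* a₃) :+ (a₀ :* a₁ :+ a₁ :* a₂ :+ a₂ :* a₃) :* (w :+ v)
          :+ (a₀ :* a₂ :+ a₁ :* a₃) :* (w :^ 2 :+ v :^ 2) :+ a₀ :* a₃ :* (w :^ 3 :+ v :^ 3)
          :+ (v :* w :- con (+ 1)) :* (a₁ :* a₁ :+ a₂ :* a₂ :* (v :* w :+ con (+ 1))
               :+ a₃ :* a₃ :* (v :* w :* v :* w :+ v :* w :+ con (+ 1)) :+ a₁ :* a₂ :* (v :+ w)
               :+ a₁ :* a₃ :* (v :* v :+ w :* w) :+ a₂ :* a₃ :* (v :+ w) :* (v :* w :+ con (+ 1)))) refl
       a₀ a₁ a₂ a₃ w v)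

  -- The conjugate is evaluation at w⁴ = w⁻¹. Replacing w + w⁴ by -1 - (w² + w³) costs `S₁` times
  -- the relation and leaves only 1 and φ.
  relNorm5-correct : ∀ p {w} → Root5 w → eval p w * eval p (w ^ 4) ≈ embedφ (relNorm5 (co5 p)) w
  relNorm5-correct p {w} e = let (a₀ , a₁ , a₂ , a₃) = co5 p
                                 S₁ = ι a₀ * ι a₁ + ι a₁ * ι a₂ + ι a₂ * ι a₃ in begin
    eval p w * eval p (w ^ 4)                          ≈⟨ *-cong (eval-co5 p e) (eval-co5 p root4) ⟩
    lin5 (co5 p) w * lin5 (co5 p) (w ^ 4)              ≈⟨ lin5-product (ι a₀) (ι a₁) (ι a₂) (ι a₃) w⁴w-1≈0 ⟩
    _                                                  ≈⟨ +-cong (+-congˡ (*-congˡ (+-congˡ v²))) (*-congˡ (+-congˡ v³)) ⟩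
    _                                                  ≈⟨ drop-multiple S₁ e (solve 5 (λ a₀ a₁ a₂ a₃ w →
      (a₀ :* a₀ :+ a₁ :* a₁ :+ a₂ :* a₂ :+ a₃ :* a₃) :+ (a₀ :* a₁ :+ a₁ :* a₂ :+ a₂ :* a₃) :* (w :+ w :^ 4)
          :+ (a₀ :* a₂ :+ a₁ :* a₃) :* (w :^ 2 :+ w :^ 3) :+ a₀ :* a₃ :* (w :^ 3 :+ w :^ 2)
      := ((a₀ :* a₀ :+ a₁ :* a₁ :+ a₂ :* a₂ :+ a₃ :* a₃) :- (a₀ :* a₁ :+ a₁ :* a₂ :+ a₂ :* a₃))
         :+ ((a₀ :* a₁ :+ a₁ :* a₂ :+ a₂ :* a₃) :- (a₀ :* a₂ :+ a₁ :* a₃ :+ a₀ :* a₃)) :* (:- (w :^ 2 :+ w :^ 3))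
         :+ (con (+ 1) :+ w :+ w :^ 2 :+ w :^ 3 :+ w :^ 4) :* (a₀ :* a₁ :+ a₁ :* a₂ :+ a₂ :* a₃)) refl
      (ι a₀) (ι a₁) (ι a₂) (ι a₃) w) ⟩
    _                                                  ≈⟨ +-cong (ιS₀ a₀ a₁ a₂ a₃ ⟨-⟩ ιS₁ a₀ a₁ a₂ a₃) (*-congʳ (ιS₁ a₀ a₁ a₂ a₃ ⟨-⟩ ιS₂ a₀ a₁ a₂ a₃)) ⟨
    embedφ (relNorm5 (co5 p)) w                        ∎
    where
    w⁵ : w ^ 5 ≈ 1#
    w⁵ = root5-^5 e
    root4 : Root5 (w ^ 4)
    root4 = trans (+-cong (+-cong (+-cong (+-congˡ w⁴) (^-congˡ 2 w⁴)) (^-congˡ 3 w⁴)) (^-congˡ 4 w⁴)) (root5-^2 (root5-^2 e))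
      where
      w⁴ : w ^ 4 ≈ (w ^ 2) ^ 2
      w⁴ = sym (^-assocʳ w 2 2)
    w⁴w-1≈0 : w ^ 4 * w - ι (+ 1) ≈ 0#
    w⁴w-1≈0 = x≈y⇒x-y≈0 (trans (*-comm _ w) (trans w⁵ (sym ι-1)))
    v² : (w ^ 4) ^ 2 ≈ w ^ 3
    v² = trans (^-assocʳ w 4 2) (^-reduce {n = 5} w⁵ 1 3)
    v³ : (w ^ 4) ^ 3 ≈ w ^ 2
    v³ = trans (^-assocʳ w 4 3) (^-reduce {n = 5} w⁵ 2 2)
    ιS₀ : ∀ a₀ a₁ a₂ a₃ → _
    ιS₀ a₀ a₁ a₂ a₃ = ι-* a₀ a₀ ⟨+⟩ ι-* a₁ a₁ ⟨+⟩ ι-* a₂ a₂ ⟨+⟩ ι-* a₃ a₃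
    ιS₁ : ∀ a₀ a₁ a₂ a₃ → _
    ιS₁ a₀ a₁ a₂ a₃ = ι-* a₀ a₁ ⟨+⟩ ι-* a₁ a₂ ⟨+⟩ ι-* a₂ a₃
    ιS₂ : ∀ a₀ a₁ a₂ a₃ → _
    ιS₂ a₀ a₁ a₂ a₃ = ι-* a₀ a₂ ⟨+⟩ ι-* a₁ a₃ ⟨+⟩ ι-* a₀ a₃

  -- The substitution of w² for w turns φ = -(w² + w³) into -(w⁴ + w) = 1 - φ, its conjugate.
  embedφ-norm : ∀ z {w} → Root5 w → embedφ z w * embedφ z (w ^ 2) ≈ ι (Nφ z)
  embedφ-norm (s , t) {w} e = drop-multiple _ e (begin
    (ι s + ι t * phi w) * (ι s + ι t * phi (w ^ 2))
      ≈⟨ solve 3 (λ s t w → (s :+ t :* (:- (w :^ 2 :+ w :^ 3))) :* (s :+ t :* (:- ((w :^ 2) :^ 2 :+ (w :^ 2) :^ 3)))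
           := (s :* s :+ s :* t :- t :* t) :+ (con (+ 1) :+ w :+ w :^ 2 :+ w :^ 3 :+ w :^ 4) :*
              (t :* t :* (con (+ 1) :- w :+ w :^ 5)
               :- s :* t :* (con (+ 1) :- w :+ w :^ 2))) refl (ι s) (ι t) w ⟩
    (ι s * ι s + ι s * ι t - ι t * ι t) + _  ≈⟨ +-congʳ (ι-* s s ⟨+⟩ ι-* s t ⟨-⟩ ι-* t t) ⟨
    ι (Nφ (s , t)) + _                       ∎)

  -- The exponents 1, 4 and 2, 3 are the pairs of complex conjugates, so the norm is taken through
  -- ℤ[φ].
  norm5 : ∀ p {w} → Root5 w →
    eval p w * (eval p (w ^ 2) * (eval p (w ^ 3) * eval p (w ^ 4))) ≈ ι (n5 p)
  norm5 p {w} e = begin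
    eval p w * (eval p (w ^ 2) * (eval p (w ^ 3) * eval p (w ^ 4)))
      ≈⟨ solve 4 (λ a b c d → a :* (b :* (c :* d)) := (a :* d) :* (b :* c)) refl (eval p w) (eval p (w ^ 2)) (eval p (w ^ 3)) (eval p (w ^ 4)) ⟩
    (eval p w * eval p (w ^ 4)) * (eval p (w ^ 2) * eval p (w ^ 3))
      ≈⟨ *-congˡ (*-congˡ (eval-congʳ p w⁸)) ⟨
    (eval p w * eval p (w ^ 4)) * (eval p (w ^ 2) * eval p ((w ^ 2) ^ 4))
      ≈⟨ *-cong (relNorm5-correct p e) (relNorm5-correct p (root5-^2 e)) ⟩
    embedφ (relNorm5 (co5 p)) w * embedφ (relNorm5 (co5 p)) (w ^ 2)
      ≈⟨ embedφ-norm (relNorm5 (co5 p)) e ⟩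
    ι (n5 p) ∎
    where
    w⁸ : (w ^ 2) ^ 4 ≈ w ^ 3
    w⁸ = trans (^-assocʳ w 2 4) (^-reduce {n = 5} (root5-^5 e) 1 3)

  eval-split15 : ∀ p {r} → Root3 (r ^ 5) →
    eval p r ≈ eval (proj₁ (split15 p)) (r ^ 3) + r ^ 5 * eval (proj₂ (split15 p)) (r ^ 3)
  eval-split15 [] {r} e = sym (trans (+-identityˡ _) (zeroʳ _))
  eval-split15 (c ∷ p) {r} e = drop-multiple _ e (begin
    ι c + r * eval p r                      ≈⟨ +-congˡ (*-congˡ (eval-split15 p e)) ⟩
    ι c + r * (a + r ^ 5 * b)
      ≈⟨ solve 4 (λ c r a b → c :+ r :* (a :+ r :^ 5 :* b)
           := (c :+ (r :^ 3) :^ 2 :* (b :- a)) :+ r :^ 5 :* (:- ((r :^ 3) :^ 2 :* a))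
              :+ (con (+ 1) :+ r :^ 5 :+ (r :^ 5) :^ 2) :* (r :* a)) refl (ι c) r a b ⟩
    (ι c + (r ^ 3) ^ 2 * (b - a)) + r ^ 5 * - ((r ^ 3) ^ 2 * a) + _
      ≈⟨ +-congʳ (+-cong first (*-congˡ second)) ⟨
    eval (cst c +ₚ X^ 2 *ₚ (B -ₚ A′)) (r ^ 3) + r ^ 5 * eval (-ₚ (X^ 2 *ₚ A′)) (r ^ 3) + _ ∎)
    where
    A′ B : Poly
    A′ = proj₁ (split15 p)
    B = proj₂ (split15 p)
    a b : Carrier
    a = eval A′ (r ^ 3)
    b = eval B (r ^ 3)
    eval-X²* : ∀ q x → eval (X^ 2 *ₚ q) x ≈ x ^ 2 * eval q x
    eval-X²* q x = trans (eval-* (X^ 2) q x) (*-congʳ (eval-X^ 2 x))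
    first : eval (cst c +ₚ X^ 2 *ₚ (B -ₚ A′)) (r ^ 3) ≈ ι c + (r ^ 3) ^ 2 * (b - a)
    first = trans (eval-+ (cst c) (X^ 2 *ₚ (B -ₚ A′)) (r ^ 3)) (+-cong (eval-cst c (r ^ 3))
      (trans (eval-X²* (B -ₚ A′) (r ^ 3)) (*-congˡ (trans (eval-+ B (-ₚ A′) (r ^ 3)) (+-congˡ (eval-neg A′ (r ^ 3)))))))
    second : eval (-ₚ (X^ 2 *ₚ A′)) (r ^ 3) ≈ - ((r ^ 3) ^ 2 * a)
    second = trans (eval-neg (X^ 2 *ₚ A′) (r ^ 3)) (-‿cong (eval-X²* A′ (r ^ 3)))

  -- As 11 ≡ 1 modulo 5 and 11 ≡ 2 modulo 3, passing from r to r¹¹ fixes r³ and squares r⁵: it is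
  -- the conjugation of ℤ[ω₁₅] over ℤ[ω₅].
  relNorm15-correct : ∀ p {r} → Root3 (r ^ 5) → eval p r * eval p (r ^ 11) ≈ eval (relNorm15 p) (r ^ 3)
  relNorm15-correct p {r} e = drop-multiple _ e (begin
    eval p r * eval p (r ^ 11)                     ≈⟨ *-cong (eval-split15 p e) (eval-split15 p root) ⟩
    (a + r ^ 5 * b) * (eval A′ ((r ^ 11) ^ 3) + (r ^ 11) ^ 5 * eval B ((r ^ 11) ^ 3))
      ≈⟨ *-congˡ (+-cong (eval-congʳ A′ r³³) (*-cong r⁵⁵ (eval-congʳ B r³³))) ⟩
    (a + r ^ 5 * b) * (a + (r ^ 5) ^ 2 * b)
      ≈⟨ solve 3 (λ w a b → (a :+ w :* b) :* (a :+ w :^ 2 :* b)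
           := (a :* a :- a :* b :+ b :* b) :+ (con (+ 1) :+ w :+ w :^ 2) :* (a :* b :+ b :* b :* (w :- con (+ 1)))) refl (r ^ 5) a b ⟩
    (a * a - a * b + b * b) + _                    ≈⟨ +-congʳ combine ⟨
    eval (relNorm15 p) (r ^ 3) + _                 ∎)
    where
    A′ B : Poly
    A′ = proj₁ (split15 p)
    B = proj₂ (split15 p)
    a b : Carrier
    a = eval A′ (r ^ 3)
    b = eval B (r ^ 3)
    r¹⁵ : r ^ 15 ≈ 1#
    r¹⁵ = trans (sym (^-assocʳ r 5 3)) (root3-^3 e)
    r³³ : (r ^ 11) ^ 3 ≈ r ^ 3
    r³³ = trans (^-assocʳ r 11 3) (^-reduce {n = 15} r¹⁵ 2 3)
    r⁵⁵ : (r ^ 11) ^ 5 ≈ (r ^ 5) ^ 2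
    r⁵⁵ = trans (^-assocʳ r 11 5) (trans (^-reduce {n = 15} r¹⁵ 3 10) (sym (^-assocʳ r 5 2)))
    root : Root3 ((r ^ 11) ^ 5)
    root = trans (+-cong (+-congˡ r⁵⁵) (^-congˡ 2 r⁵⁵)) (root3-^2 e)
    combine : eval (relNorm15 p) (r ^ 3) ≈ a * a - a * b + b * b
    combine = trans (eval-+ ((A′ *ₚ A′) -ₚ (A′ *ₚ B)) (B *ₚ B) (r ^ 3)) (+-cong
      (trans (eval-+ (A′ *ₚ A′) (-ₚ (A′ *ₚ B)) (r ^ 3)) (+-cong (eval-* A′ A′ (r ^ 3))
         (trans (eval-neg (A′ *ₚ B) (r ^ 3)) (-‿cong (eval-* A′ B (r ^ 3))))))
      (eval-* B B (r ^ 3)))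

  -- Each exponent j prime to 15 is paired with 11j. The pairs are the fibres of reduction modulo 5,
  -- so they yield the four conjugates of `relNorm15 p`.
  norm15 : ∀ p {r} → Root3 (r ^ 5) → Root5 (r ^ 3) →
    let f = λ j → eval p (r ^ j) in
    f 1 * (f 2 * (f 4 * (f 7 * (f 8 * (f 11 * (f 13 * f 14)))))) ≈ ι (n15 p)
  norm15 p {r} e₃ e₅ = begin
    f 1 * (f 2 * (f 4 * (f 7 * (f 8 * (f 11 * (f 13 * f 14))))))
      ≈⟨ solve 8 (λ f₁ f₂ f₄ f₇ f₈ f₁₁ f₁₃ f₁₄ → f₁ :* (f₂ :* (f₄ :* (f₇ :* (f₈ :* (f₁₁ :* (f₁₃ :* f₁₄))))))
           := (f₁ :* f₁₁) :* ((f₂ :* f₇) :* ((f₈ :* f₁₃) :* (f₄ :* f₁₄)))) refl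
           (f 1) (f 2) (f 4) (f 7) (f 8) (f 11) (f 13) (f 14) ⟩
    (f 1 * f 11) * ((f 2 * f 7) * ((f 8 * f 13) * (f 4 * f 14)))
      ≈⟨ *-cong (pair 1 11 1 0 0 ≡.refl ≡.refl e₃₁) (*-cong (pair 2 7 2 1 0 ≡.refl ≡.refl e₃₂)
           (*-cong (pair 8 13 3 5 1 ≡.refl ≡.refl e₃₈) (pair 4 14 4 2 0 ≡.refl ≡.refl e₃₄))) ⟩
    H ((r ^ 3) ^ 1) * (H ((r ^ 3) ^ 2) * (H ((r ^ 3) ^ 3) * H ((r ^ 3) ^ 4)))
      ≈⟨ *-congʳ (eval-congʳ (relNorm15 p) (*-identityʳ _)) ⟩
    H (r ^ 3) * (H ((r ^ 3) ^ 2) * (H ((r ^ 3) ^ 3) * H ((r ^ 3) ^ 4)))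
      ≈⟨ norm5 (relNorm15 p) e₅ ⟩
    ι (n15 p) ∎
    where
    f : ℕ → Carrier
    f j = eval p (r ^ j)
    H : Carrier → Carrier
    H = eval (relNorm15 p)
    r¹⁵ : r ^ 15 ≈ 1#
    r¹⁵ = trans (sym (^-assocʳ r 5 3)) (root3-^3 e₃)
    root3-cong : ∀ {x y} → x ≈ y → Root3 x → Root3 y
    root3-cong x≈y e = trans (+-cong (+-congˡ (sym x≈y)) (^-congˡ 2 (sym x≈y))) e
    commute : ∀ j i → (r ^ j) ^ i ≈ (r ^ i) ^ j
    commute j i = trans (^-assocʳ r j i) (trans (^-congʳ r (ℕ.*-comm j i)) (sym (^-assocʳ r i j)))
    e₃₁ : Root3 ((r ^ 1) ^ 5)
    e₃₁ = root3-cong (sym (^-congˡ 5 (*-identityʳ r))) e₃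
    e₃₂ : Root3 ((r ^ 2) ^ 5)
    e₃₂ = root3-cong (commute 5 2) (root3-^2 e₃)
    e₃₄ : Root3 ((r ^ 4) ^ 5)
    e₃₄ = root3-cong (trans (^-assocʳ (r ^ 5) 2 2) (commute 5 4)) (root3-^2 (root3-^2 e₃))
    e₃₈ : Root3 ((r ^ 8) ^ 5)
    e₃₈ = root3-cong (trans (^-assocʳ ((r ^ 5) ^ 2) 2 2) (trans (^-assocʳ (r ^ 5) 2 4) (commute 5 8))) (root3-^2 (root3-^2 (root3-^2 e₃)))
    -- `k` and `l` count the multiples of 15 discarded from 11j and 3j.
    pair : ∀ j j′ i k l → j ℕ.* 11 ≡ j′ ℕ.+ k ℕ.* 15 → j ℕ.* 3 ≡ 3 ℕ.* i ℕ.+ l ℕ.* 15 →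
           Root3 ((r ^ j) ^ 5) → f j * f j′ ≈ H ((r ^ 3) ^ i)
    pair j j′ i k l e₁ e₂ e = begin
      f j * f j′                        ≈⟨ *-congˡ (eval-congʳ p (trans (^-assocʳ r j 11) (trans (^-congʳ r e₁) (^-reduce {n = 15} r¹⁵ k j′)))) ⟨
      eval p (r ^ j) * eval p ((r ^ j) ^ 11) ≈⟨ relNorm15-correct p e ⟩
      H ((r ^ j) ^ 3)                   ≈⟨ eval-congʳ (relNorm15 p) (trans (^-assocʳ r j 3) (trans (^-congʳ r e₂)
                                             (trans (^-reduce {n = 15} r¹⁵ l (3 ℕ.* i)) (sym (^-assocʳ r 3 i))))) ⟩
      H ((r ^ 3) ^ i)                   ∎

-- The Frobenius map

3-prime : Prime 3
3-prime = from-yes (prime? 3)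

5-prime : Prime 5
5-prime = from-yes (prime? 5)

prime>1 : ∀ {p} → Prime p → 1 ℕ.< p
prime>1 pp = ℕ.nonTrivial⇒n>1 _ {{prime⇒nonTrivial pp}}

prime∤n! : ∀ {p} → Prime p → ∀ n → n ℕ.< p → ¬ p ℕ.∣ n !
prime∤n! pp zero n<p p∣1 = ℕ.<⇒≱ (prime>1 pp) (ℕ.∣⇒≤ p∣1)
prime∤n! pp (suc n) n<p p∣ with euclidsLemma (suc n) (n !) pp p∣
... | inj₁ p∣1+n = ℕ.<⇒≱ n<p (ℕ.∣⇒≤ p∣1+n)
... | inj₂ p∣n! = prime∤n! pp n (ℕ.<-trans (ℕ.n<1+n n) n<p) p∣n!

prime∣pCk : ∀ {p} → Prime p → ∀ {k} → 0 ℕ.< k → k ℕ.< p → p ℕ.∣ p C k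
prime∣pCk {p} pp {k} 0<k k<p with euclidsLemma (p C k) (k ! ℕ.* (p ℕ.∸ k) !) pp p∣
  where
  instance _ = k ℕ.!* (p ℕ.∸ k) !≢0
  n∣n! : ∀ n → 0 ℕ.< n → n ℕ.∣ n !
  n∣n! (suc n) _ = ℕ.m∣m*n (n !)
  eq : (p C k) ℕ.* (k ! ℕ.* (p ℕ.∸ k) !) ≡ p !
  eq = ≡.trans (cong (λ z → z ℕ.* (k ! ℕ.* (p ℕ.∸ k) !)) (nCk≡n!/k![n-k]! (ℕ.<⇒≤ k<p))) (ℕ.m/n*n≡m (k![n∸k]!∣n! (ℕ.<⇒≤ k<p)))
  p∣ : p ℕ.∣ (p C k) ℕ.* (k ! ℕ.* (p ℕ.∸ k) !)
  p∣ = ≡.subst (p ℕ.∣_) (≡.sym eq) (n∣n! p (ℕ.<-trans ℕ.z<s (prime>1 pp)))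
... | inj₁ p∣C = p∣C
... | inj₂ p∣k![p-k]! with euclidsLemma (k !) ((p ℕ.∸ k) !) pp p∣k![p-k]!
... | inj₁ p∣k! = contradiction p∣k! (prime∤n! pp k k<p)
... | inj₂ p∣[p-k]! = contradiction p∣[p-k]! (prime∤n! pp (p ℕ.∸ k) (ℕ.∸-monoʳ-< {p} {k} {0} 0<k (ℕ.<⇒≤ k<p)))

module Frobenius (A : ℤAlgebra) where
  open ℤAlgebra A
  open Evaluation A
  open import Algebra.Properties.Semiring.Mult semiring using () renaming (_×_ to _×′_)
  open import Algebra.Properties.Monoid.Sum +-monoid using (sum; sum-init-last; sum-cong-≋; sum-replicate-zero)
  open import Algebra.Properties.CommutativeSemiring.Binomial commutativeSemiring using (theorem; binomialTerm)
  open import Algebra.Properties.CommutativeSemiring.Exp commutativeSemiring using (^-distrib-*)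
  open import Relation.Binary.Reasoning.Setoid setoid

  -- Frobenius on values: integer coefficients are fixed and only the argument is raised to the
  -- power. It is used for q = p and for q = p².
  PowerMap : ℕ → Set
  PowerMap q = ∀ F r → eval F r ^ q ≈ eval F (r ^ q)

  powerMap-* : ∀ {q q′} → PowerMap q → PowerMap q′ → PowerMap (q ℕ.* q′)
  powerMap-* {q} {q′} e e′ F r = begin
    eval F r ^ (q ℕ.* q′)   ≈⟨ ^-assocʳ (eval F r) q q′ ⟨
    (eval F r ^ q) ^ q′     ≈⟨ ^-congˡ q′ (e F r) ⟩
    eval F (r ^ q) ^ q′     ≈⟨ e′ F (r ^ q) ⟩
    eval F ((r ^ q) ^ q′)   ≈⟨ eval-congʳ F (^-assocʳ r q q′) ⟩
    eval F (r ^ (q ℕ.* q′)) ∎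

  -- F(w) F(w)^q = 0 makes F(w) nilpotent, while F(w)^(q²) = F(w).
  conjugate-product-zero : ∀ {q} → 2 ℕ.≤ q → PowerMap q → ∀ F {w} → w ^ (q ℕ.* q) ≈ w →
    eval F w * eval F (w ^ q) ≈ 0# → eval F w ≈ 0#
  conjugate-product-zero {q} 2≤q e F {w} w^qq zero-product = begin
    eval F w                          ≈⟨ eval-congʳ F w^qq ⟨
    eval F (w ^ (q ℕ.* q))            ≈⟨ powerMap-* {q} {q} e e F w ⟨
    eval F w ^ (q ℕ.* q)              ≈⟨ ^-congʳ (eval F w) (≡.sym (ℕ.m+[n∸m]≡n 1+q≤qq)) ⟩
    eval F w ^ (suc q ℕ.+ d)          ≈⟨ ^-homo-* (eval F w) (suc q) d ⟩
    eval F w * eval F w ^ q * eval F w ^ d ≈⟨ *-congʳ (*-congˡ (e F w)) ⟩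
    eval F w * eval F (w ^ q) * eval F w ^ d ≈⟨ *-congʳ zero-product ⟩
    0# * eval F w ^ d                 ≈⟨ zeroˡ _ ⟩
    0#                                ∎
    where
    d : ℕ
    d = q ℕ.* q ℕ.∸ suc q
    1+q≤qq : suc q ℕ.≤ q ℕ.* q
    1+q≤qq = ℕ.<-≤-trans (ℕ.m<m+n q {q} (ℕ.<-≤-trans ℕ.z<s 2≤q))
               (ℕ.≤-trans (ℕ.≤-reflexive (cong (q ℕ.+_) (≡.sym (ℕ.+-identityʳ q)))) (ℕ.*-monoˡ-≤ q 2≤q))

  ×≈ι* : ∀ n x → n ×′ x ≈ ι (+ n) * x
  ×≈ι* zero x = sym (trans (*-congʳ ι-0) (zeroˡ x))
  ×≈ι* (suc n) x = begin
    x + n ×′ x               ≈⟨ +-cong (sym (*-identityˡ x)) (×≈ι* n x) ⟩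
    1# * x + ι (+ n) * x     ≈⟨ distribʳ x 1# _ ⟨
    (1# + ι (+ n)) * x       ≈⟨ *-congʳ (trans (ι-+ (+ 1) (+ n)) (+-congʳ ι-1)) ⟨
    ι (+ suc n) * x          ∎

  module _ {p : ℕ} (pp : Prime p) (ιp≈0 : ι (+ p) ≈ 0#) where

    multiple-zero : ∀ {n} x → p ℕ.∣ n → n ×′ x ≈ 0#
    multiple-zero {n} x (ℕ.divides q ≡.refl) = begin
      (q ℕ.* p) ×′ x          ≈⟨ ×≈ι* (q ℕ.* p) x ⟩
      ι (+ (q ℕ.* p)) * x     ≈⟨ *-congʳ (trans (ι-cong (ℤ.pos-* q p)) (ι-* (+ q) (+ p))) ⟩
      ι (+ q) * ι (+ p) * x   ≈⟨ *-congʳ (trans (*-congˡ ιp≈0) (zeroʳ _)) ⟩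
      0# * x                  ≈⟨ zeroˡ x ⟩
      0#                      ∎

    frobenius-+ : ∀ x y → (x + y) ^ p ≈ x ^ p + y ^ p
    frobenius-+ x y = trans (theorem p x y) (expand p ≡.refl)
      where
      -- The prime is replaced by a variable equal to it, which can be matched as a successor to
      -- split off the first and the last binomial term.
      expand : ∀ n → n ≡ p → sum (binomialTerm x y n) ≈ x ^ n + y ^ n
      expand zero 0≡p = contradiction (≡.subst (1 ℕ.<_) (≡.sym 0≡p) (prime>1 pp)) λ ()
      expand (suc m) ≡.refl = begin
        t zero + sum (λ i → t (suc i))
          ≈⟨ +-congˡ (sum-init-last (λ i → t (suc i))) ⟩
        t zero + (sum (λ i → t (suc (inject₁ i))) + t (suc (fromℕ m)))
          ≈⟨ +-cong first (+-cong (trans (sum-cong-≋ middle) (sum-replicate-zero m)) last) ⟩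
        y ^ suc m + (0# + x ^ suc m)
          ≈⟨ trans (+-congˡ (+-identityˡ _)) (+-comm _ _) ⟩
        x ^ suc m + y ^ suc m ∎
        where
        t : Fin (suc (suc m)) → Carrier
        t = binomialTerm x y (suc m)
        first : t zero ≈ y ^ suc m
        first = trans (+-identityʳ _) (*-identityˡ _)
        middle : ∀ i → t (suc (inject₁ i)) ≈ replicate m 0# i
        middle i = multiple-zero _ (≡.subst (λ k → p ℕ.∣ p C suc k) (≡.sym (Fin.toℕ-inject₁ i))
                     (prime∣pCk pp ℕ.z<s (ℕ.s<s (Fin.toℕ<n i))))
        last : t (suc (fromℕ m)) ≈ x ^ suc m
        last rewrite Fin.toℕ-fromℕ m | nCn≡1 (suc m) | ℕ.n∸n≡0 m = trans (+-identityʳ _) (*-identityʳ _)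

    frobenius-0 : 0# ^ p ≈ 0#
    frobenius-0 = 0^ p (prime>1 pp)
      where
      0^ : ∀ n → 1 ℕ.< n → 0# ^ n ≈ 0#
      0^ (suc n) _ = zeroˡ _

    frobenius-ℕ : ∀ n → ι (+ n) ^ p ≈ ι (+ n)
    frobenius-ℕ zero = trans (^-congˡ p ι-0) (trans frobenius-0 (sym ι-0))
    frobenius-ℕ (suc n) = begin
      ι (+ suc n) ^ p         ≈⟨ ^-congˡ p (ι-+ (+ 1) (+ n)) ⟩
      (ι (+ 1) + ι (+ n)) ^ p ≈⟨ frobenius-+ _ _ ⟩
      ι (+ 1) ^ p + ι (+ n) ^ p ≈⟨ +-cong (trans (^-congˡ p ι-1) (trans (1^n≈1 p) (sym ι-1))) (frobenius-ℕ n) ⟩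
      ι (+ 1) + ι (+ n)       ≈⟨ ι-+ (+ 1) (+ n) ⟨
      ι (+ suc n)             ∎

    frobenius-ι : ∀ a → ι a ^ p ≈ ι a
    frobenius-ι (+ n) = frobenius-ℕ n
    -- Additivity applied to -n + n = 0 gives the power of -n uniformly in p, with p = 2 included.
    frobenius-ι -[1+ n ] = begin
      ι -[1+ n ] ^ p                                      ≈⟨ +-identityʳ _ ⟨
      ι -[1+ n ] ^ p + 0#                                 ≈⟨ +-congˡ (-‿inverseʳ (ι (+ suc n))) ⟨
      ι -[1+ n ] ^ p + (ι (+ suc n) - ι (+ suc n))        ≈⟨ +-assoc _ _ _ ⟨
      ι -[1+ n ] ^ p + ι (+ suc n) - ι (+ suc n)          ≈⟨ +-congʳ (+-congˡ (frobenius-ℕ (suc n))) ⟨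
      ι -[1+ n ] ^ p + ι (+ suc n) ^ p - ι (+ suc n)      ≈⟨ +-congʳ (frobenius-+ _ _) ⟨
      (ι -[1+ n ] + ι (+ suc n)) ^ p - ι (+ suc n)        ≈⟨ +-congʳ (^-congˡ p (trans (sym (ι-+ _ _)) (trans (ι-cong (ℤ.+-inverseˡ (+ suc n))) ι-0))) ⟩
      0# ^ p - ι (+ suc n)                                ≈⟨ +-congʳ frobenius-0 ⟩
      0# - ι (+ suc n)                                    ≈⟨ +-identityˡ _ ⟩
      - ι (+ suc n)                                       ≈⟨ ι-neg (+ suc n) ⟨
      ι -[1+ n ]                                          ∎

    frobenius : PowerMap p
    frobenius [] r = frobenius-0
    frobenius (c ∷ F) r = begin
      (ι c + r * eval F r) ^ p          ≈⟨ frobenius-+ _ _ ⟩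
      ι c ^ p + (r * eval F r) ^ p      ≈⟨ +-cong (frobenius-ι c) (^-distrib-* r (eval F r) p) ⟩
      ι c + r ^ p * eval F r ^ p        ≈⟨ +-congˡ (*-congˡ (frobenius F r)) ⟩
      ι c + r ^ p * eval F (r ^ p)      ∎

-- Quotients of ℤ[X]

ℤalg : ℤAlgebra
ℤalg = record
  { commutativeRing = ℤ.+-*-commutativeRing
  ; ι = λ a → a
  ; ι-+ = λ _ _ → ≡.refl ; ι-* = λ _ _ → ≡.refl ; ι-neg = λ _ → ≡.refl ; ι-0 = ≡.refl ; ι-1 = ≡.refl }

polyAlgebra : ℤAlgebra
polyAlgebra = record
  { commutativeRing = polyRing
  ; ι = cst
  ; ι-+ = λ _ _ → ≑-refl
  ; ι-* = λ a b → ∷-cong (≡.sym (ℤ.+-identityʳ (a ℤ.* b))) ≑-refl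
  ; ι-neg = λ _ → ≑-refl ; ι-0 = 0∷[]≑[] ; ι-1 = ≑-refl }

ℤ[X]/ : Poly → Poly → ℤAlgebra
ℤ[X]/ f c = Quotient.quotient polyAlgebra f c

ℤ/ : ℤ → ℤAlgebra
ℤ/ d = Quotient.quotient ℤalg d (+ 0)

ℤ/-ι-injective : ∀ d {a b} → ℤAlgebra._≈_ (ℤ/ d) a b → d ℤ.∣ a ℤ.- b
ℤ/-ι-injective d {a} {b} (Quotient.ideal {h} {k} e) = ℤ.divides h (≡.trans e (lemma d h k))
  where
  lemma : ∀ d h k → d ℤ.* h ℤ.+ + 0 ℤ.* k ≡ h ℤ.* d
  lemma = solve-∀

IsZero : Poly → Set
IsZero = All (_≡ + 0)

isZero? : ∀ p → Dec (IsZero p)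
isZero? = all? (ℤ._≟ + 0)

isZero⇒≑[] : ∀ {p} → IsZero p → p ≑ []
isZero⇒≑[] [] = ≑-refl
isZero⇒≑[] (≡.refl ∷ z) = ≑-trans (∷-cong ≡.refl (isZero⇒≑[] z)) 0∷[]≑[]

-- Closed identities are settled by evaluating the difference. Its list may keep trailing zeros, so
-- the test is that all entries vanish.
decide-≑ : ∀ p q → {True (isZero? (p -ₚ q))} → p ≑ q
decide-≑ p q {t} = begin
  p                    ≈⟨ solve 2 (λ p q → p := (p :- q) :+ q) refl p q ⟩
  (p + - q) + q        ≈⟨ +-congʳ (isZero⇒≑[] (toWitness t)) ⟩
  0# + q               ≈⟨ +-identityˡ q ⟩
  q                    ∎
  where
  open ℤAlgebra polyAlgebra
  open IntegerSolver polyAlgebra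
  open import Relation.Binary.Reasoning.Setoid setoid

cst-*ₚ : ∀ c p → cst c *ₚ p ≑ scale c p
cst-*ₚ c p = ≑-trans (+ₚ-congˡ (scale c p) 0∷[]≑[]) (+ₚ-identityʳ (scale c p))

0∷≑X*ₚ : ∀ p → (+ 0 ∷ p) ≑ X^ 1 *ₚ p
0∷≑X*ₚ p = ≑-sym (≑-trans (0∷-*ₚ [ + 1 ] p) (∷-cong ≡.refl (*ₚ-identityˡ p)))

coeff-X^*ₚ : ∀ n p i → coeff (X^ n *ₚ p) (n ℕ.+ i) ≡ coeff p i
coeff-X^*ₚ zero p i = _≑_.coeffs (*ₚ-identityˡ p) i
coeff-X^*ₚ (suc n) p i = ≡.trans (_≑_.coeffs (0∷-*ₚ (X^ n) p) (suc (n ℕ.+ i))) (coeff-X^*ₚ n p i)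

coeff-≥length : ∀ p n → length p ℕ.≤ n → coeff p n ≡ + 0
coeff-≥length [] n _ = ≡.refl
coeff-≥length (a ∷ p) (suc n) (ℕ.s≤s l) = coeff-≥length p n l

-- Serves to show that integers congruent modulo (f, d) are congruent modulo d. Passing from f to Xⁿ
-- - 1 turns multiplication into a shift by n; the length bound makes the cofactor vanish at all
-- positive multiples of n.
record DividesXⁿ-1 (f : Poly) : Set where
  field
    n-1 : ℕ
    cofactor : Poly
    factorisation : f *ₚ cofactor ≑ X^ (suc n-1) -ₚ cst (+ 1)
    cofactor₀ : coeff cofactor 0 ≡ -[1+ 0 ]
    cofactor-short : length cofactor ℕ.≤ suc n-1

-- If f h = a in ℤ[X] modulo d, then (Xⁿ - 1) h = a g modulo d, so the coefficients of h at all
-- multiples of n agree with a modulo d; far enough out they vanish.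
ℤ[X]/-ι-injective : ∀ {f} → DividesXⁿ-1 f → ∀ d {a b} →
  ℤAlgebra._≈_ (ℤ[X]/ f (cst d)) (cst a) (cst b) → d ℤ.∣ a ℤ.- b
ℤ[X]/-ι-injective {f} D d {a} {b} (Quotient.ideal {h} {k} e) =
  ≡.subst (d ℤ.∣_) zero-at (multiples (length h))
  where
  open DividesXⁿ-1 D
  n : ℕ
  n = suc n-1
  c : ℤ
  c = a ℤ.- b
  g : Poly
  g = cofactor
  u : Poly
  u = k *ₚ g

  identity : cst c *ₚ g ≑ ((X^ n *ₚ h) -ₚ h) +ₚ cst d *ₚ u
  identity = begin
    cst c * g                                   ≈⟨ *-congʳ e ⟩
    (f * h + cst d * k) * g                     ≈⟨ solve 5 (λ f h d k g → (f :* h :+ d :* k) :* g := (f :* g) :* h :+ d :* (k :* g)) refl f h (cst d) k g ⟩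
    (f * g) * h + cst d * u                     ≈⟨ +-congʳ (*-congʳ factorisation) ⟩
    (X^ n -ₚ cst (+ 1)) * h + cst d * u         ≈⟨ +-congʳ (solve 2 (λ x h → (x :- con (+ 1)) :* h := x :* h :- h) refl (X^ n) h) ⟩
    (X^ n * h - h) + cst d * u                  ∎
    where
    open ℤAlgebra polyAlgebra
    open IntegerSolver polyAlgebra
    open import Relation.Binary.Reasoning.Setoid setoid

  at : ∀ i → c ℤ.* coeff g i ≡ (coeff (X^ n *ₚ h) i ℤ.- coeff h i) ℤ.+ d ℤ.* coeff u i
  at i = begin
    c ℤ.* coeff g i                                     ≡⟨ coeff-scale c g i ⟨
    coeff (scale c g) i                                 ≡⟨ _≑_.coeffs (cst-*ₚ c g) i ⟨
    coeff (cst c *ₚ g) i                                ≡⟨ _≑_.coeffs identity i ⟩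
    coeff (((X^ n *ₚ h) -ₚ h) +ₚ cst d *ₚ u) i            ≡⟨ coeff-+ ((X^ n *ₚ h) -ₚ h) (cst d *ₚ u) i ⟩
    coeff ((X^ n *ₚ h) -ₚ h) i ℤ.+ coeff (cst d *ₚ u) i   ≡⟨ cong₂ ℤ._+_ (≡.trans (coeff-+ (X^ n *ₚ h) (-ₚ h) i)
                                                                           (cong (λ z → coeff (X^ n *ₚ h) i ℤ.+ z) (coeff-neg h i)))
                                                                        (≡.trans (_≑_.coeffs (cst-*ₚ d u) i) (coeff-scale d u i)) ⟩
    (coeff (X^ n *ₚ h) i ℤ.- coeff h i) ℤ.+ d ℤ.* coeff u i ∎
    where open ≡.≡-Reasoning

  rearrange₀ : ∀ c g x h t → c ℤ.* g ≡ (x ℤ.- h) ℤ.+ t → g ≡ -[1+ 0 ] → x ≡ + 0 → c ℤ.- h ≡ ℤ.- t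
  rearrange₀ c _ _ h t eq ≡.refl ≡.refl = ≡.trans (lemma₁ c h) (≡.trans (cong (λ z → ℤ.- z ℤ.- h) eq) (lemma₂ h t))
    where
    lemma₁ : ∀ c h → c ℤ.- h ≡ ℤ.- (c ℤ.* -[1+ 0 ]) ℤ.- h
    lemma₁ = solve-∀
    lemma₂ : ∀ h t → ℤ.- ((+ 0 ℤ.- h) ℤ.+ t) ℤ.- h ≡ ℤ.- t
    lemma₂ = solve-∀

  rearrange₁ : ∀ c g x h t → c ℤ.* g ≡ (x ℤ.- h) ℤ.+ t → g ≡ + 0 → c ℤ.- h ≡ (c ℤ.- x) ℤ.+ ℤ.- t
  rearrange₁ c _ x h t eq ≡.refl = ≡.trans (lemma₁ c x h t) (≡.trans (cong (λ z → (c ℤ.- x) ℤ.+ ℤ.- t ℤ.+ z) (≡.trans (≡.sym eq) (ℤ.*-zeroʳ c))) (ℤ.+-identityʳ _))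
    where
    lemma₁ : ∀ c x h t → c ℤ.- h ≡ (c ℤ.- x) ℤ.+ ℤ.- t ℤ.+ ((x ℤ.- h) ℤ.+ t)
    lemma₁ = solve-∀

  d∣-d* : ∀ z → d ℤ.∣ ℤ.- (d ℤ.* z)
  d∣-d* z = ℤ.∣m⇒∣-m (ℤ.∣m⇒∣m*n z ℤ.∣-refl)

  multiples : ∀ j → d ℤ.∣ c ℤ.- coeff h (j ℕ.* n)
  multiples zero = ≡.subst (d ℤ.∣_) (≡.sym (rearrange₀ c _ _ (coeff h 0) _ (at 0) cofactor₀ (_≑_.coeffs (0∷-*ₚ (X^ n-1) h) 0))) (d∣-d* (coeff u 0))
  multiples (suc j) = ≡.subst (d ℤ.∣_)
    (≡.sym (rearrange₁ c _ (coeff h (j ℕ.* n)) (coeff h i) (d ℤ.* coeff u i)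
      (≡.trans (at i) (cong (λ z → (z ℤ.- coeff h i) ℤ.+ d ℤ.* coeff u i) (coeff-X^*ₚ n h (j ℕ.* n))))
      (coeff-≥length g i (ℕ.≤-trans cofactor-short (ℕ.m≤m+n n (j ℕ.* n))))))
    (ℤ.∣m∣n⇒∣m+n (multiples j) (d∣-d* (coeff u i)))
    where
    i : ℕ
    i = suc j ℕ.* n

  -- The index lies past the end of `h` because n is at least 1.
  zero-at : c ℤ.- coeff h (length h ℕ.* n) ≡ a ℤ.- b
  zero-at = ≡.trans (cong (λ z → c ℤ.- z) (coeff-≥length h _ (ℕ.m≤m*n (length h) n))) (ℤ.+-identityʳ c)

Φ3∣X³-1 : DividesXⁿ-1 Φ3
Φ3∣X³-1 = record { n-1 = 2 ; cofactor = -[1+ 0 ] ∷ + 1 ∷ [] ; factorisation = decide-≑ _ _ ; cofactor₀ = ≡.refl ; cofactor-short = ℕ.s≤s (ℕ.s≤s ℕ.z≤n) }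

Φ5∣X⁵-1 : DividesXⁿ-1 Φ5
Φ5∣X⁵-1 = record { n-1 = 4 ; cofactor = -[1+ 0 ] ∷ + 1 ∷ [] ; factorisation = decide-≑ _ _ ; cofactor₀ = ≡.refl ; cofactor-short = ℕ.s≤s (ℕ.s≤s ℕ.z≤n) }

Φ15∣X¹⁵-1 : DividesXⁿ-1 Φ15
Φ15∣X¹⁵-1 = record
  { n-1 = 14 ; cofactor = (X^ 1 -ₚ cst (+ 1)) *ₚ Φ3 *ₚ Φ5
  ; factorisation = decide-≑ _ _ ; cofactor₀ = ≡.refl ; cofactor-short = ℕ.m≤m+n 8 7 }

module PolyQuotient (f c : Poly) where
  open ℤAlgebra (ℤ[X]/ f c)
  open Evaluation (ℤ[X]/ f c)
  open Quotient polyAlgebra f c using (~-lift)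

  x : Poly
  x = X^ 1

  ∘x^≡eval : ∀ F j → F ∘x^ j ≡ eval F (X^ j)
  ∘x^≡eval [] j = ≡.refl
  ∘x^≡eval (a ∷ F) j = cong (λ z → cst a +ₚ X^ j *ₚ z) (∘x^≡eval F j)

  X^≈x^ : ∀ n → X^ n ≈ x ^ n
  X^≈x^ zero = refl
  X^≈x^ (suc n) = trans (~-lift (0∷≑X*ₚ (X^ n))) (*-congˡ {X^ 1} (X^≈x^ n))

  ∘x^≈eval : ∀ F j → F ∘x^ j ≈ eval F (x ^ j)
  ∘x^≈eval F j = trans (reflexive (∘x^≡eval F j)) (eval-congʳ F (X^≈x^ j))

  -- The vanishing of a value at `x` thereby becomes membership of the polynomial itself in the
  -- ideal.
  eval-x : ∀ F → eval F x ≈ F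
  eval-x [] = refl
  eval-x (a ∷ F) = trans (+-congˡ {cst a} (*-congˡ {x} (eval-x F)))
    (~-lift (≑-trans (+ₚ-congˡ (cst a) (≑-sym (0∷≑X*ₚ F))) (∷-cong (ℤ.+-identityʳ a) ≑-refl)))

  -- `h` and `k` are an explicit certificate that p - q lies in the ideal (f, c).
  by-computation : ∀ p q h k → {True (isZero? ((p -ₚ q) -ₚ (f *ₚ h +ₚ c *ₚ k)))} → p ≈ q
  by-computation p q h k {t} = Quotient.ideal {h = h} {k} (decide-≑ (p -ₚ q) (f *ₚ h +ₚ c *ₚ k) {t})

-- Congruences between the norms

n1 : Poly → ℤ
n1 [] = + 0
n1 (c ∷ p) = c ℤ.+ n1 p

module EvalOne (A : ℤAlgebra) where
  open ℤAlgebra A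
  open Evaluation A

  eval-1 : ∀ p {r} → r ≈ 1# → eval p r ≈ ι (n1 p)
  eval-1 [] e = sym ι-0
  eval-1 (c ∷ p) e = sym (trans (ι-+ c (n1 p)) (+-congˡ (trans (sym (*-identityˡ _)) (*-cong (sym e) (sym (eval-1 p e))))))

-- Modulo 3 the element 1 is a root of Φ₃, and both factors of the norm become F(1).
n3≡n1² : ∀ F → + 3 ℤ.∣ n3 F ℤ.- n1 F ℤ.* n1 F
n3≡n1² F = ℤ/-ι-injective (+ 3) (begin
  n3 F                              ≈⟨ norm3 F {+ 1} (Quotient.generator₁≈0 ℤalg (+ 3) (+ 0)) ⟨
  eval F (+ 1) * eval F (+ 1)       ≈⟨ *-cong (eval-1 F {+ 1} refl) (eval-1 F {+ 1} refl) ⟩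
  n1 F * n1 F                       ∎)
  where
  open ℤAlgebra (ℤ/ (+ 3))
  open Evaluation (ℤ/ (+ 3))
  open EvalOne (ℤ/ (+ 3))
  open Norms (ℤ/ (+ 3))
  open import Relation.Binary.Reasoning.Setoid setoid

-- Modulo 5 the element 1 is a root of Φ₅, and all four factors of the norm become F(1).
n5≡n1⁴ : ∀ F → + 5 ℤ.∣ n5 F ℤ.- n1 F ℤ.* (n1 F ℤ.* (n1 F ℤ.* n1 F))
n5≡n1⁴ F = ℤ/-ι-injective (+ 5) (begin
  n5 F                              ≈⟨ norm5 F {+ 1} (Quotient.generator₁≈0 ℤalg (+ 5) (+ 0)) ⟨
  eval F (+ 1) * (eval F (+ 1) * (eval F (+ 1) * eval F (+ 1))) ≈⟨ *-cong e (*-cong e (*-cong e e)) ⟩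
  n1 F * (n1 F * (n1 F * n1 F))     ∎)
  where
  open ℤAlgebra (ℤ/ (+ 5))
  open Evaluation (ℤ/ (+ 5))
  open EvalOne (ℤ/ (+ 5))
  open Norms (ℤ/ (+ 5))
  open import Relation.Binary.Reasoning.Setoid setoid
  e : eval F (+ 1) ≈ n1 F
  e = eval-1 F {+ 1} refl

module Norm15Mod (A : ℤAlgebra) (F : Poly) where
  open ℤAlgebra A
  open Evaluation A
  open Norms A
  open IntegerSolver A
  open import Relation.Binary.Reasoning.Setoid setoid

  -- A root `x` of Φ₅ takes the place of ω₁₅. Exponents then count modulo 5, and the eight exponents
  -- prime to 15 hit each nonzero class twice.
  n15≈n5² : ∀ {x} → Root5 x → Root3 (x ^ 5) → Root5 (x ^ 3) → ι (n15 F) ≈ ι (n5 F ℤ.* n5 F)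
  n15≈n5² {x} e e₃ e₅ = begin
    ι (n15 F)                                                   ≈⟨ norm15 F e₃ e₅ ⟨
    f 1 * (f 2 * (f 4 * (f 7 * (f 8 * (f 11 * (f 13 * f 14))))))
      ≈⟨ *-congˡ (*-congˡ (*-congˡ (*-cong (r 1 2) (*-cong (r 1 3) (*-cong (r 2 1) (*-cong (r 2 3) (r 2 4))))))) ⟩
    f 1 * (f 2 * (f 4 * (f 2 * (f 3 * (f 1 * (f 3 * f 4))))))
      ≈⟨ solve 4 (λ a b c d → a :* (b :* (d :* (b :* (c :* (a :* (c :* d)))))) := (a :* (b :* (c :* d))) :* (a :* (b :* (c :* d)))) refl
           (f 1) (f 2) (f 3) (f 4) ⟩
    (f 1 * (f 2 * (f 3 * f 4))) * (f 1 * (f 2 * (f 3 * f 4)))    ≈⟨ *-cong n n ⟩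
    ι (n5 F) * ι (n5 F)                                         ≈⟨ ι-* _ _ ⟨
    ι (n5 F ℤ.* n5 F)                                           ∎
    where
    f : ℕ → Carrier
    f j = eval F (x ^ j)
    r : ∀ k m → f (m ℕ.+ k ℕ.* 5) ≈ f m
    r k m = eval-congʳ F (^-reduce {n = 5} (root5-^5 e) k m)
    n : f 1 * (f 2 * (f 3 * f 4)) ≈ ι (n5 F)
    n = trans (*-congʳ (eval-congʳ F (*-identityʳ x))) (norm5 F e)

  -- With a root of Φ₃ in place of ω₁₅ exponents count modulo 3, and each nonzero class is hit four
  -- times.
  n15≈n3⁴ : ∀ {x} → Root3 x → Root3 (x ^ 5) → Root5 (x ^ 3) → ι (n15 F) ≈ ι (n3 F ℤ.* (n3 F ℤ.* (n3 F ℤ.* n3 F)))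
  n15≈n3⁴ {x} e e₃ e₅ = begin
    ι (n15 F)                                                   ≈⟨ norm15 F e₃ e₅ ⟨
    f 1 * (f 2 * (f 4 * (f 7 * (f 8 * (f 11 * (f 13 * f 14))))))
      ≈⟨ *-congˡ (*-congˡ (*-cong (r 1 1) (*-cong (r 2 1) (*-cong (r 2 2) (*-cong (r 3 2) (*-cong (r 4 1) (r 4 2))))))) ⟩
    f 1 * (f 2 * (f 1 * (f 1 * (f 2 * (f 2 * (f 1 * f 2))))))
      ≈⟨ solve 2 (λ a b → a :* (b :* (a :* (a :* (b :* (b :* (a :* b)))))) := (a :* b) :* ((a :* b) :* ((a :* b) :* (a :* b)))) refl
           (f 1) (f 2) ⟩
    (f 1 * f 2) * ((f 1 * f 2) * ((f 1 * f 2) * (f 1 * f 2)))    ≈⟨ *-cong n (*-cong n (*-cong n n)) ⟩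
    ι (n3 F) * (ι (n3 F) * (ι (n3 F) * ι (n3 F)))               ≈⟨ refl ⟨*⟩ (refl ⟨*⟩ ι-* _ _) ⟨
    ι (n3 F ℤ.* (n3 F ℤ.* (n3 F ℤ.* n3 F)))                     ∎
    where
    f : ℕ → Carrier
    f j = eval F (x ^ j)
    r : ∀ k m → f (m ℕ.+ k ℕ.* 3) ≈ f m
    r k m = eval-congʳ F (^-reduce {n = 3} (root3-^3 e) k m)
    n : f 1 * f 2 ≈ ι (n3 F)
    n = trans (*-congʳ (eval-congʳ F (*-identityʳ x))) (norm3 F e)

n15≡n5² : ∀ F → + 3 ℤ.∣ n15 F ℤ.- n5 F ℤ.* n5 F
n15≡n5² F = ℤ[X]/-ι-injective Φ5∣X⁵-1 (+ 3) (Norm15Mod.n15≈n5² A F {x} e e₃ e₅)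
  where
  A : ℤAlgebra
  A = ℤ[X]/ Φ5 (cst (+ 3))
  open PolyQuotient Φ5 (cst (+ 3))
  open Norms A
  e : Root5 x
  e = by-computation _ [] (cst (+ 1)) []
  e₃ : Root3 (ℤAlgebra._^_ A x 5)
  -- Φ₃(y) = 3 + (y - 1)(y + 2) at y = X⁵, where X⁵ - 1 = (X - 1)Φ₅.
  e₃ = by-computation _ [] ((X^ 1 -ₚ cst (+ 1)) *ₚ (X^ 5 +ₚ cst (+ 2))) (cst (+ 1))
  e₅ : Root5 (ℤAlgebra._^_ A x 3)
  -- Φ₅(X³) = Φ₅Φ₁₅.
  e₅ = by-computation _ [] Φ15 []

n15≡n3⁴ : ∀ F → + 5 ℤ.∣ n15 F ℤ.- n3 F ℤ.* (n3 F ℤ.* (n3 F ℤ.* n3 F))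
n15≡n3⁴ F = ℤ[X]/-ι-injective Φ3∣X³-1 (+ 5) (Norm15Mod.n15≈n3⁴ A F {x} e e₃ e₅)
  where
  A : ℤAlgebra
  A = ℤ[X]/ Φ3 (cst (+ 5))
  open PolyQuotient Φ3 (cst (+ 5))
  open Norms A
  e : Root3 x
  e = by-computation _ [] (cst (+ 1)) []
  e₃ : Root3 (ℤAlgebra._^_ A x 5)
  e₃ = by-computation _ [] Φ15 []
  e₅ : Root5 (ℤAlgebra._^_ A x 3)
  -- Φ₅(y) = 5 + (y - 1)(4 + 3y + 2y² + y³) at y = X³, where X³ - 1 = (X - 1)Φ₃.
  e₅ = by-computation _ [] ((X^ 1 -ₚ cst (+ 1)) *ₚ (cst (+ 4) +ₚ cst (+ 3) *ₚ X^ 3 +ₚ cst (+ 2) *ₚ X^ 6 +ₚ X^ 9)) (cst (+ 1))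

-- The ring ℤ[ω₁₅]

ℤ[ω15] : ℤAlgebra
ℤ[ω15] = ℤ[X]/ Φ15 (cst (+ 0))

0*ₚ : ∀ p q → p +ₚ cst (+ 0) *ₚ q ≑ p
0*ₚ p q = ≑-trans (+ₚ-congˡ p (≑-trans (cst-*ₚ (+ 0) q) (scale-0 q))) (+ₚ-identityʳ p)

≈ω⇒≈ : ∀ p q → p ≈ω q → ℤAlgebra._≈_ ℤ[ω15] p q
≈ω⇒≈ p q (h , e) = Quotient.ideal {h = h} {k = []} (≑-trans (mk e) (≑-sym (0*ₚ (Φ15 *ₚ h) [])))

≈⇒≈ω : ∀ {p q} → ℤAlgebra._≈_ ℤ[ω15] p q → p ≈ω q
≈⇒≈ω (Quotient.ideal {h} {k} e) = h , _≑_.coeffs (≑-trans e (0*ₚ (Φ15 *ₚ h) k))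

-- For d = 0 the congruence given by `ℤ[X]/-ι-injective` is an equality.
cst-injective : ∀ a b → cst a ≈ω cst b → a ≡ b
cst-injective a b e = ℤ.i-j≡0⇒i≡j a b (ℤ.0∣⇒≡0 (ℤ[X]/-ι-injective Φ15∣X¹⁵-1 (+ 0) {a} {b} (≈ω⇒≈ (cst a) (cst b) e)))

root15 : Norms.Root3 ℤ[ω15] (ℤAlgebra._^_ ℤ[ω15] (X^ 1) 5) × Norms.Root5 ℤ[ω15] (ℤAlgebra._^_ ℤ[ω15] (X^ 1) 3)
root15 = by-computation _ [] Φ3 [] , by-computation _ [] Φ5 []
  where open PolyQuotient Φ15 (cst (+ 0))

-- The products defining M₁₅, N₃, N₅ and N₁₅

module Norms15 (A : ℤAlgebra) (F : Poly) {r : ℤAlgebra.Carrier A}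
  (e₃ : Norms.Root3 A (ℤAlgebra._^_ A r 5)) (e₅ : Norms.Root5 A (ℤAlgebra._^_ A r 3)) where
  open ℤAlgebra A
  open Evaluation A
  open EvalOne A
  open Norms A
  open IntegerSolver A
  open import Relation.Binary.Reasoning.Setoid setoid

  f : ℕ → Carrier
  f j = eval F (r ^ j)

  product3 : f 5 * (f 10 * 1#) ≈ ι (n3 F)
  product3 = trans (*-congˡ (trans (*-identityʳ _) (eval-congʳ F (sym (^-assocʳ r 5 2))))) (norm3 F e₃)

  product5 : f 3 * (f 6 * (f 9 * (f 12 * 1#))) ≈ ι (n5 F)
  product5 = trans (*-congˡ (*-cong (g 2) (*-cong (g 3) (trans (*-identityʳ _) (g 4))))) (norm5 F e₅)
    where
    g : ∀ i → f (3 ℕ.* i) ≈ eval F ((r ^ 3) ^ i)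
    g i = eval-congʳ F (sym (^-assocʳ r 3 i))

  product15 : f 1 * (f 2 * (f 4 * (f 7 * (f 8 * (f 11 * (f 13 * (f 14 * 1#))))))) ≈ ι (n15 F)
  product15 = trans (*-congˡ (*-congˡ (*-congˡ (*-congˡ (*-congˡ (*-congˡ (*-congˡ (*-identityʳ _)))))))) (norm15 F e₃ e₅)

  product1 : f 15 ≈ ι (n1 F)
  product1 = eval-1 F (trans (sym (^-assocʳ r 5 3)) (root3-^3 e₃))

  -- The exponents 1 to 15 are sorted by their gcd with 15. The order and the final `1#` match the
  -- unfolding of `prodₚ`.
  product-all : f 1 * (f 2 * (f 3 * (f 4 * (f 5 * (f 6 * (f 7 * (f 8 * (f 9 * (f 10 * (f 11 * (f 12 * (f 13 * (f 14 * (f 15 * 1#))))))))))))))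
    ≈ ι (n1 F ℤ.* n3 F ℤ.* n5 F ℤ.* n15 F)
  product-all = begin
    _ ≈⟨ CM.solve 15 (λ f₁ f₂ f₃ f₄ f₅ f₆ f₇ f₈ f₉ f₁₀ f₁₁ f₁₂ f₁₃ f₁₄ f₁₅ →
           f₁ ⊕ (f₂ ⊕ (f₃ ⊕ (f₄ ⊕ (f₅ ⊕ (f₆ ⊕ (f₇ ⊕ (f₈ ⊕ (f₉ ⊕ (f₁₀ ⊕ (f₁₁ ⊕ (f₁₂ ⊕ (f₁₃ ⊕ (f₁₄ ⊕ (f₁₅ ⊕ id))))))))))))))
           ⊜ (((f₁₅ ⊕ (f₅ ⊕ (f₁₀ ⊕ id))) ⊕ (f₃ ⊕ (f₆ ⊕ (f₉ ⊕ (f₁₂ ⊕ id))))) ⊕ (f₁ ⊕ (f₂ ⊕ (f₄ ⊕ (f₇ ⊕ (f₈ ⊕ (f₁₁ ⊕ (f₁₃ ⊕ (f₁₄ ⊕ id)))))))))) refl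
           (f 1) (f 2) (f 3) (f 4) (f 5) (f 6) (f 7) (f 8) (f 9) (f 10) (f 11) (f 12) (f 13) (f 14) (f 15) ⟩
    f 15 * (f 5 * (f 10 * 1#)) * (f 3 * (f 6 * (f 9 * (f 12 * 1#)))) * (f 1 * (f 2 * (f 4 * (f 7 * (f 8 * (f 11 * (f 13 * (f 14 * 1#))))))))
      ≈⟨ *-cong (*-cong (*-cong product1 product3) product5) product15 ⟩
    ι (n1 F) * ι (n3 F) * ι (n5 F) * ι (n15 F) ≈⟨ ι-* _ _ ⟨*⟩ refl ⟨*⟩ refl ⟨
    ι (n1 F ℤ.* n3 F ℤ.* n5 F ℤ.* n15 F) ∎
    where
    open module CM = Algebra.Solver.CommutativeMonoid *-commutativeMonoid using (_⊕_; id; _⊜_)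

module _ (F : Poly) where
  open ℤAlgebra ℤ[ω15]
  open PolyQuotient Φ15 (cst (+ 0))
  open Norms15 ℤ[ω15] F {X^ 1} (proj₁ root15) (proj₂ root15)

  prodₚ-cong : ∀ js → prodₚ (map (λ j → F ∘x^ j) js) ≈ foldr _*_ 1# (map f js)
  prodₚ-cong [] = refl
  prodₚ-cong (j ∷ js) = *-cong (∘x^≈eval F j) (prodₚ-cong js)

  N3≈n3 : N3 F ≈ω cst (n3 F)
  N3≈n3 = ≈⇒≈ω (trans (prodₚ-cong (5 ∷ 10 ∷ [])) product3)

  N5≈n5 : N5 F ≈ω cst (n5 F)
  N5≈n5 = ≈⇒≈ω (trans (prodₚ-cong (3 ∷ 6 ∷ 9 ∷ 12 ∷ [])) product5)

  N15≈n15 : N15 F ≈ω cst (n15 F)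
  N15≈n15 = ≈⇒≈ω (trans (prodₚ-cong (1 ∷ 2 ∷ 4 ∷ 7 ∷ 8 ∷ 11 ∷ 13 ∷ 14 ∷ [])) product15)

  M15≈product : M15 F ≈ω cst (n1 F ℤ.* n3 F ℤ.* n5 F ℤ.* n15 F)
  M15≈product = ≈⇒≈ω (trans (prodₚ-cong (oneTo 15)) product-all)

  M15-value : ∀ k → M15 F ≈ω cst k → n1 F ℤ.* n3 F ℤ.* n5 F ℤ.* n15 F ≡ k
  M15-value k e = cst-injective _ k (≈⇒≈ω (trans (sym (≈ω⇒≈ (M15 F) _ M15≈product)) (≈ω⇒≈ (M15 F) (cst k) e)))

-- Euclidean division in ℤ[φ]

infixl 7 _*φ_
infixl 6 _+φ_

-- The pair (a , b) stands for a + bφ with φ² = φ + 1.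
_+φ_ _*φ_ : ℤ × ℤ → ℤ × ℤ → ℤ × ℤ
(a , b) +φ (c , d) = a ℤ.+ c , b ℤ.+ d
(a , b) *φ (c , d) = a ℤ.* c ℤ.+ b ℤ.* d , a ℤ.* d ℤ.+ b ℤ.* c ℤ.+ b ℤ.* d

-φ_ : ℤ × ℤ → ℤ × ℤ
-φ (a , b) = ℤ.- a , ℤ.- b

ℤ[φ] : CommutativeRing 0ℓ 0ℓ
ℤ[φ] = record
  { Carrier = ℤ × ℤ ; _≈_ = _≡_ ; _+_ = _+φ_ ; _*_ = _*φ_ ; -_ = -φ_ ; 0# = + 0 , + 0 ; 1# = + 1 , + 0
  ; isCommutativeRing = record
    { isRing = record
      { +-isAbelianGroup = record
        { isGroup = record
          { isMonoid = record
            { isSemigroup = record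
              { isMagma = record { isEquivalence = ≡.isEquivalence ; ∙-cong = cong₂ _+φ_ }
              ; assoc = λ (a , b) (c , d) (e , f) → cong₂ _,_ (ℤ.+-assoc a c e) (ℤ.+-assoc b d f) }
            ; identity = (λ (a , b) → cong₂ _,_ (ℤ.+-identityˡ a) (ℤ.+-identityˡ b))
                       , (λ (a , b) → cong₂ _,_ (ℤ.+-identityʳ a) (ℤ.+-identityʳ b)) }
          ; inverse = (λ (a , b) → cong₂ _,_ (ℤ.+-inverseˡ a) (ℤ.+-inverseˡ b))
                    , (λ (a , b) → cong₂ _,_ (ℤ.+-inverseʳ a) (ℤ.+-inverseʳ b))
          ; ⁻¹-cong = cong -φ_ }
        ; comm = λ (a , b) (c , d) → cong₂ _,_ (ℤ.+-comm a c) (ℤ.+-comm b d) }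
      ; *-cong = cong₂ _*φ_
      ; *-assoc = *φ-assoc
      ; *-identity = *φ-identityˡ , λ z → ≡.trans (*φ-comm z (+ 1 , + 0)) (*φ-identityˡ z)
      ; distrib = *φ-distribˡ , λ z x y → ≡.trans (*φ-comm (x +φ y) z) (≡.trans (*φ-distribˡ z x y) (cong₂ _+φ_ (*φ-comm z x) (*φ-comm z y))) }
    ; *-comm = *φ-comm } }
  where
  open +-*-Solver
  _⊗_ _⊕_ : ∀ {n} → Polynomial n × Polynomial n → Polynomial n × Polynomial n → Polynomial n × Polynomial n
  (a , b) ⊗ (c , d) = a :* c :+ b :* d , a :* d :+ b :* c :+ b :* d
  (a , b) ⊕ (c , d) = a :+ c , b :+ d
  *φ-comm : ∀ x y → x *φ y ≡ y *φ x
  *φ-comm (a , b) (c , d) = cong₂ _,_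
    (solve 4 (λ a b c d → proj₁ ((a , b) ⊗ (c , d)) := proj₁ ((c , d) ⊗ (a , b))) ≡.refl a b c d)
    (solve 4 (λ a b c d → proj₂ ((a , b) ⊗ (c , d)) := proj₂ ((c , d) ⊗ (a , b))) ≡.refl a b c d)
  *φ-assoc : ∀ x y z → (x *φ y) *φ z ≡ x *φ (y *φ z)
  *φ-assoc (a , b) (c , d) (e , f) = cong₂ _,_
    (solve 6 (λ a b c d e f → proj₁ (((a , b) ⊗ (c , d)) ⊗ (e , f)) := proj₁ ((a , b) ⊗ ((c , d) ⊗ (e , f)))) ≡.refl a b c d e f)
    (solve 6 (λ a b c d e f → proj₂ (((a , b) ⊗ (c , d)) ⊗ (e , f)) := proj₂ ((a , b) ⊗ ((c , d) ⊗ (e , f)))) ≡.refl a b c d e f)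
  *φ-identityˡ : ∀ x → (+ 1 , + 0) *φ x ≡ x
  *φ-identityˡ (a , b) = cong₂ _,_
    (solve 2 (λ a b → proj₁ ((con (+ 1) , con (+ 0)) ⊗ (a , b)) := a) ≡.refl a b)
    (solve 2 (λ a b → proj₂ ((con (+ 1) , con (+ 0)) ⊗ (a , b)) := b) ≡.refl a b)
  *φ-distribˡ : ∀ x y z → x *φ (y +φ z) ≡ x *φ y +φ x *φ z
  *φ-distribˡ (a , b) (c , d) (e , f) = cong₂ _,_
    (solve 6 (λ a b c d e f → proj₁ ((a , b) ⊗ ((c , d) ⊕ (e , f))) := proj₁ (((a , b) ⊗ (c , d)) ⊕ ((a , b) ⊗ (e , f)))) ≡.refl a b c d e f)
    (solve 6 (λ a b c d e f → proj₂ ((a , b) ⊗ ((c , d) ⊕ (e , f))) := proj₂ (((a , b) ⊗ (c , d)) ⊕ ((a , b) ⊗ (e , f)))) ≡.refl a b c d e f)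

Nφ-* : ∀ x y → Nφ (x *φ y) ≡ Nφ x ℤ.* Nφ y
Nφ-* (a , b) (c , d) = solve 4 (λ a b c d → N (a :* c :+ b :* d) (a :* d :+ b :* c :+ b :* d) := N a b :* N c d) ≡.refl a b c d
  where
  open +-*-Solver
  N : ∀ {n} → Polynomial n → Polynomial n → Polynomial n
  N s t = s :* s :+ s :* t :- t :* t

module Euclidean (R : CommutativeRing 0ℓ 0ℓ) where
  open CommutativeRing R hiding (zero)
  open import Relation.Binary.Reasoning.Setoid setoid
  open import Algebra.Properties.Ring ring using (-‿distribˡ-*)

  record Bézout (a b : Carrier) : Set where
    field
      {g s t a′ b′} : Carrier
      combination : g ≈ s * a + t * b
      g∣a : a ≈ g * a′
      g∣b : b ≈ g * b′

  module _ (size : Carrier → ℕ) (size-zero : ∀ b → size b ≡ 0 → b ≈ 0#)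
    (divide : ∀ a b → size b ≢ 0 → ∃ λ q → ∃ λ r → a ≈ q * b + r × size r ℕ.< size b) where

    bézout : ∀ a b → Bézout a b
    bézout a b = <-rec (λ n → ∀ a b → size b ≡ n → Bézout a b) step (size b) a b ≡.refl
      where
      step : ∀ n → (∀ {m} → m ℕ.< n → ∀ a b → size b ≡ m → Bézout a b) → ∀ a b → size b ≡ n → Bézout a b
      step n rec a b ≡.refl with size b ℕ.≟ 0
      ... | yes z = record
        { combination = sym (trans (+-cong (*-identityˡ a) (zeroˡ b)) (+-identityʳ a))
        ; g∣a = sym (*-identityʳ a)
        ; g∣b = trans (size-zero b z) (sym (zeroʳ a)) }
      ... | no nz with divide a b nz
      ... | q , r , a≈ , r< with rec r< b r ≡.refl
      ... | record { g = g ; s = s ; t = t ; a′ = b′ ; b′ = r′ ; combination = g≈ ; g∣a = b≈ ; g∣b = r≈ } = record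
        { s = t ; t = s - t * q
        ; combination = begin
            g                                    ≈⟨ g≈ ⟩
            s * b + t * r                        ≈⟨ +-congʳ (+-identityʳ _) ⟨
            s * b + 0# + t * r                   ≈⟨ +-congʳ (+-congˡ (-‿inverseˡ (t * q * b))) ⟨
            s * b + (- (t * q * b) + t * q * b) + t * r ≈⟨ +-congʳ (+-assoc _ _ _) ⟨
            s * b - t * q * b + t * q * b + t * r ≈⟨ +-assoc _ _ _ ⟩
            (s * b - t * q * b) + (t * q * b + t * r) ≈⟨ +-cong (trans (+-congˡ (-‿distribˡ-* _ _)) (sym (distribʳ b s _)))
                                                       (trans (+-congʳ (*-assoc t q b)) (sym (distribˡ t _ r))) ⟩
            (s - t * q) * b + t * (q * b + r)    ≈⟨ +-comm _ _ ⟩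
            t * (q * b + r) + (s - t * q) * b    ≈⟨ +-congʳ (*-congˡ a≈) ⟨
            t * a + (s - t * q) * b              ∎
        ; g∣a = begin
            a                       ≈⟨ a≈ ⟩
            q * b + r               ≈⟨ +-cong (trans (*-congˡ b≈) (trans (sym (*-assoc q g b′)) (trans (*-congʳ (*-comm q g)) (*-assoc g q b′)))) r≈ ⟩
            g * (q * b′) + g * r′   ≈⟨ distribˡ g _ r′ ⟨
            g * (q * b′ + r′)       ∎
        ; g∣b = b≈ }

balanced-division : ∀ u n → n ≢ + 0 → ∃ λ q → ∃ λ r → u ≡ q ℤ.* n ℤ.+ r × 2 ℕ.* ∣ r ∣ ℕ.≤ ∣ n ∣
balanced-division u n n≢0 with 2 ℕ.* (u ℤ.% n) ℕ.≤? ∣ n ∣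
  where instance _ = ℤ.≢-nonZero n≢0
... | yes small = u ℤ./ n , + (u ℤ.% n) , ≡.trans (ℤ.a≡a%n+[a/n]*n u n) (ℤ.+-comm (+ (u ℤ.% n)) ((u ℤ./ n) ℤ.* n)) , small
  where instance _ = ℤ.≢-nonZero n≢0
-- A remainder above half of the modulus is lowered by the absolute value of n, which moves the
-- quotient by the sign of n.
... | no large = u ℤ./ n ℤ.+ sgn , + r ℤ.- + ∣ n ∣ , eq , bound
  where
  instance _ = ℤ.≢-nonZero n≢0
  r : ℕ
  r = u ℤ.% n
  r<n : r ℕ.< ∣ n ∣
  r<n = ℤ.n%d<d u n
  sign-of : ∀ n → ∃ λ e → e ℤ.* n ≡ + ∣ n ∣
  sign-of (+ n) = + 1 , ℤ.*-identityˡ (+ n)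
  sign-of -[1+ n ] = -[1+ 0 ] , ℤ.-1*i≡-i -[1+ n ]
  sgn : ℤ
  sgn = proj₁ (sign-of n)
  eq : u ≡ (u ℤ./ n ℤ.+ sgn) ℤ.* n ℤ.+ (+ r ℤ.- + ∣ n ∣)
  eq = ≡.trans (ℤ.a≡a%n+[a/n]*n u n) (≡.trans (lemma (+ r) (u ℤ./ n) n sgn)
         (cong (λ z → (u ℤ./ n ℤ.+ sgn) ℤ.* n ℤ.+ (+ r ℤ.- z)) (proj₂ (sign-of n))))
    where
    lemma : ∀ r q n s → r ℤ.+ q ℤ.* n ≡ (q ℤ.+ s) ℤ.* n ℤ.+ (r ℤ.- s ℤ.* n)
    lemma = solve-∀
  abs : ∣ + r ℤ.- + ∣ n ∣ ∣ ≡ ∣ n ∣ ℕ.∸ r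
  abs = ≡.trans (cong ∣_∣ (ℤ.m-n≡m⊖n r ∣ n ∣)) (ℤ.∣⊖∣-≤ (ℕ.<⇒≤ r<n))
  bound : 2 ℕ.* ∣ + r ℤ.- + ∣ n ∣ ∣ ℕ.≤ ∣ n ∣
  bound rewrite abs = begin
    2 ℕ.* (∣ n ∣ ℕ.∸ r)                 ≡⟨ ℕ.*-distribˡ-∸ 2 ∣ n ∣ r ⟩
    2 ℕ.* ∣ n ∣ ℕ.∸ 2 ℕ.* r             ≤⟨ ℕ.∸-monoʳ-≤ (2 ℕ.* ∣ n ∣) (ℕ.<⇒≤ (ℕ.≰⇒> large)) ⟩
    2 ℕ.* ∣ n ∣ ℕ.∸ ∣ n ∣               ≡⟨ ℕ.m+n∸m≡n ∣ n ∣ _ ⟩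
    ∣ n ∣ ℕ.+ 0                         ≡⟨ ℕ.+-identityʳ _ ⟩
    ∣ n ∣                               ∎
    where open ℕ.≤-Reasoning

conjφ : ℤ × ℤ → ℤ × ℤ
conjφ (a , b) = a ℤ.+ b , ℤ.- b

sizeφ : ℤ × ℤ → ℕ
sizeφ z = ∣ Nφ z ∣

-- Infinite descent: 5 divides x, and with x = 5c the pair (y , c) solves the same equation; for
-- nonzero y it is smaller.
√5-irrational : ∀ x y → x ℕ.* x ≡ 5 ℕ.* (y ℕ.* y) → y ≡ 0
√5-irrational = <-rec _ step
  where
  step : ∀ x → (∀ {z} → z ℕ.< x → ∀ y → z ℕ.* z ≡ 5 ℕ.* (y ℕ.* y) → y ≡ 0) → ∀ y → x ℕ.* x ≡ 5 ℕ.* (y ℕ.* y) → y ≡ 0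
  step x rec y e with y ℕ.≟ 0
  ... | yes y≡0 = y≡0
  ... | no y≢0 = contradiction y²≡0 λ z → y≢0 (Sum.reduce (ℕ.m*n≡0⇒m≡0∨n≡0 y z))
    where
    5∣x : 5 ℕ.∣ x
    5∣x = Sum.reduce (euclidsLemma x x 5-prime (ℕ.divides (y ℕ.* y) (≡.trans e (ℕ.*-comm 5 (y ℕ.* y)))))
    c : ℕ
    c = ℕ.quotient 5∣x
    y²≡5c² : y ℕ.* y ≡ 5 ℕ.* (c ℕ.* c)
    y²≡5c² = ℕ.*-cancelˡ-≡ (y ℕ.* y) _ 5 (≡.trans (≡.sym e) (≡.trans (cong₂ ℕ._*_ (ℕ._∣_.equality 5∣x) (ℕ._∣_.equality 5∣x)) (lemma c)))
      where
      lemma : ∀ c → (c ℕ.* 5) ℕ.* (c ℕ.* 5) ≡ 5 ℕ.* (5 ℕ.* (c ℕ.* c))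
      lemma = ℕSolver.solve-∀
    y²-zero : 4 ℕ.* (y ℕ.* y) ≡ 0 → y ℕ.* y ≡ 0
    y²-zero z with ℕ.m*n≡0⇒m≡0∨n≡0 4 z
    ... | inj₂ w = w
    y<x : y ℕ.< x
    y<x = ℕ.≰⇒> λ x≤y → ℕ.<⇒≱ (ℕ.m<m+n (y ℕ.* y) {4 ℕ.* (y ℕ.* y)} (ℕ.n≢0⇒n>0 λ z → y≢0 (Sum.reduce (ℕ.m*n≡0⇒m≡0∨n≡0 y (y²-zero z)))))
      (ℕ.≤-trans (ℕ.≤-reflexive (≡.sym e)) (ℕ.*-mono-≤ x≤y x≤y))
    y²≡0 : y ℕ.* y ≡ 0
    y²≡0 = ≡.trans y²≡5c² (cong (λ c → 5 ℕ.* (c ℕ.* c)) (rec y<x c y²≡5c²))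

-- 4N(a + bφ) = (2a + b)² - 5b², so a zero of the norm with b nonzero would make √5 rational.
sizeφ-zero : ∀ z → sizeφ z ≡ 0 → z ≡ (+ 0 , + 0)
sizeφ-zero (a , b) e = cong₂ _,_ a≡0 b≡0
  where
  N≡0 : Nφ (a , b) ≡ + 0
  N≡0 = ℤ.∣i∣≡0⇒i≡0 e
  square : (+ 2 ℤ.* a ℤ.+ b) ℤ.* (+ 2 ℤ.* a ℤ.+ b) ≡ + 5 ℤ.* (b ℤ.* b)
  square = ≡.trans (lemma a b) (≡.trans (cong (λ z → + 4 ℤ.* z ℤ.+ + 5 ℤ.* (b ℤ.* b)) N≡0) (ℤ.+-identityˡ _))
    where
    lemma : ∀ a b → (+ 2 ℤ.* a ℤ.+ b) ℤ.* (+ 2 ℤ.* a ℤ.+ b) ≡ + 4 ℤ.* (a ℤ.* a ℤ.+ a ℤ.* b ℤ.- b ℤ.* b) ℤ.+ + 5 ℤ.* (b ℤ.* b)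
    lemma = solve-∀
  b≡0 : b ≡ + 0
  b≡0 = ℤ.∣i∣≡0⇒i≡0 (√5-irrational ∣ + 2 ℤ.* a ℤ.+ b ∣ ∣ b ∣
    (≡.trans (≡.sym (ℤ.abs-* (+ 2 ℤ.* a ℤ.+ b) (+ 2 ℤ.* a ℤ.+ b))) (≡.trans (cong ∣_∣ square)
      (≡.trans (ℤ.abs-* (+ 5) (b ℤ.* b)) (cong (5 ℕ.*_) (ℤ.abs-* b b))))))
  a²≡0 : a ℤ.* a ≡ + 0
  a²≡0 = ≡.trans (≡.sym (lemma a)) (≡.trans (cong (λ b → Nφ (a , b)) (≡.sym b≡0)) N≡0)
    where
    lemma : ∀ a → a ℤ.* a ℤ.+ a ℤ.* + 0 ℤ.- + 0 ℤ.* + 0 ≡ a ℤ.* a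
    lemma = solve-∀
  a≡0 : a ≡ + 0
  a≡0 = Sum.reduce (ℤ.i*j≡0⇒i≡0∨j≡0 a a²≡0)

-- Each of the three terms of the norm is at most m²/4 in absolute value, and 3/4 < 1.
Nφ-bound : ∀ r₀ r₁ m → 0 ℕ.< m → 2 ℕ.* ∣ r₀ ∣ ℕ.≤ m → 2 ℕ.* ∣ r₁ ∣ ℕ.≤ m → sizeφ (r₀ , r₁) ℕ.< m ℕ.* m
Nφ-bound r₀ r₁ m 0<m b₀ b₁ = ℕ.*-cancelˡ-< 4 _ _ (begin-strict
  4 ℕ.* sizeφ (r₀ , r₁)                             ≤⟨ ℕ.*-monoʳ-≤ 4 triangle ⟩
  4 ℕ.* (x ℕ.* x ℕ.+ x ℕ.* y ℕ.+ y ℕ.* y)           ≡⟨ lemma₁ x y ⟩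
  (2 ℕ.* x) ℕ.* (2 ℕ.* x) ℕ.+ (2 ℕ.* x) ℕ.* (2 ℕ.* y) ℕ.+ (2 ℕ.* y) ℕ.* (2 ℕ.* y)
    ≤⟨ ℕ.+-mono-≤ (ℕ.+-mono-≤ (ℕ.*-mono-≤ b₀ b₀) (ℕ.*-mono-≤ b₀ b₁)) (ℕ.*-mono-≤ b₁ b₁) ⟩
  m ℕ.* m ℕ.+ m ℕ.* m ℕ.+ m ℕ.* m                   <⟨ ℕ.m<m+n _ {m ℕ.* m} (ℕ.*-mono-< 0<m 0<m) ⟩
  m ℕ.* m ℕ.+ m ℕ.* m ℕ.+ m ℕ.* m ℕ.+ m ℕ.* m       ≡⟨ lemma₂ m ⟩
  4 ℕ.* (m ℕ.* m)                                   ∎)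
  where
  open ℕ.≤-Reasoning
  x y : ℕ
  x = ∣ r₀ ∣
  y = ∣ r₁ ∣
  lemma₁ : ∀ x y → 4 ℕ.* (x ℕ.* x ℕ.+ x ℕ.* y ℕ.+ y ℕ.* y) ≡ (2 ℕ.* x) ℕ.* (2 ℕ.* x) ℕ.+ (2 ℕ.* x) ℕ.* (2 ℕ.* y) ℕ.+ (2 ℕ.* y) ℕ.* (2 ℕ.* y)
  lemma₁ = ℕSolver.solve-∀
  lemma₂ : ∀ m → m ℕ.* m ℕ.+ m ℕ.* m ℕ.+ m ℕ.* m ℕ.+ m ℕ.* m ≡ 4 ℕ.* (m ℕ.* m)
  lemma₂ = ℕSolver.solve-∀
  triangle : sizeφ (r₀ , r₁) ℕ.≤ x ℕ.* x ℕ.+ x ℕ.* y ℕ.+ y ℕ.* y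
  triangle = begin
    ∣ r₀ ℤ.* r₀ ℤ.+ r₀ ℤ.* r₁ ℤ.- r₁ ℤ.* r₁ ∣       ≤⟨ ℤ.∣i-j∣≤∣i∣+∣j∣ (r₀ ℤ.* r₀ ℤ.+ r₀ ℤ.* r₁) (r₁ ℤ.* r₁) ⟩
    ∣ r₀ ℤ.* r₀ ℤ.+ r₀ ℤ.* r₁ ∣ ℕ.+ ∣ r₁ ℤ.* r₁ ∣   ≤⟨ ℕ.+-monoˡ-≤ _ (ℤ.∣i+j∣≤∣i∣+∣j∣ (r₀ ℤ.* r₀) (r₀ ℤ.* r₁)) ⟩
    ∣ r₀ ℤ.* r₀ ∣ ℕ.+ ∣ r₀ ℤ.* r₁ ∣ ℕ.+ ∣ r₁ ℤ.* r₁ ∣ ≡⟨ cong₂ ℕ._+_ (cong₂ ℕ._+_ (ℤ.abs-* r₀ r₀) (ℤ.abs-* r₀ r₁)) (ℤ.abs-* r₁ r₁) ⟩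
    x ℕ.* x ℕ.+ x ℕ.* y ℕ.+ y ℕ.* y                 ∎

-- Rounding the two coordinates of a / b = a b̄ / N(b) to nearest integers leaves an error of norm at most 3/4.
divideφ : ∀ a b → sizeφ b ≢ 0 → ∃ λ q → ∃ λ r → a ≡ q *φ b +φ r × sizeφ r ℕ.< sizeφ b
divideφ a b b≢0 with balanced-division (proj₁ (a *φ conjφ b)) (Nφ b) (λ z → b≢0 (cong ∣_∣ z))
                   | balanced-division (proj₂ (a *φ conjφ b)) (Nφ b) (λ z → b≢0 (cong ∣_∣ z))
... | q₀ , r₀ , e₀ , bound₀ | q₁ , r₁ , e₁ , bound₁ = q , r , a≡ , ℕ.*-cancelʳ-< (sizeφ b) _ _ small
  where
  open CommutativeRing ℤ[φ] using (_-_; +-assoc; +-comm; +-identityˡ; -‿inverseʳ)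
  q r : ℤ × ℤ
  q = q₀ , q₁
  r = a - q *φ b
  a≡ : a ≡ q *φ b +φ r
  a≡ = ≡.sym (≡.trans (cong (q *φ b +φ_) (+-comm a _)) (≡.trans (≡.sym (+-assoc (q *φ b) (-φ (q *φ b)) a))
         (≡.trans (cong (_+φ a) (-‿inverseʳ (q *φ b))) (+-identityˡ a))))
  r-conj : r *φ conjφ b ≡ (r₀ , r₁)
  r-conj = cong₂ _,_
    (≡.trans (remainder₀ (proj₁ a) (proj₂ a) (proj₁ b) (proj₂ b) q₀ q₁) (shift q₀ e₀))
    (≡.trans (remainder₁ (proj₁ a) (proj₂ a) (proj₁ b) (proj₂ b) q₀ q₁) (shift q₁ e₁))
    where
    shift : ∀ {u n r} q → u ≡ q ℤ.* n ℤ.+ r → u ℤ.- q ℤ.* n ≡ r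
    shift {u} {n} {r} q ≡.refl = lemma q n r
      where
      lemma : ∀ q n r → q ℤ.* n ℤ.+ r ℤ.- q ℤ.* n ≡ r
      lemma = solve-∀
    open +-*-Solver
    M : ∀ {n} → Polynomial n → Polynomial n → Polynomial n → Polynomial n → Polynomial n × Polynomial n
    M a b c d = a :* c :+ b :* d , a :* d :+ b :* c :+ b :* d
    N : ∀ {n} → Polynomial n → Polynomial n → Polynomial n
    N s t = s :* s :+ s :* t :- t :* t
    remainder₀ : ∀ a₀ a₁ b₀ b₁ q₀ q₁ → proj₁ ((((a₀ , a₁) - (q₀ , q₁) *φ (b₀ , b₁)) *φ conjφ (b₀ , b₁)))
      ≡ proj₁ ((a₀ , a₁) *φ conjφ (b₀ , b₁)) ℤ.- q₀ ℤ.* Nφ (b₀ , b₁)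
    remainder₀ = solve 6 (λ a₀ a₁ b₀ b₁ q₀ q₁ →
      proj₁ (M (a₀ :+ :- proj₁ (M q₀ q₁ b₀ b₁)) (a₁ :+ :- proj₂ (M q₀ q₁ b₀ b₁)) (b₀ :+ b₁) (:- b₁))
      := proj₁ (M a₀ a₁ (b₀ :+ b₁) (:- b₁)) :- q₀ :* N b₀ b₁) ≡.refl
    remainder₁ : ∀ a₀ a₁ b₀ b₁ q₀ q₁ → proj₂ ((((a₀ , a₁) - (q₀ , q₁) *φ (b₀ , b₁)) *φ conjφ (b₀ , b₁)))
      ≡ proj₂ ((a₀ , a₁) *φ conjφ (b₀ , b₁)) ℤ.- q₁ ℤ.* Nφ (b₀ , b₁)
    remainder₁ = solve 6 (λ a₀ a₁ b₀ b₁ q₀ q₁ →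
      proj₂ (M (a₀ :+ :- proj₁ (M q₀ q₁ b₀ b₁)) (a₁ :+ :- proj₂ (M q₀ q₁ b₀ b₁)) (b₀ :+ b₁) (:- b₁))
      := proj₂ (M a₀ a₁ (b₀ :+ b₁) (:- b₁)) :- q₁ :* N b₀ b₁) ≡.refl
  N-conj : ∀ a b → Nφ (conjφ (a , b)) ≡ Nφ (a , b)
  N-conj a b = lemma a b
    where
    lemma : ∀ a b → (a ℤ.+ b) ℤ.* (a ℤ.+ b) ℤ.+ (a ℤ.+ b) ℤ.* (ℤ.- b) ℤ.- (ℤ.- b) ℤ.* (ℤ.- b) ≡ a ℤ.* a ℤ.+ a ℤ.* b ℤ.- b ℤ.* b
    lemma = solve-∀
  -- N(r) N(b) is the norm of r b̄, whose coordinates are the two rounding remainders; N(b) is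
  -- cancelled afterwards.
  small : sizeφ r ℕ.* sizeφ b ℕ.< sizeφ b ℕ.* sizeφ b
  small = ≡.subst (ℕ._< sizeφ b ℕ.* sizeφ b) eq (Nφ-bound r₀ r₁ (sizeφ b) (ℕ.n≢0⇒n>0 b≢0) bound₀ bound₁)
    where
    eq : sizeφ (r₀ , r₁) ≡ sizeφ r ℕ.* sizeφ b
    eq = ≡.trans (cong sizeφ (≡.sym r-conj)) (≡.trans (cong ∣_∣ (Nφ-* r (conjφ b)))
           (≡.trans (ℤ.abs-* (Nφ r) (Nφ (conjφ b))) (cong (λ z → sizeφ r ℕ.* ∣ z ∣) (N-conj (proj₁ b) (proj₂ b)))))

bézoutφ : ∀ a b → Euclidean.Bézout ℤ[φ] a b
bézoutφ = Euclidean.bézout ℤ[φ] sizeφ sizeφ-zero divideφ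

-- Multiplicativity and positivity of the norms

module EvalMod (f c : Poly) (A : ℤAlgebra) where
  open ℤAlgebra A
  open Evaluation A
  open import Relation.Binary.Reasoning.Setoid setoid
  open import Algebra.Properties.Ring ring using (x∙y⁻¹≈ε⇒x≈y)

  eval-≈ : ∀ {w} → eval f w ≈ 0# → eval c w ≈ 0# → ∀ {F G} →
    ℤAlgebra._≈_ (ℤ[X]/ f c) F G → eval F w ≈ eval G w
  eval-≈ {w} fw≈0 cw≈0 {F} {G} (Quotient.ideal {h} {k} e) = x∙y⁻¹≈ε⇒x≈y _ _ (begin
    eval F w - eval G w                    ≈⟨ +-congˡ (eval-neg G w) ⟨
    eval F w + eval (-ₚ G) w               ≈⟨ eval-+ F (-ₚ G) w ⟨
    eval (F -ₚ G) w                        ≈⟨ eval-congˡ w e ⟩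
    eval (f *ₚ h +ₚ c *ₚ k) w              ≈⟨ trans (eval-+ (f *ₚ h) (c *ₚ k) w) (+-cong (eval-* f h w) (eval-* c k w)) ⟩
    eval f w * eval h w + eval c w * eval k w ≈⟨ +-cong (trans (*-congʳ fw≈0) (zeroˡ _)) (trans (*-congʳ cw≈0) (zeroˡ _)) ⟩
    0# + 0#                                ≈⟨ +-identityˡ 0# ⟩
    0#                                     ∎)

-- The square of `x` is again a root of Φ₃, so evaluation at either conjugate factors through the
-- quotient. The case d = 0 is invariance over ℤ; d = 5 transfers norms to residues in F₂₅.
n3-cong-mod : ∀ d F G → ℤAlgebra._≈_ (ℤ[X]/ Φ3 (cst d)) F G → d ℤ.∣ n3 F ℤ.- n3 G
n3-cong-mod d F G e = ℤ[X]/-ι-injective Φ3∣X³-1 d (begin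
  ι (n3 F)                    ≈⟨ norm3 F {x} root ⟨
  eval F x * eval F (x ^ 2)   ≈⟨ *-cong (ev (by-computation (eval Φ3 x) [] (cst (+ 1)) []))
                                        (ev (by-computation (eval Φ3 (x ^ 2)) [] (+ 1 ∷ -[1+ 0 ] ∷ + 1 ∷ []) [])) ⟩
  eval G x * eval G (x ^ 2)   ≈⟨ norm3 G {x} root ⟩
  ι (n3 G)                    ∎)
  where
  A : ℤAlgebra
  A = ℤ[X]/ Φ3 (cst d)
  open ℤAlgebra A
  open Evaluation A
  open Norms A
  open PolyQuotient Φ3 (cst d)
  open import Relation.Binary.Reasoning.Setoid setoid
  root : Root3 x
  root = by-computation _ [] (cst (+ 1)) []
  ev : ∀ {w} → eval Φ3 w ≈ 0# → eval F w ≈ eval G w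
  ev {w} z = EvalMod.eval-≈ Φ3 (cst d) A {w} z (trans (eval-cst d w) (Quotient.generator₂≈0 polyAlgebra Φ3 (cst d))) {F} {G} e

n3-cong : ∀ F G → ℤAlgebra._≈_ (ℤ[X]/ Φ3 (cst (+ 0))) F G → n3 F ≡ n3 G
n3-cong F G e = ℤ.i-j≡0⇒i≡j _ _ (ℤ.0∣⇒≡0 (n3-cong-mod (+ 0) F G e))

n5-cong-mod : ∀ d F G → ℤAlgebra._≈_ (ℤ[X]/ Φ5 (cst d)) F G → d ℤ.∣ n5 F ℤ.- n5 G
n5-cong-mod d F G e = ℤ[X]/-ι-injective Φ5∣X⁵-1 d (begin
  ι (n5 F)                    ≈⟨ norm5 F {x} root ⟨
  eval F x * (eval F (x ^ 2) * (eval F (x ^ 3) * eval F (x ^ 4)))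
    ≈⟨ *-cong (ev (by-computation (eval Φ5 x) [] (cst (+ 1)) []))
        (*-cong (ev (by-computation (eval Φ5 (x ^ 2)) [] alt []))
          (*-cong (ev (by-computation (eval Φ5 (x ^ 3)) [] Φ15 []))
            (ev (by-computation (eval Φ5 (x ^ 4)) [] (alt *ₚ (alt ∘x^ 2)) [])))) ⟩
  eval G x * (eval G (x ^ 2) * (eval G (x ^ 3) * eval G (x ^ 4))) ≈⟨ norm5 G {x} root ⟩
  ι (n5 G)                    ∎)
  where
  A : ℤAlgebra
  A = ℤ[X]/ Φ5 (cst d)
  open ℤAlgebra A
  open Evaluation A
  open Norms A
  open PolyQuotient Φ5 (cst d)
  open import Relation.Binary.Reasoning.Setoid setoid
  root : Root5 x
  root = by-computation _ [] (cst (+ 1)) []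
  -- This is Φ₁₀. The cofactors above come from Φ₅(X²) = Φ₅Φ₁₀, Φ₅(X³) = Φ₅Φ₁₅ and Φ₅(X⁴) =
  -- Φ₅(X)Φ₁₀(X)Φ₁₀(X²).
  alt : Poly
  alt = + 1 ∷ -[1+ 0 ] ∷ + 1 ∷ -[1+ 0 ] ∷ + 1 ∷ []
  ev : ∀ {w} → eval Φ5 w ≈ 0# → eval F w ≈ eval G w
  ev {w} z = EvalMod.eval-≈ Φ5 (cst d) A {w} z (trans (eval-cst d w) (Quotient.generator₂≈0 polyAlgebra Φ5 (cst d))) {F} {G} e

n5-cong : ∀ F G → ℤAlgebra._≈_ (ℤ[X]/ Φ5 (cst (+ 0))) F G → n5 F ≡ n5 G
n5-cong F G e = ℤ.i-j≡0⇒i≡j _ _ (ℤ.0∣⇒≡0 (n5-cong-mod (+ 0) F G e))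

module ℤ[ω3] where
  A : ℤAlgebra
  A = ℤ[X]/ Φ3 (cst (+ 0))
  open ℤAlgebra A
  open Evaluation A
  open Norms A
  open PolyQuotient Φ3 (cst (+ 0))
  open IntegerSolver A
  open import Relation.Binary.Reasoning.Setoid setoid

  root : Root3 x
  root = by-computation _ [] (cst (+ 1)) []

  ι-injective : ∀ a b → ι a ≈ ι b → a ≡ b
  ι-injective a b e = ℤ.i-j≡0⇒i≡j a b (ℤ.0∣⇒≡0 (ℤ[X]/-ι-injective Φ3∣X³-1 (+ 0) {a} {b} e))

  -- Values multiply in ℤ[ω₃], and integers embed there, so no expansion of the quadratic form is
  -- involved.
  n3-* : ∀ F G → n3 (F *ₚ G) ≡ n3 F ℤ.* n3 G
  n3-* F G = ι-injective (n3 (F *ₚ G)) (n3 F ℤ.* n3 G) (begin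
    ι (n3 (F *ₚ G))                                              ≈⟨ norm3 (F *ₚ G) root ⟨
    eval (F *ₚ G) x * eval (F *ₚ G) (x ^ 2)                      ≈⟨ *-cong (eval-* F G x) (eval-* F G (x ^ 2)) ⟩
    (eval F x * eval G x) * (eval F (x ^ 2) * eval G (x ^ 2))
      ≈⟨ solve 4 (λ a b c d → (a :* b) :* (c :* d) := (a :* c) :* (b :* d)) refl (eval F x) (eval G x) (eval F (x ^ 2)) (eval G (x ^ 2)) ⟩
    (eval F x * eval F (x ^ 2)) * (eval G x * eval G (x ^ 2))    ≈⟨ *-cong (norm3 F {x} root) (norm3 G {x} root) ⟩
    ι (n3 F) * ι (n3 G)                                          ≈⟨ ι-* (n3 F) (n3 G) ⟨
    ι (n3 F ℤ.* n3 G)                                            ∎)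

open ℤ[ω3] public using (n3-*)

module ℤ[ω5] where
  A : ℤAlgebra
  A = ℤ[X]/ Φ5 (cst (+ 0))
  open ℤAlgebra A
  open Evaluation A
  open Norms A
  open PolyQuotient Φ5 (cst (+ 0))
  open IntegerSolver A
  open import Relation.Binary.Reasoning.Setoid setoid

  root : Root5 x
  root = by-computation _ [] (cst (+ 1)) []

  ι-injective : ∀ a b → ι a ≈ ι b → a ≡ b
  ι-injective a b e = ℤ.i-j≡0⇒i≡j a b (ℤ.0∣⇒≡0 (ℤ[X]/-ι-injective Φ5∣X⁵-1 (+ 0) {a} {b} e))

  n5-* : ∀ F G → n5 (F *ₚ G) ≡ n5 F ℤ.* n5 G
  n5-* F G = ι-injective (n5 (F *ₚ G)) (n5 F ℤ.* n5 G) (begin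
    ι (n5 (F *ₚ G))                                              ≈⟨ norm5 (F *ₚ G) root ⟨
    FG x * (FG (x ^ 2) * (FG (x ^ 3) * FG (x ^ 4)))              ≈⟨ *-cong (eval-* F G x) (*-cong (eval-* F G (x ^ 2)) (*-cong (eval-* F G (x ^ 3)) (eval-* F G (x ^ 4)))) ⟩
    _ ≈⟨ solve 8 (λ a a′ b b′ c c′ d d′ → (a :* a′) :* ((b :* b′) :* ((c :* c′) :* (d :* d′)))
            := (a :* (b :* (c :* d))) :* (a′ :* (b′ :* (c′ :* d′)))) refl
            (eval F x) (eval G x) (eval F (x ^ 2)) (eval G (x ^ 2)) (eval F (x ^ 3)) (eval G (x ^ 3)) (eval F (x ^ 4)) (eval G (x ^ 4)) ⟩
    _ ≈⟨ *-cong (norm5 F {x} root) (norm5 G {x} root) ⟩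
    ι (n5 F) * ι (n5 G)                                          ≈⟨ ι-* (n5 F) (n5 G) ⟨
    ι (n5 F ℤ.* n5 G)                                            ∎)
    where
    FG : Carrier → Carrier
    FG = eval (F *ₚ G)

open ℤ[ω5] public using (n5-*)

φ-poly : ℤ × ℤ → Poly
φ-poly (s , t) = s ∷ + 0 ∷ ℤ.- t ∷ ℤ.- t ∷ []

co3-short : ∀ a b → co3 (a ∷ b ∷ []) ≡ (a , b)
co3-short a b = cong₂ _,_ (z a) (≡.trans (z (b ℤ.- + 0)) (z b))
  where
  z : ∀ a → a ℤ.- + 0 ≡ a
  z = ℤ.+-identityʳ

co5-short : ∀ a b c d → co5 (a ∷ b ∷ c ∷ d ∷ []) ≡ (a , b , c , d)
co5-short a b c d = cong₂ _,_ (z a) (cong₂ _,_ (≡.trans (z _) (z b)) (cong₂ _,_ (≡.trans (z _) (≡.trans (z _) (z c)))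
    (≡.trans (z _) (≡.trans (z _) (≡.trans (z _) (z d))))))
  where
  z : ∀ a → a ℤ.- + 0 ≡ a
  z = ℤ.+-identityʳ

-- The coefficients of β = α(ω) α(ω²) on 1, ω, …, ω⁴ (ω = ω₅); the norm of α is β β̄.
βcoeffs : ℤ × ℤ × ℤ × ℤ → ℤ × ℤ × ℤ × ℤ × ℤ
βcoeffs (a₀ , a₁ , a₂ , a₃) =
  a₀ ℤ.* a₀ ℤ.+ a₁ ℤ.* a₂ ℤ.+ a₁ ℤ.* a₃ ,
  a₀ ℤ.* a₁ ℤ.+ a₀ ℤ.* a₃ ℤ.+ a₂ ℤ.* a₂ ,
  a₀ ℤ.* a₂ ℤ.+ a₀ ℤ.* a₁ ℤ.+ a₁ ℤ.* a₃ ℤ.+ a₂ ℤ.* a₃ ,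
  a₀ ℤ.* a₃ ℤ.+ a₁ ℤ.* a₁ ℤ.+ a₂ ℤ.* a₃ ,
  a₁ ℤ.* a₂ ℤ.+ a₀ ℤ.* a₂ ℤ.+ a₃ ℤ.* a₃

cyclicSquares : ℤ × ℤ × ℤ × ℤ × ℤ → ℤ
cyclicSquares (e₀ , e₁ , e₂ , e₃ , e₄) =
  (e₀ ℤ.- e₁) ℤ.* (e₀ ℤ.- e₁) ℤ.+ (e₁ ℤ.- e₂) ℤ.* (e₁ ℤ.- e₂) ℤ.+ (e₂ ℤ.- e₃) ℤ.* (e₂ ℤ.- e₃)
    ℤ.+ (e₃ ℤ.- e₄) ℤ.* (e₃ ℤ.- e₄) ℤ.+ (e₄ ℤ.- e₀) ℤ.* (e₄ ℤ.- e₀)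

module Form5 where
  open +-*-Solver

  form5 : ∀ {n} (a₀ a₁ a₂ a₃ : Polynomial n) → Polynomial n
  form5 a₀ a₁ a₂ a₃ = s :* s :+ s :* t :- t :* t
    where
    S₀ = a₀ :* a₀ :+ a₁ :* a₁ :+ a₂ :* a₂ :+ a₃ :* a₃
    S₁ = a₀ :* a₁ :+ a₁ :* a₂ :+ a₂ :* a₃
    S₂ = a₀ :* a₂ :+ a₁ :* a₃ :+ a₀ :* a₃
    s = S₀ :- S₁
    t = S₁ :- S₂

  form5-φ : ∀ s t → Nφ (relNorm5 (s , + 0 , ℤ.- t , ℤ.- t)) ≡ Nφ (s , t) ℤ.* Nφ (s , t)
  form5-φ = solve 2 (λ s t → form5 s (con (+ 0)) (:- t) (:- t) := (s :* s :+ s :* t :- t :* t) :* (s :* s :+ s :* t :- t :* t)) ≡.refl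

  -- Write β β̄ = A + B(ω + ω⁴) + C(ω² + ω³) with A = Σ eᵢ² and B = Σ eᵢeᵢ₊₁, indices modulo 5. It
  -- is rational, so B = C and the norm is A - B; doubled, this is the sum of squared cyclic
  -- differences.
  twice-form5 : ∀ a₀ a₁ a₂ a₃ → + 2 ℤ.* Nφ (relNorm5 (a₀ , a₁ , a₂ , a₃)) ≡ cyclicSquares (βcoeffs (a₀ , a₁ , a₂ , a₃))
  twice-form5 = solve 4 (λ a₀ a₁ a₂ a₃ →
    let e₀ = a₀ :* a₀ :+ a₁ :* a₂ :+ a₁ :* a₃
        e₁ = a₀ :* a₁ :+ a₀ :* a₃ :+ a₂ :* a₂
        e₂ = a₀ :* a₂ :+ a₀ :* a₁ :+ a₁ :* a₃ :+ a₂ :* a₃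
        e₃ = a₀ :* a₃ :+ a₁ :* a₁ :+ a₂ :* a₃
        e₄ = a₁ :* a₂ :+ a₀ :* a₂ :+ a₃ :* a₃ in
    con (+ 2) :* form5 a₀ a₁ a₂ a₃ :=
    (e₀ :- e₁) :* (e₀ :- e₁) :+ (e₁ :- e₂) :* (e₁ :- e₂) :+ (e₂ :- e₃) :* (e₂ :- e₃)
      :+ (e₃ :- e₄) :* (e₃ :- e₄) :+ (e₄ :- e₀) :* (e₄ :- e₀)) ≡.refl

n5-φ-poly : ∀ z → n5 (φ-poly z) ≡ Nφ z ℤ.* Nφ z
n5-φ-poly (s , t) = ≡.trans (cong (λ a → Nφ (relNorm5 a)) (co5-short s (+ 0) (ℤ.- t) (ℤ.- t))) (Form5.form5-φ s t)

0≤square : ∀ i → + 0 ℤ.≤ i ℤ.* i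
0≤square (+ n) = ≡.subst (+ 0 ℤ.≤_) (ℤ.pos-* n n) (ℤ.+≤+ ℕ.z≤n)
0≤square -[1+ n ] = ℤ.+≤+ ℕ.z≤n

cyclicSquares≥0 : ∀ e → + 0 ℤ.≤ cyclicSquares e
cyclicSquares≥0 (e₀ , e₁ , e₂ , e₃ , e₄) = ℤ.+-mono-≤ (ℤ.+-mono-≤ (ℤ.+-mono-≤ (ℤ.+-mono-≤
  (0≤square (e₀ ℤ.- e₁)) (0≤square (e₁ ℤ.- e₂))) (0≤square (e₂ ℤ.- e₃))) (0≤square (e₃ ℤ.- e₄))) (0≤square (e₄ ℤ.- e₀))

-- The sign matters because -1 is a nonsquare modulo 3: the residue of the absolute value, which is
-- what gets factored, must be that of the norm.
n5≥0 : ∀ F → + 0 ℤ.≤ n5 F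
n5≥0 F = let (a₀ , a₁ , a₂ , a₃) = co5 F in
  ℤ.*-cancelˡ-≤-pos (+ 0) (n5 F) (+ 2) (≡.subst (+ 0 ℤ.≤_) (≡.sym (Form5.twice-form5 a₀ a₁ a₂ a₃)) (cyclicSquares≥0 (βcoeffs (co5 F))))

n3≥0 : ∀ F → + 0 ℤ.≤ n3 F
n3≥0 F = let (a , b) = co3 F in
  ℤ.*-cancelˡ-≤-pos (+ 0) (n3 F) (+ 4) (≡.subst (+ 0 ℤ.≤_) (lemma a b)
    (ℤ.+-mono-≤ (0≤square (+ 2 ℤ.* a ℤ.- b)) (ℤ.*-monoˡ-≤-nonNeg (+ 3) (0≤square b))))
  where
  lemma : ∀ a b → (+ 2 ℤ.* a ℤ.- b) ℤ.* (+ 2 ℤ.* a ℤ.- b) ℤ.+ + 3 ℤ.* (b ℤ.* b) ≡ + 4 ℤ.* (a ℤ.* a ℤ.- a ℤ.* b ℤ.+ b ℤ.* b)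
  lemma = solve-∀

-- Descent for norms from ℤ[ω₃] and ℤ[ω₅]

-- Turns vanishing modulo c into a factor c that can be pulled out of the norm.
vanishing⇒multiple : ∀ f c F → ℤAlgebra._≈_ (ℤ[X]/ f c) F [] →
  ∃ λ k → ℤAlgebra._≈_ (ℤ[X]/ f (cst (+ 0))) F (c *ₚ k)
vanishing⇒multiple f c F (Quotient.ideal {h} {k} e) = k , Quotient.ideal {h = h} {[]} (begin
  F - c * k                     ≈⟨ +-congʳ (+ₚ-identityʳ F) ⟨
  (F +ₚ []) - c * k             ≈⟨ +-congʳ {x = - (c * k)} e ⟩
  (f * h + c * k) - c * k       ≈⟨ solve 4 (λ f h c k → (f :* h :+ c :* k) :- c :* k := f :* h) refl f h c k ⟩
  f * h                         ≈⟨ 0*ₚ (f *ₚ h) [] ⟨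
  f * h + cst (+ 0) * []        ∎)
  where
  open ℤAlgebra polyAlgebra
  open IntegerSolver polyAlgebra
  open import Relation.Binary.Reasoning.Setoid setoid

module _ (A : ℤAlgebra) where
  open ℤAlgebra A

  ι-multiple≈0 : ∀ {d a} → ι d ≈ 0# → d ℤ.∣ a → ι a ≈ 0#
  ι-multiple≈0 {d} z (ℤ.divides q ≡.refl) = trans (ι-* q d) (trans (*-congˡ z) (zeroʳ _))

  ^-% : ∀ {w} n .{{_ : ℕ.NonZero n}} → w ^ n ≈ 1# → ∀ m {r} → m ℕ.% n ≡ r → w ^ m ≈ w ^ r
  ^-% {w} n w^n m ≡.refl = trans (^-congʳ w (ℕ.m≡m%n+[m/n]*n m n)) (^-reduce {n = n} w^n (m ℕ./ n) (m ℕ.% n))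

%-square : ∀ q n .{{_ : ℕ.NonZero n}} {r} → q ℕ.% n ≡ r → (q ℕ.* q) ℕ.% n ≡ (r ℕ.* r) ℕ.% n
%-square q n ≡.refl = ℕ.%-distribˡ-* q q n

-- The real subfield of ℚ(ω₃) is ℚ, so p itself divides F(ω₃), and its norm p² comes out. The
-- exponent q is p, as p ≡ -1 modulo 3.
n3-descent : ∀ F {p} → Prime p → p ℕ.% 3 ≡ 2 → + p ℤ.∣ n3 F → ∃ λ G → n3 F ≡ + p ℤ.* + p ℤ.* n3 G
n3-descent F {p} pp p%3 p∣n = proj₁ multiple , (begin
  n3 F                               ≡⟨ n3-cong F (cst (+ p) *ₚ G) (proj₂ multiple) ⟩
  n3 (cst (+ p) *ₚ G)                ≡⟨ n3-* (cst (+ p)) G ⟩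
  n3 (cst (+ p)) ℤ.* n3 G            ≡⟨ cong (ℤ._* n3 G) n3-cst ⟩
  + p ℤ.* + p ℤ.* n3 G               ∎)
  where
  open ≡.≡-Reasoning
  A : ℤAlgebra
  A = ℤ[X]/ Φ3 (cst (+ p))
  module R = ℤAlgebra A
  open Evaluation A
  open PolyQuotient Φ3 (cst (+ p))
  root : Norms.Root3 A x
  root = by-computation _ [] (cst (+ 1)) []
  ιp≈0 : R.ι (+ p) R.≈ R.0#
  ιp≈0 = Quotient.generator₂≈0 polyAlgebra Φ3 (cst (+ p))
  x³ : x R.^ 3 R.≈ R.1#
  x³ = Norms.root3-^3 A {x} root
  product-zero : eval F x R.* eval F (x R.^ p) R.≈ R.0#
  product-zero = R.trans (R.*-congˡ {eval F x} (eval-congʳ F (^-% A {x} 3 x³ p p%3)))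
    (R.trans (Norms.norm3 A F {x} root) (ι-multiple≈0 A ιp≈0 p∣n))
  F≈0 : F R.≈ []
  F≈0 = R.trans (R.sym (eval-x F)) (Frobenius.conjugate-product-zero A (prime>1 pp) (Frobenius.frobenius A pp ιp≈0) F {x}
    (R.trans (^-% A {x} 3 x³ (p ℕ.* p) (%-square p 3 p%3)) (R.*-identityʳ x)) product-zero)
  multiple : ∃ λ k → ℤAlgebra._≈_ (ℤ[X]/ Φ3 (cst (+ 0))) F (cst (+ p) *ₚ k)
  multiple = vanishing⇒multiple Φ3 (cst (+ p)) F F≈0
  G : Poly
  G = proj₁ multiple
  n3-cst : n3 (cst (+ p)) ≡ + p ℤ.* + p
  n3-cst = ≡.trans (cong form3 (cong₂ _,_ (ℤ.+-identityʳ (+ p)) ≡.refl)) (lemma (+ p))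
    where
    lemma : ∀ p → p ℤ.* p ℤ.- p ℤ.* + 0 ℤ.+ + 0 ℤ.* + 0 ≡ p ℤ.* p
    lemma = solve-∀

module Embedφ (A : ℤAlgebra) where
  open ℤAlgebra A
  open Evaluation A
  open Norms A
  open IntegerSolver A
  open import Relation.Binary.Reasoning.Setoid setoid

  embedφ-* : ∀ y z {w} → Root5 w → embedφ (y *φ z) w ≈ embedφ y w * embedφ z w
  embedφ-* (a , b) (c , d) {w} e = sym (drop-multiple _ e (begin
    (ι a + ι b * phi w) * (ι c + ι d * phi w)
      ≈⟨ solve 5 (λ a b c d w → (a :+ b :* (:- (w :^ 2 :+ w :^ 3))) :* (c :+ d :* (:- (w :^ 2 :+ w :^ 3)))
           := (a :* c :+ b :* d) :+ (a :* d :+ b :* c :+ b :* d) :* (:- (w :^ 2 :+ w :^ 3))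
              :+ (con (+ 1) :+ w :+ w :^ 2 :+ w :^ 3 :+ w :^ 4) :* (b :* d :* (w :^ 2 :+ w :- con (+ 1)))) refl (ι a) (ι b) (ι c) (ι d) w ⟩
    (ι a * ι c + ι b * ι d) + (ι a * ι d + ι b * ι c + ι b * ι d) * phi w + _
      ≈⟨ +-congʳ (+-cong (ι-* a c ⟨+⟩ ι-* b d) (*-congʳ (ι-* a d ⟨+⟩ ι-* b c ⟨+⟩ ι-* b d))) ⟨
    embedφ ((a , b) *φ (c , d)) w + _ ∎))

  eval-φ-poly : ∀ z w → eval (φ-poly z) w ≈ embedφ z w
  eval-φ-poly (s , t) w = begin
    ι s + w * (ι (+ 0) + w * (ι (ℤ.- t) + w * (ι (ℤ.- t) + w * 0#)))
      ≈⟨ +-congˡ (*-congˡ (+-congˡ (*-congˡ (+-cong (ι-neg t) (*-congˡ (+-cong (ι-neg t) (*-congˡ (sym ι-0)))))))) ⟩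
    ι s + w * (ι (+ 0) + w * (- ι t + w * (- ι t + w * ι (+ 0))))
      ≈⟨ solve 3 (λ s t w → s :+ w :* (con (+ 0) :+ w :* (:- t :+ w :* (:- t :+ w :* con (+ 0)))) := s :+ t :* (:- (w :^ 2 :+ w :^ 3))) refl (ι s) (ι t) w ⟩
    ι s + ι t * phi w ∎

-- `cofactor` is the expansion of N(c + tp) - N(c) divided by p.
Nφ-mod : ∀ p c t → + p ℤ.∣ Nφ c → + p ℤ.∣ Nφ (c +φ t *φ (+ p , + 0))
Nφ-mod p (c₀ , c₁) (t₀ , t₁) p∣N = ≡.subst (+ p ℤ.∣_) (≡.sym (lemma c₀ c₁ t₀ t₁ (+ p)))
  (ℤ.∣m∣n⇒∣m+n p∣N (ℤ.∣n⇒∣m*n (cofactor (+ p)) ℤ.∣-refl))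
  where
  cofactor : ℤ → ℤ
  cofactor p = + 2 ℤ.* c₀ ℤ.* t₀ ℤ.+ t₀ ℤ.* t₀ ℤ.* p ℤ.+ c₀ ℤ.* t₁ ℤ.+ t₀ ℤ.* c₁ ℤ.+ t₀ ℤ.* t₁ ℤ.* p ℤ.- + 2 ℤ.* c₁ ℤ.* t₁ ℤ.- t₁ ℤ.* t₁ ℤ.* p
  open +-*-Solver
  M : ∀ {n} → Polynomial n → Polynomial n → Polynomial n
  M s t = s :* s :+ s :* t :- t :* t
  lemma : ∀ c₀ c₁ t₀ t₁ p → Nφ ((c₀ , c₁) +φ (t₀ , t₁) *φ (p , + 0)) ≡
    Nφ (c₀ , c₁) ℤ.+ (+ 2 ℤ.* c₀ ℤ.* t₀ ℤ.+ t₀ ℤ.* t₀ ℤ.* p ℤ.+ c₀ ℤ.* t₁ ℤ.+ t₀ ℤ.* c₁ ℤ.+ t₀ ℤ.* t₁ ℤ.* p ℤ.- + 2 ℤ.* c₁ ℤ.* t₁ ℤ.- t₁ ℤ.* t₁ ℤ.* p) ℤ.* p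
  lemma = solve 5 (λ c₀ c₁ t₀ t₁ p → M (c₀ :+ (t₀ :* p :+ t₁ :* con (+ 0))) (c₁ :+ (t₀ :* con (+ 0) :+ t₁ :* p :+ t₁ :* con (+ 0)))
    := M c₀ c₁ :+ (con (+ 2) :* c₀ :* t₀ :+ t₀ :* t₀ :* p :+ c₀ :* t₁ :+ t₀ :* c₁ :+ t₀ :* t₁ :* p :- con (+ 2) :* c₁ :* t₁ :- t₁ :* t₁ :* p) :* p) ≡.refl

-- Let π be the gcd in ℤ[φ] of p and the product c of F(ω₅) with its conjugate. Modulo π both p and
-- c vanish, which is all that the Frobenius argument asks, so π divides F(ω₅). Since p divides N(c)
-- = N₅(F), the Bézout relation gives p ∣ N(π): the factor N(π)² taken out is not trivial.
n5-descent : ∀ F {p} → Prime p → p ℕ.% 5 ≡ 2 ⊎ p ℕ.% 5 ≡ 3 ⊎ p ℕ.% 5 ≡ 4 → + p ℤ.∣ n5 F →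
  ∃ λ m → ∃ λ G → + p ℤ.∣ m × n5 F ≡ m ℤ.* m ℤ.* n5 G
n5-descent F {p} pp p%5 p∣n = Nφ π , G , p∣Nπ , (begin
  n5 F                               ≡⟨ n5-cong F (φ-poly π *ₚ G) (proj₂ multiple) ⟩
  n5 (φ-poly π *ₚ G)                 ≡⟨ n5-* (φ-poly π) G ⟩
  n5 (φ-poly π) ℤ.* n5 G             ≡⟨ cong (ℤ._* n5 G) (n5-φ-poly π) ⟩
  Nφ π ℤ.* Nφ π ℤ.* n5 G             ∎)
  where
  open ≡.≡-Reasoning
  c p′ : ℤ × ℤ
  c = relNorm5 (co5 F)
  p′ = + p , + 0
  open Euclidean.Bézout (bézoutφ c p′) renaming (g to π; a′ to c₁; b′ to p₁)
  p∣Nπ : + p ℤ.∣ Nφ π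
  p∣Nπ = ≡.subst (λ z → + p ℤ.∣ Nφ z) (≡.sym combination) (Nφ-mod p (s *φ c) t
    (≡.subst (+ p ℤ.∣_) (≡.sym (Nφ-* s c)) (ℤ.∣n⇒∣m*n (Nφ s) p∣n)))
  A : ℤAlgebra
  A = ℤ[X]/ Φ5 (φ-poly π)
  module R = ℤAlgebra A
  open Evaluation A
  open Norms A using (embedφ; phi)
  open PolyQuotient Φ5 (φ-poly π)
  root : Norms.Root5 A x
  root = by-computation _ [] (cst (+ 1)) []
  π≈0 : embedφ π x R.≈ R.0#
  π≈0 = R.trans (R.sym (Embedφ.eval-φ-poly A π x)) (R.trans (eval-x (φ-poly π)) (Quotient.generator₂≈0 polyAlgebra Φ5 (φ-poly π)))
  multiple≈0 : ∀ z y → z ≡ π *φ y → embedφ z x R.≈ R.0#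
  multiple≈0 _ y ≡.refl = R.trans (Embedφ.embedφ-* A π y {x} root) (R.trans (R.*-congʳ {embedφ y x} π≈0) (R.zeroˡ (embedφ y x)))
  ιp≈0 : R.ι (+ p) R.≈ R.0#
  ιp≈0 = R.trans (R.sym (R.trans (R.+-congˡ {R.ι (+ p)} (R.trans (R.*-congʳ {phi x} R.ι-0) (R.zeroˡ (phi x)))) (R.+-identityʳ (R.ι (+ p)))))
           (multiple≈0 p′ p₁ g∣b)
  x⁵ : x R.^ 5 R.≈ R.1#
  x⁵ = Norms.root5-^5 A {x} root
  finish : ∀ q → 2 ℕ.≤ q → q ℕ.% 5 ≡ 4 → Frobenius.PowerMap A q → F R.≈ []
  finish q 2≤q q%5 pow = R.trans (R.sym (eval-x F)) (Frobenius.conjugate-product-zero A 2≤q pow F {x}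
    (R.trans (^-% A {x} 5 x⁵ (q ℕ.* q) (%-square q 5 q%5)) (R.*-identityʳ x))
    (R.trans (R.*-congˡ {eval F x} (eval-congʳ F (^-% A {x} 5 x⁵ q q%5)))
      (R.trans (Norms.relNorm5-correct A F {x} root) (multiple≈0 c c₁ g∣a))))
  frob : Frobenius.PowerMap A p
  frob = Frobenius.frobenius A pp ιp≈0
  -- For p ≡ 2 or 3 modulo 5 the exponent is q = p², which is ≡ 4; for p ≡ 4 it is p itself.
  square : ∀ {r} → p ℕ.% 5 ≡ r → (r ℕ.* r) ℕ.% 5 ≡ 4 → F R.≈ []
  square e e′ = finish (p ℕ.* p) (ℕ.≤-trans (prime>1 pp) (ℕ.m≤m*n p p {{ℕ.>-nonZero (ℕ.<-trans ℕ.z<s (prime>1 pp))}}))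
    (≡.trans (%-square p 5 e) e′) (Frobenius.powerMap-* A {p} {p} frob frob)
  F≈0 : F R.≈ []
  F≈0 = [ (λ e → square e ≡.refl) , [ (λ e → square e ≡.refl) , (λ e → finish p (prime>1 pp) e frob) ]′ ]′ p%5
  multiple : ∃ λ k → ℤAlgebra._≈_ (ℤ[X]/ Φ5 (cst (+ 0))) F (φ-poly π *ₚ k)
  multiple = vanishing⇒multiple Φ5 (φ-poly π) F F≈0
  G : Poly
  G = proj₁ multiple

-- Prime factors of the norms

module NaturalNumbers where
  open import Data.List.Membership.Propositional using (_∈_; find)
  open import Data.List.Relation.Unary.All as All using (All; []; _∷_)
  open import Data.List.Relation.Unary.All.Properties using (¬Any⇒All¬)
  open import Data.List.Relation.Unary.Any using (here; there; any?)
  open import Data.Nat using (_*_; _^_; _<_; _%_; NonZero; ≢-nonZero; _≟_)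
  open import Data.Nat.Divisibility
  open import Data.Nat.DivMod
  open import Data.Nat.Primality.Factorisation using (factorise)
  open import Data.Nat.Properties hiding (_≟_)
  open ≡ using (refl)

  record Decomposition (d : ℕ) .{{_ : NonZero d}} (n : ℕ) : Set where
    field
      {root exponent} : ℕ
      {primes} : List ℕ
      factors : n ≡ root * root * (d ^ exponent * product primes)
      prime-factors : All (λ p → Prime p × p % d ≡ 1) primes

  module _ {d : ℕ} .{{_ : NonZero d}} (d-prime : Prime d) where

    private
      no-residue-left : ∀ ps → All Prime ps → All (λ p → p % d ≡ 0 ⊎ p % d ≡ 1) ps →
        ∃ λ e → ∃ λ L → product ps ≡ d ^ e * product L × All (λ p → Prime p × p % d ≡ 1) L
      no-residue-left [] [] [] = 0 , [] , refl , []
      no-residue-left (p ∷ ps) (pp ∷ pps) (r ∷ rs) with no-residue-left ps pps rs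
      no-residue-left (p ∷ ps) (pp ∷ pps) (inj₂ p%d ∷ rs) | e , L , eq , all =
        e , p ∷ L , ≡.trans (cong (p *_) eq) (lemma p (d ^ e) (product L)) , (pp , p%d) ∷ all
        where
        lemma : ∀ p a b → p * (a * b) ≡ a * (p * b)
        lemma = ℕSolver.solve-∀
      no-residue-left (p ∷ ps) (pp ∷ pps) (inj₁ p%d ∷ rs) | e , L , eq , all
        with prime⇒irreducible pp (m%n≡0⇒n∣m p d p%d)
      ... | inj₁ d≡1 = contradiction (≡.subst (1 <_) d≡1 (prime>1 d-prime)) (<-irrefl refl)
      ... | inj₂ refl = suc e , L , ≡.trans (cong (p *_) eq) (≡.sym (*-assoc p (p ^ e) (product L))) , all

    -- Prime factors outside the residues 0 and 1 mod d are removed in pairs by the descent step.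
    decompose : (S : ℕ → Set) →
      (∀ {n p} → S n → Prime p → p ∣ n → p % d ≢ 0 → p % d ≢ 1 → ∃ λ m → ∃ λ n′ → p ∣ m × n ≡ m * m * n′ × S n′) →
      ∀ n → S n → n ≢ 0 → Decomposition d n
    decompose S descent = <-rec _ step
      where
      step : ∀ n → (∀ {k} → k < n → S k → k ≢ 0 → Decomposition d k) → S n → n ≢ 0 → Decomposition d n
      step n rec s n≢0 with factorise n {{≢-nonZero n≢0}}
      ... | record { factors = ps ; isFactorisation = eq ; factorsPrime = pps }
        with any? (λ p → ¬? (p % d ≟ 0) ×-dec ¬? (p % d ≟ 1)) ps
      ... | no none with no-residue-left ps pps (All.map residue (¬Any⇒All¬ ps none))
        where
        residue : ∀ {p} → ¬ (p % d ≢ 0 × p % d ≢ 1) → p % d ≡ 0 ⊎ p % d ≡ 1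
        residue {p} h with p % d ≟ 0 | p % d ≟ 1
        ... | yes z | _ = inj₁ z
        ... | no _ | yes o = inj₂ o
        ... | no z | no o = contradiction (z , o) h
      ... | e , L , eq′ , all = record { root = 1 ; exponent = e ; primes = L ; factors = ≡.trans eq (≡.trans eq′ (≡.sym (*-identityˡ _))) ; prime-factors = all }
      step n rec s n≢0 | record { factors = ps ; isFactorisation = eq ; factorsPrime = pps } | yes some
        with find some
      ... | p , p∈ps , z , o with descent s (All.lookup pps p∈ps) (≡.subst (p ∣_) (≡.sym eq) (∈⇒∣product p∈ps)) z o
      ... | m , n′ , p∣m , n≡ , s′ with rec n′<n s′ n′≢0
        where
        n′≢0 : n′ ≢ 0
        n′≢0 refl = n≢0 (≡.trans n≡ (*-zeroʳ (m * m)))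
        m≢0 : m ≢ 0
        m≢0 refl = n≢0 n≡
        instance
          _ = ≢-nonZero n′≢0
          _ = ≢-nonZero m≢0
        1<m : 1 < m
        1<m = <-≤-trans (prime>1 (All.lookup pps p∈ps)) (∣⇒≤ p∣m)
        n′<n : n′ < n
        n′<n = ≡.subst (n′ <_) (≡.trans (*-comm n′ (m * m)) (≡.sym n≡)) (m<m*n n′ (m * m) (<-≤-trans 1<m (m≤m*n m m)))
      ... | record { root = r ; exponent = e ; primes = L ; factors = fs ; prime-factors = all } = record
        { root = m * r ; exponent = e ; primes = L ; factors = ≡.trans n≡ (≡.trans (cong (m * m *_) fs) (lemma m r (d ^ e * product L))) ; prime-factors = all }
        where
        lemma : ∀ m r a → m * m * (r * r * a) ≡ m * r * (m * r) * a
        lemma = ℕSolver.solve-∀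

    product-1 : ∀ {L} → All (λ p → Prime p × p % d ≡ 1) L → product L % d ≡ 1 % d
    product-1 [] = refl
    product-1 {p ∷ L} ((_ , p%d) ∷ all) = ≡.trans (%-distribˡ-* p (product L) d)
      (≡.trans (cong₂ (λ a b → (a * b) % d) p%d (product-1 all)) (≡.trans (cong (_% d) (*-identityˡ (1 % d))) (m%n%n≡m%n 1 d)))

    private
      d∤product : ∀ {L} → All (λ p → Prime p × p % d ≡ 1) L → ¬ d ∣ product L
      d∤product {L} all d∣ = contradiction
        (≡.trans (≡.sym (n∣m⇒m%n≡0 (product L) d d∣)) (≡.trans (product-1 all) (m<n⇒m%n≡m (prime>1 d-prime)))) λ ()

    unramified : ∀ {n} (D : Decomposition d n) → ¬ d ∣ n →
      let open Decomposition D in n ≡ root * root * product primes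
    unramified record { root = r ; exponent = zero ; primes = L ; factors = fs } _ = ≡.trans fs (cong (r * r *_) (*-identityˡ _))
    unramified record { root = r ; exponent = suc e ; primes = L ; factors = fs } d∤n =
      contradiction (≡.subst (d ∣_) (≡.sym fs) (∣n⇒∣m*n (r * r) (∣m⇒∣m*n (product L) (∣m⇒∣m*n (d ^ e) ∣-refl)))) d∤n

    -- A factor d may come from `root` or from the power of d; since d² does not divide n, only a
    -- single d in the power is possible.
    ramified : ∀ {n} (D : Decomposition d n) → d ∣ n → ¬ d * d ∣ n →
      let open Decomposition D in n ≡ d * (root * root * product primes)
    ramified record { root = r ; exponent = zero ; primes = L ; factors = fs ; prime-factors = all } d∣n dd∤n
      with euclidsLemma (r * r) (1 * product L) d-prime (≡.subst (d ∣_) fs d∣n)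
    ... | inj₂ d∣L = contradiction (≡.subst (d ∣_) (*-identityˡ _) d∣L) (d∤product all)
    ... | inj₁ d∣rr with euclidsLemma r r d-prime d∣rr
    ... | inj₁ d∣r = contradiction (≡.subst (d * d ∣_) (≡.sym fs) (∣m⇒∣m*n _ (*-pres-∣ d∣r d∣r))) dd∤n
    ... | inj₂ d∣r = contradiction (≡.subst (d * d ∣_) (≡.sym fs) (∣m⇒∣m*n _ (*-pres-∣ d∣r d∣r))) dd∤n
    ramified record { root = r ; exponent = suc zero ; primes = L ; factors = fs } _ _ = ≡.trans fs (lemma r d (product L))
      where
      lemma : ∀ r d a → r * r * (d * 1 * a) ≡ d * (r * r * a)
      lemma = ℕSolver.solve-∀
    ramified record { root = r ; exponent = suc (suc e) ; primes = L ; factors = fs } _ dd∤n =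
      contradiction (≡.subst (d * d ∣_) (≡.sym fs) (divides (r * r * (d ^ e * product L)) (lemma r d (d ^ e) (product L)))) dd∤n
      where
      lemma : ∀ r d a b → r * r * (d * (d * a) * b) ≡ r * r * (a * b) * (d * d)
      lemma = ℕSolver.solve-∀

  module _ {Bad Q : ℕ → Set} (Q-1 : Q 1) (Q-* : ∀ {m n} → Q m → Q n → Q (m * n)) where

    bad-factor : ∀ {L} → All (λ p → Bad p ⊎ Q p) L → (∃ λ p → p ∈ L × Bad p) ⊎ Q (product L)
    bad-factor [] = inj₂ Q-1
    bad-factor (inj₁ b ∷ _) = inj₁ (_ , here refl , b)
    bad-factor (inj₂ q ∷ all) with bad-factor all
    ... | inj₁ (p , p∈L , b) = inj₁ (p , there p∈L , b)
    ... | inj₂ q′ = inj₂ (Q-* q q′)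

  -- Residue classes modulo 3, 5 and 15

  residues : ∀ {P : ℕ → Set} d .{{_ : NonZero d}} → (∀ (r : Fin d) → P (toℕ r)) → ∀ n → P (n % d)
  residues {P} d all n = ≡.subst P (Fin.toℕ-fromℕ< (m%n<n n d)) (all (fromℕ< (m%n<n n d)))

  *-% : ∀ m n d .{{_ : NonZero d}} {a b} → m % d ≡ a → n % d ≡ b → (m * n) % d ≡ (a * b) % d
  *-% m n d refl refl = %-distribˡ-* m n d

  ±1mod5 : ℕ → Set
  ±1mod5 n = n % 5 ≡ 1 ⊎ n % 5 ≡ 4

  ±1mod5-* : ∀ {m n} → ±1mod5 m → ±1mod5 n → ±1mod5 (m * n)
  ±1mod5-* {m} {n} (inj₁ x) (inj₁ y) = inj₁ (*-% m n 5 x y)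
  ±1mod5-* {m} {n} (inj₁ x) (inj₂ y) = inj₂ (*-% m n 5 x y)
  ±1mod5-* {m} {n} (inj₂ x) (inj₁ y) = inj₂ (*-% m n 5 x y)
  ±1mod5-* {m} {n} (inj₂ x) (inj₂ y) = inj₁ (*-% m n 5 x y)

  square-mod5 : ∀ n → ¬ 5 ∣ n → ±1mod5 (n * n)
  square-mod5 n 5∤n = ≡.subst (λ r → r ≡ 1 ⊎ r ≡ 4) (≡.sym (*-% n n 5 refl refl)) (
    residues {λ r → r ≢ 0 → ±1mod5 (r * r)} 5
      (from-yes (Fin.all? λ (r : Fin 5) → ¬? (toℕ r ≟ 0) →-dec (((toℕ r * toℕ r) % 5 ≟ 1) ⊎-dec ((toℕ r * toℕ r) % 5 ≟ 4)))) n
      (λ z → 5∤n (m%n≡0⇒n∣m n 5 z)))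

  square-mod3 : ∀ n → ¬ 3 ∣ n → (n * n) % 3 ≡ 1
  square-mod3 n 3∤n = ≡.trans (*-% n n 3 refl refl) (
    residues {λ r → r ≢ 0 → (r * r) % 3 ≡ 1} 3
      (from-yes (Fin.all? λ (r : Fin 3) → ¬? (toℕ r ≟ 0) →-dec ((toℕ r * toℕ r) % 3 ≟ 1))) n
      (λ z → 3∤n (m%n≡0⇒n∣m n 3 z)))

  Bad3 Bad5 : ℕ → Set
  Bad3 p = p % 15 ≡ 7 ⊎ p % 15 ≡ 13
  Bad5 p = p % 15 ≡ 11

  -- Apart from multiples of 5, numbers ≡ 1 modulo 3 lie in the classes 1, 4, 7, 13 modulo 15; the
  -- exceptional 7 and 13 are the nonsquares modulo 5.
  classify3 : ∀ p → p % 3 ≡ 1 → ¬ 5 ∣ p → Bad3 p ⊎ ±1mod5 p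
  classify3 p p%3 5∤p = conclude (check p (≡.trans (m∣n⇒o%n%m≡o%m 3 15 p (divides 5 refl)) p%3))
    where
    check : ∀ p → p % 15 % 3 ≡ 1 → p % 15 % 5 ≡ 0 ⊎ (p % 15 ≡ 7 ⊎ p % 15 ≡ 13) ⊎ (p % 15 % 5 ≡ 1 ⊎ p % 15 % 5 ≡ 4)
    check = residues {λ r → r % 3 ≡ 1 → r % 5 ≡ 0 ⊎ (r ≡ 7 ⊎ r ≡ 13) ⊎ (r % 5 ≡ 1 ⊎ r % 5 ≡ 4)} 15
      (from-yes (Fin.all? λ (r : Fin 15) → (toℕ r % 3 ≟ 1) →-dec ((toℕ r % 5 ≟ 0) ⊎-dec
        (((toℕ r ≟ 7) ⊎-dec (toℕ r ≟ 13)) ⊎-dec ((toℕ r % 5 ≟ 1) ⊎-dec (toℕ r % 5 ≟ 4))))))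
    %5 : p % 15 % 5 ≡ p % 5
    %5 = m∣n⇒o%n%m≡o%m 5 15 p (divides 3 refl)
    conclude : _ → Bad3 p ⊎ ±1mod5 p
    conclude (inj₁ z) = contradiction (m%n≡0⇒n∣m p 5 (≡.trans (≡.sym %5) z)) 5∤p
    conclude (inj₂ (inj₁ b)) = inj₁ b
    conclude (inj₂ (inj₂ q)) = inj₂ (≡.subst (λ r → r ≡ 1 ⊎ r ≡ 4) %5 q)

  -- The classes modulo 15 above 1 modulo 5 are 1, 6 and 11: 6 is a multiple of 3, and the
  -- exceptional 11 is a nonsquare modulo 3.
  classify5 : ∀ p → p % 5 ≡ 1 → ¬ 3 ∣ p → Bad5 p ⊎ p % 3 ≡ 1
  classify5 p p%5 3∤p = conclude (check p (≡.trans (m∣n⇒o%n%m≡o%m 5 15 p (divides 3 refl)) p%5))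
    where
    check : ∀ p → p % 15 % 5 ≡ 1 → p % 15 % 3 ≡ 0 ⊎ p % 15 ≡ 11 ⊎ p % 15 % 3 ≡ 1
    check = residues {λ r → r % 5 ≡ 1 → r % 3 ≡ 0 ⊎ r ≡ 11 ⊎ r % 3 ≡ 1} 15
      (from-yes (Fin.all? λ (r : Fin 15) → (toℕ r % 5 ≟ 1) →-dec ((toℕ r % 3 ≟ 0) ⊎-dec ((toℕ r ≟ 11) ⊎-dec (toℕ r % 3 ≟ 1)))))
    %3 : p % 15 % 3 ≡ p % 3
    %3 = m∣n⇒o%n%m≡o%m 3 15 p (divides 5 refl)
    conclude : _ → Bad5 p ⊎ p % 3 ≡ 1
    conclude (inj₁ z) = contradiction (m%n≡0⇒n∣m p 3 (≡.trans (≡.sym %3) z)) 3∤p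
    conclude (inj₂ (inj₁ b)) = inj₁ b
    conclude (inj₂ (inj₂ q)) = inj₂ (≡.trans (≡.sym %3) q)

  BadPrime : (ℕ → Set) → ℕ → Set
  BadPrime Bad n = ∃ λ p → Prime p × Bad p × p ∣ n

  module _ (r : ℕ) (L : List ℕ) where

    private
      u : ℕ
      u = r * r * product L

      ∤-factor : ∀ {q p} → ¬ q ∣ u → p ∈ L → ¬ q ∣ p
      ∤-factor q∤u p∈L q∣p = q∤u (∣n⇒∣m*n (r * r) (∣-trans q∣p (∈⇒∣product p∈L)))

      ∤-root : ∀ {q} → ¬ q ∣ u → ¬ q ∣ r
      ∤-root q∤u q∣r = q∤u (∣m⇒∣m*n (product L) (∣m⇒∣m*n r q∣r))

      bad-prime : ∀ {Bad : ℕ → Set} {Pr : ℕ → Set} → All (λ p → Prime p × Pr p) L → (∃ λ p → p ∈ L × Bad p) → BadPrime Bad u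
      bad-prime all (p , p∈L , b) = p , proj₁ (All.lookup all p∈L) , b , ∣n⇒∣m*n (r * r) (∈⇒∣product p∈L)

    bad3⊎±1mod5 : All (λ p → Prime p × p % 3 ≡ 1) L → ¬ 5 ∣ u → BadPrime Bad3 u ⊎ ±1mod5 u
    bad3⊎±1mod5 all 5∤u with bad-factor {Bad3} {±1mod5} (inj₁ refl) (λ {m} {n} → ±1mod5-* {m} {n})
      (All.tabulate λ {p} p∈L → classify3 p (proj₂ (All.lookup all p∈L)) (∤-factor 5∤u p∈L))
    ... | inj₁ b = inj₁ (bad-prime all b)
    ... | inj₂ q = inj₂ (±1mod5-* {r * r} {product L} (square-mod5 r (∤-root 5∤u)) q)

    bad5⊎1mod3 : All (λ p → Prime p × p % 5 ≡ 1) L → ¬ 3 ∣ u → BadPrime Bad5 u ⊎ u % 3 ≡ 1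
    bad5⊎1mod3 all 3∤u with bad-factor {Bad5} {λ n → n % 3 ≡ 1} refl (λ {m} {n} → *-% m n 3)
      (All.tabulate λ {p} p∈L → classify5 p (proj₂ (All.lookup all p∈L)) (∤-factor 3∤u p∈L))
    ... | inj₁ b = inj₁ (bad-prime all b)
    ... | inj₂ q = inj₂ (*-% (r * r) (product L) 3 (square-mod3 r (∤-root 3∤u)) q)

  larger-bad : ∀ {Bad u n} → u ∣ n → BadPrime Bad u → BadPrime Bad n
  larger-bad u∣n (p , pp , bad , p∣u) = p , pp , bad , ∣-trans p∣u u∣n

  unramified3 : ∀ {n} → Decomposition 3 n → ¬ 3 ∣ n → ¬ 5 ∣ n → BadPrime Bad3 n ⊎ ±1mod5 n
  unramified3 D 3∤n 5∤n = ≡.subst (λ n → BadPrime Bad3 n ⊎ ±1mod5 n) (≡.sym n≡)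
    (bad3⊎±1mod5 root primes prime-factors (≡.subst (λ n → ¬ 5 ∣ n) n≡ 5∤n))
    where
    open Decomposition D
    n≡ : _ ≡ root * root * product primes
    n≡ = unramified 3-prime D 3∤n

  ramified3 : ∀ {n} → Decomposition 3 n → 3 ∣ n → ¬ 3 * 3 ∣ n → ¬ 5 ∣ n → BadPrime Bad3 n ⊎ ∃ λ u → n ≡ 3 * u × ±1mod5 u
  ramified3 {n} D 3∣n 9∤n 5∤n = Sum.map (larger-bad (divides 3 n≡)) (λ q → root * root * product primes , n≡ , q)
    (bad3⊎±1mod5 root primes prime-factors λ 5∣u → 5∤n (≡.subst (5 ∣_) (≡.sym n≡) (∣n⇒∣m*n 3 5∣u)))
    where
    open Decomposition D
    n≡ : n ≡ 3 * (root * root * product primes)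
    n≡ = ramified 3-prime D 3∣n 9∤n

  unramified5 : ∀ {n} → Decomposition 5 n → ¬ 5 ∣ n → ¬ 3 ∣ n → BadPrime Bad5 n ⊎ n % 3 ≡ 1
  unramified5 D 5∤n 3∤n = ≡.subst (λ n → BadPrime Bad5 n ⊎ n % 3 ≡ 1) (≡.sym n≡)
    (bad5⊎1mod3 root primes prime-factors (≡.subst (λ n → ¬ 3 ∣ n) n≡ 3∤n))
    where
    open Decomposition D
    n≡ : _ ≡ root * root * product primes
    n≡ = unramified 5-prime D 5∤n

  ramified5 : ∀ {n} → Decomposition 5 n → 5 ∣ n → ¬ 5 * 5 ∣ n → ¬ 3 ∣ n → BadPrime Bad5 n ⊎ ∃ λ u → n ≡ 5 * u × u % 3 ≡ 1
  ramified5 {n} D 5∣n 25∤n 3∤n = Sum.map (larger-bad (divides 5 n≡)) (λ q → root * root * product primes , n≡ , q)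
    (bad5⊎1mod3 root primes prime-factors λ 3∣u → 3∤n (≡.subst (3 ∣_) (≡.sym n≡) (∣n⇒∣m*n 5 3∣u)))
    where
    open Decomposition D
    n≡ : n ≡ 5 * (root * root * product primes)
    n≡ = ramified 5-prime D 5∣n 25∤n

  -- For d = 3 the numbers a, x, y, z are N₁, N₃, N₅, N₁₅ up to sign; for d = 5 the middle two are
  -- exchanged. The product has exactly two factors d. Since d ∣ y would give d² ∣ y and d ∣ z,
  -- hence three factors, d divides neither y nor z; so it divides both a and x, each once.
  module _ {d : ℕ} .{{_ : NonZero d}} (d-prime : Prime d) {a x y z m : ℕ} (total : a * x * y * z ≡ d * d * m) (d∤m : ¬ d ∣ m)
    (a⇒x : d ∣ a → d ∣ x) (x⇒a : d ∣ x → d ∣ a) (y⇒z : d ∣ y → d ∣ z) (z⇒y : d ∣ z → d ∣ y) (y-square : d ∣ y → d * d ∣ y) where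

    private
      no-cube : ¬ d * d * d ∣ a * x * y * z
      no-cube ddd∣ = d∤m (*-cancelˡ-∣ (d * d) {{m*n≢0 d d}} (≡.subst (d * d * d ∣_) total ddd∣))

    valuation-y : ¬ d ∣ y
    valuation-y d∣y = no-cube (≡.subst (d * d * d ∣_) (≡.sym (*-assoc (a * x) y z)) (∣n⇒∣m*n (a * x) (*-pres-∣ (y-square d∣y) (y⇒z d∣y))))

    valuation-z : ¬ d ∣ z
    valuation-z d∣z = valuation-y (z⇒y d∣z)

    valuation-x : d ∣ x
    valuation-x with euclidsLemma (a * x * y) z d-prime (≡.subst (d ∣_) (≡.sym total) (∣m⇒∣m*n m (∣m⇒∣m*n d ∣-refl)))
    ... | inj₂ d∣z = contradiction d∣z valuation-z
    ... | inj₁ d∣axy with euclidsLemma (a * x) y d-prime d∣axy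
    ... | inj₂ d∣y = contradiction d∣y valuation-y
    ... | inj₁ d∣ax with euclidsLemma a x d-prime d∣ax
    ... | inj₁ d∣a = a⇒x d∣a
    ... | inj₂ d∣x = d∣x

    valuation-x² : ¬ d * d ∣ x
    valuation-x² dd∣x = no-cube (∣m⇒∣m*n z (∣m⇒∣m*n y (≡.subst (_∣ a * x) (lemma d) (*-pres-∣ (x⇒a valuation-x) dd∣x))))
      where
      lemma : ∀ d → d * (d * d) ≡ d * d * d
      lemma = ℕSolver.solve-∀

  coprime-15 : ∀ {n} → ¬ 3 ∣ n → ¬ 5 ∣ n → Coprime n 15
  coprime-15 {n} 3∤n 5∤n {d} (d∣n , d∣15) = conclude (prime⇒irreducible 5-prime (coprime-divisor {d} {3} {5} d-3 d∣15))
    where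
    d-3 : Coprime d 3
    d-3 {e} (e∣d , e∣3) with prime⇒irreducible 3-prime e∣3
    ... | inj₁ e≡1 = e≡1
    ... | inj₂ refl = contradiction (∣-trans e∣d d∣n) 3∤n
    conclude : d ≡ 1 ⊎ d ≡ 5 → d ≡ 1
    conclude (inj₁ d≡1) = d≡1
    conclude (inj₂ refl) = contradiction d∣n 5∤n

open NaturalNumbers

-- Residues of units

-- These are ℤ[ω₁₅] modulo Φ₃(ω₁₅) = (ω₅ - 1)/(ω₁₅ - 1) and modulo Φ₅(ω₁₅) = (ω₃ - 1)/(ω₁₅ - 1),
-- with ω₁₅ going to the class of X.
F₂₅ F₈₁ : ℤAlgebra
F₂₅ = ℤ[X]/ Φ3 (cst (+ 5))
F₈₁ = ℤ[X]/ Φ5 (cst (+ 3))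

pow : Poly → ℕ → Poly
pow p zero = cst (+ 1)
pow p (suc n) = p *ₚ pow p n

module _ {f c : Poly} where
  private module R = ℤAlgebra (ℤ[X]/ f c)

  pow-cong : ∀ p q n → p R.≈ q → pow p n R.≈ pow q n
  pow-cong p q zero e = R.refl {cst (+ 1)}
  pow-cong p q (suc n) e = R.*-cong {p} {q} {pow p n} {pow q n} e (pow-cong p q n e)

  pow-1 : ∀ p n → p R.≈ R.1# → pow p n R.≈ R.1#
  pow-1 p zero e = R.refl {cst (+ 1)}
  pow-1 p (suc n) e = R.trans (R.*-cong {p} {R.1#} {pow p n} {R.1#} e (pow-1 p n e)) (R.*-identityˡ R.1#)

infix 4 _≡_mod_ _≡⁴_mod_

_≡_mod_ : ℤ → ℤ → ℤ → Set
a ≡ b mod d = d ℤ.∣ a ℤ.- b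

_≡⁴_mod_ : ℤ × ℤ × ℤ × ℤ → ℤ × ℤ × ℤ × ℤ → ℤ → Set
(a₀ , a₁ , a₂ , a₃) ≡⁴ (b₀ , b₁ , b₂ , b₃) mod d = a₀ ≡ b₀ mod d × a₁ ≡ b₁ mod d × a₂ ≡ b₂ mod d × a₃ ≡ b₃ mod d

≡⁴-dec : ∀ a b d → Dec (a ≡⁴ b mod d)
≡⁴-dec (a₀ , a₁ , a₂ , a₃) (b₀ , b₁ , b₂ , b₃) d =
  (d ℤ.∣? a₀ ℤ.- b₀) ×-dec ((d ℤ.∣? a₁ ℤ.- b₁) ×-dec ((d ℤ.∣? a₂ ℤ.- b₂) ×-dec (d ℤ.∣? a₃ ℤ.- b₃)))

module _ (A : ℤAlgebra) where
  open ℤAlgebra A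
  open IntegerSolver A
  open import Relation.Binary.Reasoning.Setoid setoid

  ι-mod : ∀ {d} a b → ι d ≈ 0# → a ≡ b mod d → ι a ≈ ι b
  ι-mod {d} a b z (ℤ.divides q e) = begin
    ι a                    ≈⟨ ι-cong (lemma a b) ⟩
    ι (b ℤ.+ (a ℤ.- b))    ≈⟨ ι-+ b (a ℤ.- b) ⟩
    ι b + ι (a ℤ.- b)      ≈⟨ +-congˡ (trans (ι-cong e) (trans (ι-* q d) (trans (*-congˡ z) (zeroʳ (ι q))))) ⟩
    ι b + 0#               ≈⟨ +-identityʳ (ι b) ⟩
    ι b                    ∎
    where
    lemma : ∀ a b → a ≡ b ℤ.+ (a ℤ.- b)
    lemma = solve-∀

  lin3-mod : ∀ {d} → ι d ≈ 0# → ∀ {a b w} → proj₁ a ≡ proj₁ b mod d → proj₂ a ≡ proj₂ b mod d →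
    Norms.lin3 A a w ≈ Norms.lin3 A b w
  lin3-mod z {a} {b} e₀ e₁ = +-cong (ι-mod (proj₁ a) (proj₁ b) z e₀) (*-congʳ (ι-mod (proj₂ a) (proj₂ b) z e₁))

  lin5-mod : ∀ {d} → ι d ≈ 0# → ∀ a b {w} → a ≡⁴ b mod d → Norms.lin5 A a w ≈ Norms.lin5 A b w
  lin5-mod z (a₀ , a₁ , a₂ , a₃) (b₀ , b₁ , b₂ , b₃) (e₀ , e₁ , e₂ , e₃) =
    +-cong (+-cong (+-cong (ι-mod a₀ b₀ z e₀) (*-congʳ (ι-mod a₁ b₁ z e₁))) (*-congʳ (ι-mod a₂ b₂ z e₂))) (*-congʳ (ι-mod a₃ b₃ z e₃))

  -- As 5 is a multiple of a and 3 of b, the relation 2·3 - 5 = 1 shows that a common multiple of a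
  -- and b is a multiple of ab. The unit `y` is inserted for the factor x - 1 in the definition of
  -- good elements.
  comaximal : ∀ {D a b Q₁ Q₂ c₅ c₃ y e} → ι (+ 5) ≈ a * c₅ → ι (+ 3) ≈ b * c₃ → D ≈ a * Q₁ → D ≈ b * Q₂ → y * e ≈ 1# →
    D ≈ y * a * b * (e * (ι (+ 2) * (c₃ * Q₁) - c₅ * Q₂))
  comaximal {D} {a} {b} {Q₁} {Q₂} {c₅} {c₃} {y} {e} e₅ e₃ d₁ d₂ inverse = begin
    D
      ≈⟨ solve 1 (λ D → D := con (+ 2) :* con (+ 3) :* D :- con (+ 5) :* D) refl D ⟩
    ι (+ 2) * ι (+ 3) * D - ι (+ 5) * D
      ≈⟨ +-cong (*-cong (*-congˡ e₃) d₁) (-‿cong (*-cong e₅ d₂)) ⟩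
    ι (+ 2) * (b * c₃) * (a * Q₁) - a * c₅ * (b * Q₂)
      ≈⟨ *-identityˡ _ ⟨
    1# * (ι (+ 2) * (b * c₃) * (a * Q₁) - a * c₅ * (b * Q₂))
      ≈⟨ *-congʳ inverse ⟨
    y * e * (ι (+ 2) * (b * c₃) * (a * Q₁) - a * c₅ * (b * Q₂))
      ≈⟨ solve 8 (λ a b Q₁ Q₂ c₅ c₃ y e → y :* e :* (con (+ 2) :* (b :* c₃) :* (a :* Q₁) :- a :* c₅ :* (b :* Q₂))
           := y :* a :* b :* (e :* (con (+ 2) :* (c₃ :* Q₁) :- c₅ :* Q₂))) refl a b Q₁ Q₂ c₅ c₃ y e ⟩
    y * a * b * (e * (ι (+ 2) * (c₃ * Q₁) - c₅ * Q₂)) ∎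

  -- In ℤ[ω₁₅] the integer generator is a multiple of the cyclotomic one, so the ideal becomes
  -- principal.
  absorb : ∀ {D f h c k g} → D ≈ f * h + c * k → c ≈ f * g → D ≈ f * (h + g * k)
  absorb {D} {f} {h} {c} {k} {g} e e′ = trans e (trans (+-congˡ (*-congʳ e′))
    (solve 4 (λ f h g k → f :* h :+ f :* g :* k := f :* (h :+ g :* k)) refl f h g k))

≈-by-co3 : ∀ F G → proj₁ (co3 F) ≡ proj₁ (co3 G) mod (+ 5) → proj₂ (co3 F) ≡ proj₂ (co3 G) mod (+ 5) → ℤAlgebra._≈_ F₂₅ F G
≈-by-co3 F G e₀ e₁ = begin
  F                    ≈⟨ eval-x F ⟨
  eval F x             ≈⟨ eval-co3 F {x} root ⟩
  lin3 (co3 F) x       ≈⟨ lin3-mod F₂₅ {+ 5} z {co3 F} {co3 G} {x} e₀ e₁ ⟩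
  lin3 (co3 G) x       ≈⟨ eval-co3 G {x} root ⟨
  eval G x             ≈⟨ eval-x G ⟩
  G                    ∎
  where
  open ℤAlgebra F₂₅
  open Evaluation F₂₅
  open Norms F₂₅
  open PolyQuotient Φ3 (cst (+ 5))
  open import Relation.Binary.Reasoning.Setoid setoid
  root : Root3 x
  root = by-computation _ [] (cst (+ 1)) []
  z : ι (+ 5) ≈ 0#
  z = Quotient.generator₂≈0 polyAlgebra Φ3 (cst (+ 5))

≈-by-co5 : ∀ F G → co5 F ≡⁴ co5 G mod (+ 3) → ℤAlgebra._≈_ F₈₁ F G
≈-by-co5 F G e = begin
  F                    ≈⟨ eval-x F ⟨
  eval F x             ≈⟨ eval-co5 F {x} root ⟩
  lin5 (co5 F) x       ≈⟨ lin5-mod F₈₁ {+ 3} z (co5 F) (co5 G) {x} e ⟩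
  lin5 (co5 G) x       ≈⟨ eval-co5 G {x} root ⟨
  eval G x             ≈⟨ eval-x G ⟩
  G                    ∎
  where
  open ℤAlgebra F₈₁
  open Evaluation F₈₁
  open Norms F₈₁
  open PolyQuotient Φ5 (cst (+ 3))
  open import Relation.Binary.Reasoning.Setoid setoid
  root : Root5 x
  root = by-computation _ [] (cst (+ 1)) []
  z : ι (+ 3) ≈ 0#
  z = Quotient.generator₂≈0 polyAlgebra Φ5 (cst (+ 3))

-- Exhaustive searches in the residue fields

Nonsquare5 : ℤ → Set
Nonsquare5 n = n ≡ + 2 mod (+ 5) ⊎ n ≡ + 3 mod (+ 5)

pair : Fin 5 → Fin 5 → Poly
pair a b = + toℕ a ∷ + toℕ b ∷ []

X⁵-1 : Poly
X⁵-1 = X^ 5 -ₚ cst (+ 1)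

-- 2 generates the units modulo 5 and X has order 3, so together they generate the 12 nonzero
-- squares of F₂₅. A nonzero element is a square exactly when its norm is one; `X⁵-1` has norm 3,
-- and the nonsquares form its coset.
search₂₅ : ∀ a b → Nonsquare5 (n3 (pair a b)) → ∃ λ (i : Fin 3) → ∃ λ (k : Fin 4) →
  let P = pow (X^ 1) (toℕ i) *ₚ pow (cst (+ 2)) (toℕ k) *ₚ pair a b in
  proj₁ (co3 P) ≡ proj₁ (co3 X⁵-1) mod (+ 5) × proj₂ (co3 P) ≡ proj₂ (co3 X⁵-1) mod (+ 5)
search₂₅ = from-yes (Fin.all? λ (a : Fin 5) → Fin.all? λ (b : Fin 5) →
  ((+ 5 ℤ.∣? n3 (pair a b) ℤ.- + 2) ⊎-dec (+ 5 ℤ.∣? n3 (pair a b) ℤ.- + 3)) →-dec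
  (Fin.any? λ (i : Fin 3) → Fin.any? λ (k : Fin 4) →
    let P = pow (X^ 1) (toℕ i) *ₚ pow (cst (+ 2)) (toℕ k) *ₚ pair a b in
    (+ 5 ℤ.∣? proj₁ (co3 P) ℤ.- proj₁ (co3 X⁵-1)) ×-dec (+ 5 ℤ.∣? proj₂ (co3 P) ℤ.- proj₂ (co3 X⁵-1))))

quad : Fin 3 → Fin 3 → Fin 3 → Fin 3 → Poly
quad a b c d = + toℕ a ∷ + toℕ b ∷ + toℕ c ∷ + toℕ d ∷ []

sign : Fin 2 → ℤ
sign zero = + 1
sign (suc _) = -[1+ 0 ]

-- Norm 1 characterises the 40 nonzero squares of F₈₁. Among them are Φ₃, 1 + X and the ten elements
-- ±Xʲ; four powers of 1 + X represent all cosets of these ten.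
search₈₁ : ∀ a b c d → n5 (quad a b c d) ≡ + 1 mod (+ 3) → ∃ λ (l : Fin 4) → ∃ λ (s : Fin 2) → ∃ λ (j : Fin 5) →
  co5 (pow (+ 1 ∷ + 1 ∷ []) (toℕ l) *ₚ quad a b c d) ≡⁴ co5 (cst (sign s) *ₚ X^ (toℕ j) *ₚ Φ3) mod (+ 3)
search₈₁ = from-yes (Fin.all? λ (a : Fin 3) → Fin.all? λ (b : Fin 3) → Fin.all? λ (c : Fin 3) → Fin.all? λ (d : Fin 3) →
  (+ 3 ℤ.∣? n5 (quad a b c d) ℤ.- + 1) →-dec
  (Fin.any? λ (l : Fin 4) → Fin.any? λ (s : Fin 2) → Fin.any? λ (j : Fin 5) →
    ≡⁴-dec (co5 (pow (+ 1 ∷ + 1 ∷ []) (toℕ l) *ₚ quad a b c d)) (co5 (cst (sign s) *ₚ X^ (toℕ j) *ₚ Φ3)) (+ 3)))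

module Assemble (A : ℤAlgebra) where
  open ℤAlgebra A
  open IntegerSolver A
  open import Relation.Binary.Reasoning.Setoid setoid

  subtract₁ : ∀ {P Q T f h c k t} → P - Q ≈ f * h + c * k → T ≈ t * f → P - (Q + T) ≈ f * (h - t) + c * k
  subtract₁ {P} {Q} {T} {f} {h} {c} {k} {t} e e′ = begin
    P - (Q + T)                ≈⟨ solve 3 (λ P Q T → P :- (Q :+ T) := (P :- Q) :- T) refl P Q T ⟩
    (P - Q) - T                ≈⟨ +-cong e (-‿cong e′) ⟩
    (f * h + c * k) - t * f    ≈⟨ solve 5 (λ f h c k t → (f :* h :+ c :* k) :- t :* f := f :* (h :- t) :+ c :* k) refl f h c k t ⟩
    f * (h - t) + c * k        ∎

  subtract₂ : ∀ {P Q T f h c k t} → P - T ≈ f * h + c * k → Q ≈ t * f → P - (Q + T) ≈ f * (h - t) + c * k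
  subtract₂ {P} {Q} {T} e e′ = trans (+-congˡ (-‿cong (+-comm Q T))) (subtract₁ e e′)

  divide-unit : ∀ {Q W F u v} → v * F - Q ≈ W → u * v ≈ 1# → F ≈ u * (Q + W)
  divide-unit {Q} {W} {F} {u} {v} e inverse = begin
    F                        ≈⟨ *-identityˡ F ⟨
    1# * F                   ≈⟨ *-congʳ inverse ⟨
    u * v * F                ≈⟨ solve 4 (λ u v F Q → u :* v :* F := u :* (Q :+ (v :* F :- Q))) refl u v F Q ⟩
    u * (Q + (v * F - Q))    ≈⟨ *-congˡ (+-congˡ e) ⟩
    u * (Q + W)              ∎

  inverse-* : ∀ {u v u′ v′} → u * v ≈ 1# → u′ * v′ ≈ 1# → (u * u′) * (v * v′) ≈ 1#
  inverse-* {u} {v} {u′} {v′} e e′ = begin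
    (u * u′) * (v * v′)   ≈⟨ solve 4 (λ u v u′ v′ → (u :* u′) :* (v :* v′) := (u :* v) :* (u′ :* v′)) refl u v u′ v′ ⟩
    (u * v) * (u′ * v′)   ≈⟨ *-cong e e′ ⟩
    1# * 1#               ≈⟨ *-identityˡ 1# ⟩
    1#                    ∎

-- Units of ℤ[ω₁₅] and good elements

module ω15 = ℤAlgebra ℤ[ω15]
open PolyQuotient Φ15 (cst (+ 0)) using (by-computation)

X-1 : Poly
X-1 = X^ 1 -ₚ cst (+ 1)

record Unit (v : Poly) : Set where
  constructor unit
  field
    inverse : Poly
    isInverse : (inverse *ₚ v) ω15.≈ cst (+ 1)

unit-* : ∀ {v w} → Unit v → Unit w → Unit (v *ₚ w)
unit-* {v} {w} (unit u e) (unit u′ e′) = unit (u *ₚ u′) (Assemble.inverse-* ℤ[ω15] {u} {v} {u′} {w} e e′)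

unit-pow : ∀ {v} → Unit v → ∀ n → Unit (pow v n)
unit-pow e zero = unit (cst (+ 1)) (by-computation _ (cst (+ 1)) [] [])
unit-pow e (suc n) = unit-* e (unit-pow e n)

-- Φ₁₅(1) = 1, so X - 1 divides Φ₁₅ - 1; the negative of the quotient is the inverse.
unit-X-1 : Unit X-1
unit-X-1 = unit (-ₚ (+ 0 ∷ + 1 ∷ + 1 ∷ + 0 ∷ + 1 ∷ + 0 ∷ + 0 ∷ + 1 ∷ [])) (by-computation _ (cst (+ 1)) (cst -[1+ 0 ]) [])

unit-X : Unit (X^ 1)
unit-X = unit (X^ 14) (by-computation _ (cst (+ 1)) (X-1 *ₚ Φ3 *ₚ Φ5) [])

-- (X⁶ - 1)/(X³ - 1)
1+X³ : Poly
1+X³ = cst (+ 1) +ₚ X^ 3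

-- X³ = X¹⁸ in ℤ[ω₁₅], so the inverse is (X¹⁸ - 1)/(X⁶ - 1).
unit-1+X³ : Unit 1+X³
unit-1+X³ = unit (cst (+ 1) +ₚ X^ 6 +ₚ X^ 12) (by-computation _ (cst (+ 1)) (Φ5 +ₚ X-1 *ₚ Φ3 *ₚ Φ5) [])

-- (X⁷ - 1)/(X - 1): congruent to 1 in F₂₅ and to 1 + X in F₈₁, as 7 ≡ 1 mod 3 and 7 ≡ 2 mod 5.
E : Poly
E = + 1 ∷ + 1 ∷ + 1 ∷ + 1 ∷ + 1 ∷ + 1 ∷ + 1 ∷ []

-- X = X⁹¹ in ℤ[ω₁₅], so the inverse is (X⁹¹ - 1)/(X⁷ - 1) = -X - X⁸, written in reduced form.
unit-E : Unit E
unit-E = unit (+ 1 ∷ -[1+ 1 ] ∷ + 0 ∷ + 1 ∷ -[1+ 0 ] ∷ + 1 ∷ + 0 ∷ -[1+ 0 ] ∷ [])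
  (by-computation _ (cst (+ 1)) (+ 0 ∷ -[1+ 0 ] ∷ -[1+ 1 ] ∷ -[1+ 1 ] ∷ -[1+ 1 ] ∷ -[1+ 0 ] ∷ []) [])

-- Chinese remaindering: `T` vanishes modulo Φ₃ and `X⁵-1` modulo Φ₅, so the two hypotheses make `D`
-- a multiple of both, hence of (x - 1)Φ₃Φ₅.
good-from-residues : ∀ F v s j → IsSign s → j ℕ.< 15 → Unit v →
  ℤAlgebra._≈_ F₂₅ (v *ₚ F) X⁵-1 → ℤAlgebra._≈_ F₈₁ (v *ₚ F) (cst s *ₚ X^ j *ₚ Φ3) → Good F
good-from-residues F v s j is-sign j<15 (unit u uv≈1) (Quotient.ideal {h₁} {k₁} e₁) (Quotient.ideal {h₂} {k₂} e₂) =
  u , (v , ≈⇒≈ω uv≈1) , j , j<15 , s , is-sign , g ,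
  ≈⇒≈ω (Assemble.divide-unit ℤ[ω15] {X⁵-1 +ₚ T} {X-1 *ₚ Φ3 *ₚ Φ5 *ₚ g} {F} {u} {v} D≈ uv≈1)
  where
  open Quotient polyAlgebra Φ15 (cst (+ 0)) using (~-lift)
  T P D c₅ c₃ e Q₁ Q₂ g : Poly
  P = v *ₚ F
  T = cst s *ₚ X^ j *ₚ Φ3
  D = P -ₚ (X⁵-1 +ₚ T)
  -- Φ₅(y) = 5 + (y - 1)(4 + 3y + 2y² + y³) vanishes at y = ω₁₅³, which exhibits 5 as a multiple of
  -- Φ₃(ω₁₅); `c₃` arises from Φ₃(y) = 3 + (y - 1)(y + 2) at y = ω₁₅⁵.
  c₅ = -ₚ (X-1 *ₚ (cst (+ 4) +ₚ cst (+ 3) *ₚ X^ 3 +ₚ cst (+ 2) *ₚ X^ 6 +ₚ X^ 9))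
  c₃ = -ₚ (X-1 *ₚ (cst (+ 2) +ₚ X^ 5))
  e = Unit.inverse unit-X-1
  Q₁ = (h₁ -ₚ (cst s *ₚ X^ j)) +ₚ c₅ *ₚ k₁
  Q₂ = (h₂ -ₚ X-1) +ₚ c₃ *ₚ k₂
  g = e *ₚ ((cst (+ 2) *ₚ (c₃ *ₚ Q₁)) -ₚ (c₅ *ₚ Q₂))
  5≈ : cst (+ 5) ω15.≈ (Φ3 *ₚ c₅)
  5≈ = by-computation _ _ Φ5 []
  3≈ : cst (+ 3) ω15.≈ (Φ5 *ₚ c₃)
  3≈ = by-computation _ _ Φ3 []
  D₁ : D ω15.≈ (Φ3 *ₚ Q₁)
  D₁ = absorb ℤ[ω15] {D} {Φ3} {h₁ -ₚ (cst s *ₚ X^ j)} {cst (+ 5)} {k₁} {c₅}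
    (~-lift (Assemble.subtract₁ polyAlgebra {P} {X⁵-1} {T} {Φ3} {h₁} {cst (+ 5)} {k₁} {cst s *ₚ X^ j} e₁ ≑-refl)) 5≈
  D₂ : D ω15.≈ (Φ5 *ₚ Q₂)
  D₂ = absorb ℤ[ω15] {D} {Φ5} {h₂ -ₚ X-1} {cst (+ 3)} {k₂} {c₃}
    (~-lift (Assemble.subtract₂ polyAlgebra {P} {X⁵-1} {T} {Φ5} {h₂} {cst (+ 3)} {k₂} {X-1} e₂ (decide-≑ _ _))) 3≈
  D≈ : D ω15.≈ (X-1 *ₚ Φ3 *ₚ Φ5 *ₚ g)
  D≈ = comaximal ℤ[ω15] {D} {Φ3} {Φ5} {Q₁} {Q₂} {c₅} {c₃} {X-1} {e} 5≈ 3≈ D₁ D₂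
    (ω15.trans (ω15.*-comm X-1 e) (Unit.isInverse unit-X-1))

good-divide : ∀ F v → Unit v → Good (v *ₚ F) → Good F
good-divide F v (unit u e) (w , (w′ , ww′) , j , j<15 , s , is-sign , g , vF≈) =
  u *ₚ w , (v *ₚ w′ , ≈⇒≈ω (Assemble.inverse-* ℤ[ω15] {u} {v} {w} {w′} e (≈ω⇒≈ (w *ₚ w′) (cst (+ 1)) ww′))) ,
  j , j<15 , s , is-sign , g , ≈⇒≈ω (begin
    F                       ≈⟨ *-identityˡ F ⟨
    cst (+ 1) * F           ≈⟨ *-congʳ {F} e ⟨
    u * v * F               ≈⟨ *-assoc u v F ⟩
    u * (v * F)             ≈⟨ *-congˡ {u} (≈ω⇒≈ (v *ₚ F) (w *ₚ Gpoly s j g) vF≈) ⟩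
    u * (w * Gpoly s j g)   ≈⟨ *-assoc u w (Gpoly s j g) ⟨
    u * w * Gpoly s j g     ∎)
  where
  open ℤAlgebra ℤ[ω15]
  open import Relation.Binary.Reasoning.Setoid setoid

residue : ∀ d .{{_ : ℕ.NonZero d}} z → ∃ λ (r : Fin d) → z ≡ + toℕ r mod (+ d)
residue d z = fromℕ< r<d , ℤ.divides (z ℤ./ℕ d) (begin
  z ℤ.- + toℕ (fromℕ< r<d)                                      ≡⟨ cong (λ r → z ℤ.- + r) (Fin.toℕ-fromℕ< r<d) ⟩
  z ℤ.- + (z ℤ.%ℕ d)                                            ≡⟨ cong (ℤ._- + (z ℤ.%ℕ d)) (ℤ.a≡a%ℕn+[a/ℕn]*n z d) ⟩
  + (z ℤ.%ℕ d) ℤ.+ (z ℤ./ℕ d) ℤ.* + d ℤ.- + (z ℤ.%ℕ d)          ≡⟨ lemma (+ (z ℤ.%ℕ d)) ((z ℤ./ℕ d) ℤ.* + d) ⟩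
  (z ℤ./ℕ d) ℤ.* + d                                            ∎)
  where
  open ≡.≡-Reasoning
  r<d : z ℤ.%ℕ d ℕ.< d
  r<d = ℤ.n%ℕd<d z d
  lemma : ∀ a b → a ℤ.+ b ℤ.- a ≡ b
  lemma = solve-∀

mod-trans : ∀ {d} a b c → a ≡ c mod d → a ≡ b mod d → b ≡ c mod d
mod-trans {d} a b c p q = ≡.subst (d ℤ.∣_) (lemma a b c) (ℤ.∣m∣n⇒∣m-n p q)
  where
  lemma : ∀ a b c → (a ℤ.- c) ℤ.- (a ℤ.- b) ≡ b ℤ.- c
  lemma = solve-∀

residue₂₅ : ∀ F → ∃ λ a → ∃ λ b → ℤAlgebra._≈_ F₂₅ F (pair a b)
residue₂₅ F = let (a , e₀) = residue 5 (proj₁ (co3 F)) ; (b , e₁) = residue 5 (proj₂ (co3 F))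
                  short = co3-short (+ toℕ a) (+ toℕ b) in
  a , b , ≈-by-co3 F (pair a b) (≡.subst (λ z → proj₁ (co3 F) ≡ proj₁ z mod (+ 5)) (≡.sym short) e₀)
                                (≡.subst (λ z → proj₂ (co3 F) ≡ proj₂ z mod (+ 5)) (≡.sym short) e₁)

residue₈₁ : ∀ F → ∃ λ a → ∃ λ b → ∃ λ c → ∃ λ d → ℤAlgebra._≈_ F₈₁ F (quad a b c d)
residue₈₁ F = let (z₀ , z₁ , z₂ , z₃) = co5 F
                  (a , e₀) = residue 3 z₀ ; (b , e₁) = residue 3 z₁ ; (c , e₂) = residue 3 z₂ ; (d , e₃) = residue 3 z₃ in
  a , b , c , d , ≈-by-co5 F (quad a b c d)
    (≡.subst (λ z → co5 F ≡⁴ z mod (+ 3)) (≡.sym (co5-short (+ toℕ a) (+ toℕ b) (+ toℕ c) (+ toℕ d))) (e₀ , e₁ , e₂ , e₃))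

n5-unit-pow : ∀ v → n5 v ≡ + 1 → ∀ n → n5 (pow v n) ≡ + 1
n5-unit-pow v e zero = ≡.refl
n5-unit-pow v e (suc n) = ≡.trans (n5-* v (pow v n)) (cong₂ ℤ._*_ e (n5-unit-pow v e n))

-- The unit Xⁱ (1 + X³)ᵏ adjusts the residue in F₂₅; a power of E then adjusts the one in F₈₁.
good : ∀ F → Nonsquare5 (n3 F) → n5 F ≡ + 1 mod (+ 3) → Good F
good F n3-nonsquare n5≡1 = with-25 (search₂₅ a b n3′)
  where
  module K₂₅ = ℤAlgebra F₂₅
  module K₈₁ = ℤAlgebra F₈₁
  a b : Fin 5
  a = proj₁ (residue₂₅ F)
  b = proj₁ (proj₂ (residue₂₅ F))
  F≈pair : F K₂₅.≈ pair a b
  F≈pair = proj₂ (proj₂ (residue₂₅ F))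
  n3′ : Nonsquare5 (n3 (pair a b))
  n3′ = Sum.map (shift (+ 2)) (shift (+ 3)) n3-nonsquare
    where
    shift : ∀ c → n3 F ≡ c mod (+ 5) → n3 (pair a b) ≡ c mod (+ 5)
    shift c e = mod-trans (n3 F) (n3 (pair a b)) c e (n3-cong-mod (+ 5) F (pair a b) F≈pair)

  with-25 : (∃ λ (i : Fin 3) → ∃ λ (k : Fin 4) →
    let P = pow (X^ 1) (toℕ i) *ₚ pow (cst (+ 2)) (toℕ k) *ₚ pair a b in
    proj₁ (co3 P) ≡ proj₁ (co3 X⁵-1) mod (+ 5) × proj₂ (co3 P) ≡ proj₂ (co3 X⁵-1) mod (+ 5)) → Good F
  with-25 (i , k , e₀ , e₁) = with-81 (search₈₁ c₀ c₁ c₂ c₃ n5′)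
    where
    V F′ : Poly
    V = pow (X^ 1) (toℕ i) *ₚ pow 1+X³ (toℕ k)
    F′ = V *ₚ F
    unit-V : Unit V
    unit-V = unit-* (unit-pow unit-X (toℕ i)) (unit-pow unit-1+X³ (toℕ k))
    -- X and 1 + X³ have norm 1 in ℤ[ω₅], so the condition on N₅ survives the correction in F₂₅.
    n5-V : n5 V ≡ + 1
    n5-V = ≡.trans (n5-* (pow (X^ 1) (toℕ i)) (pow 1+X³ (toℕ k))) (cong₂ ℤ._*_ (n5-unit-pow (X^ 1) ≡.refl (toℕ i)) (n5-unit-pow 1+X³ ≡.refl (toℕ k)))
    n5-F′ : n5 F′ ≡ + 1 mod (+ 3)
    n5-F′ = ≡.subst (λ n → n ≡ + 1 mod (+ 3)) (≡.sym (≡.trans (n5-* V F) (≡.trans (cong (ℤ._* n5 F) n5-V) (ℤ.*-identityˡ (n5 F))))) n5≡1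
    F′≈X⁵-1 : F′ K₂₅.≈ X⁵-1
    F′≈X⁵-1 = K₂₅.trans
      (K₂₅.*-cong {V} {pow (X^ 1) (toℕ i) *ₚ pow (cst (+ 2)) (toℕ k)} {F} {pair a b}
        (K₂₅.*-congˡ {pow (X^ 1) (toℕ i)} (pow-cong 1+X³ (cst (+ 2)) (toℕ k) 1+X³≈2)) F≈pair)
      (≈-by-co3 (pow (X^ 1) (toℕ i) *ₚ pow (cst (+ 2)) (toℕ k) *ₚ pair a b) X⁵-1 e₀ e₁)
      where
      1+X³≈2 : 1+X³ K₂₅.≈ cst (+ 2)
      1+X³≈2 = PolyQuotient.by-computation Φ3 (cst (+ 5)) 1+X³ (cst (+ 2)) X-1 []
    c₀ c₁ c₂ c₃ : Fin 3
    c₀ = proj₁ (residue₈₁ F′)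
    c₁ = proj₁ (proj₂ (residue₈₁ F′))
    c₂ = proj₁ (proj₂ (proj₂ (residue₈₁ F′)))
    c₃ = proj₁ (proj₂ (proj₂ (proj₂ (residue₈₁ F′))))
    Q : Poly
    Q = quad c₀ c₁ c₂ c₃
    F′≈quad : F′ K₈₁.≈ Q
    F′≈quad = proj₂ (proj₂ (proj₂ (proj₂ (residue₈₁ F′))))
    n5′ : n5 Q ≡ + 1 mod (+ 3)
    n5′ = mod-trans (n5 F′) (n5 Q) (+ 1) n5-F′ (n5-cong-mod (+ 3) F′ Q F′≈quad)
    1+X : Poly
    1+X = + 1 ∷ + 1 ∷ []

    with-81 : (∃ λ (l : Fin 4) → ∃ λ (s : Fin 2) → ∃ λ (j : Fin 5) →
      co5 (pow 1+X (toℕ l) *ₚ Q) ≡⁴ co5 (cst (sign s) *ₚ X^ (toℕ j) *ₚ Φ3) mod (+ 3)) → Good F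
    with-81 (l , s , j , e) = good-divide F V unit-V (good-from-residues F′ (pow E (toℕ l)) (sign s) (toℕ j) (is-sign s)
      (ℕ.<-≤-trans (Fin.toℕ<n j) (ℕ.m≤m+n 5 10)) (unit-pow unit-E (toℕ l))
      (K₂₅.trans (K₂₅.*-cong {pow E (toℕ l)} {cst (+ 1)} {F′} {X⁵-1} (pow-1 E (toℕ l) E≈1) F′≈X⁵-1) (K₂₅.*-identityˡ X⁵-1))
      (K₈₁.trans (K₈₁.*-cong {pow E (toℕ l)} {pow 1+X (toℕ l)} {F′} {Q} (pow-cong E 1+X (toℕ l) E≈1+X) F′≈quad)
        (≈-by-co5 (pow 1+X (toℕ l) *ₚ Q) (cst (sign s) *ₚ X^ (toℕ j) *ₚ Φ3) e)))
      where
      is-sign : ∀ s → IsSign (sign s)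
      is-sign zero = inj₁ ≡.refl
      is-sign (suc _) = inj₂ ≡.refl
      E≈1 : E K₂₅.≈ cst (+ 1)
      E≈1 = PolyQuotient.by-computation Φ3 (cst (+ 5)) E (cst (+ 1)) (X^ 1 +ₚ X^ 4) []
      E≈1+X : E K₈₁.≈ 1+X
      E≈1+X = PolyQuotient.by-computation Φ5 (cst (+ 3)) E 1+X (X^ 2) []

-- The unit X - 1 has N₃ = 3 and N₅ = 5, a nonsquare modulo 5 and a nonsquare modulo 3, so it
-- changes both symbols at once.
good-times-X-1 : ∀ F → Nonsquare5 (+ 3 ℤ.* n3 F) → + 5 ℤ.* n5 F ≡ + 1 mod (+ 3) → Good F
good-times-X-1 F e₃ e₅ = good-divide F X-1 unit-X-1 (good (X-1 *ₚ F)
  (≡.subst Nonsquare5 (≡.sym (n3-* X-1 F)) e₃) (≡.subst (λ n → n ≡ + 1 mod (+ 3)) (≡.sym (n5-* X-1 F)) e₅))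

-- Valuations of the norms of F and the two cases

open import Data.Nat using (_%_)
open import Data.Integer using (_*_)
open import Data.Integer.Divisibility using (_∣_)

-- The predicates that `decompose` carries through its induction: after a square is removed, what
-- remains is again a norm.
IsN3 IsN5 : ℕ → Set
IsN3 n = ∃ λ F → n3 F ≡ + n
IsN5 n = ∃ λ F → n5 F ≡ + n

n3-abs : ∀ F → n3 F ≡ + ∣ n3 F ∣
n3-abs F = ≡.sym (ℤ.0≤i⇒+∣i∣≡i (n3≥0 F))

n5-abs : ∀ F → n5 F ≡ + ∣ n5 F ∣
n5-abs F = ≡.sym (ℤ.0≤i⇒+∣i∣≡i (n5≥0 F))

abs-*² : ∀ {n a} b c → n ≡ + a → n ≡ b * b * c → a ≡ ∣ b ∣ ℕ.* ∣ b ∣ ℕ.* ∣ c ∣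
abs-*² b c ≡.refl e = ≡.trans (cong ∣_∣ e) (≡.trans (ℤ.abs-* (b * b) c) (cong (ℕ._* ∣ c ∣) (ℤ.abs-* b b)))

residue-2 : ∀ p → p % 3 ≢ 0 → p % 3 ≢ 1 → p % 3 ≡ 2
residue-2 p z o with p % 3 | ℕ.m%n<n p 3
... | 0 | _ = contradiction ≡.refl z
... | 1 | _ = contradiction ≡.refl o
... | 2 | _ = ≡.refl
... | ℕ.suc (ℕ.suc (ℕ.suc _)) | ℕ.s≤s (ℕ.s≤s (ℕ.s≤s ()))

residue-234 : ∀ p → p % 5 ≢ 0 → p % 5 ≢ 1 → p % 5 ≡ 2 ⊎ p % 5 ≡ 3 ⊎ p % 5 ≡ 4
residue-234 p z o with p % 5 | ℕ.m%n<n p 5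
... | 0 | _ = contradiction ≡.refl z
... | 1 | _ = contradiction ≡.refl o
... | 2 | _ = inj₁ ≡.refl
... | 3 | _ = inj₂ (inj₁ ≡.refl)
... | 4 | _ = inj₂ (inj₂ ≡.refl)
... | ℕ.suc (ℕ.suc (ℕ.suc (ℕ.suc (ℕ.suc _)))) | ℕ.s≤s (ℕ.s≤s (ℕ.s≤s (ℕ.s≤s (ℕ.s≤s ()))))

n3-step : ∀ {n p} → IsN3 n → Prime p → p ℕ.∣ n → p % 3 ≢ 0 → p % 3 ≢ 1 →
  ∃ λ m → ∃ λ n′ → p ℕ.∣ m × n ≡ m ℕ.* m ℕ.* n′ × IsN3 n′
n3-step {n} {p} (F , e) pp p∣n z o = p , ∣ n3 G ∣ , ℕ.∣-refl , abs-*² (+ p) (n3 G) e (proj₂ descent) , G , n3-abs G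
  where
  descent : ∃ λ G → n3 F ≡ + p * + p * n3 G
  descent = n3-descent F pp (residue-2 p z o) (ℤ.∣ᵤ⇒∣ {+ p} {n3 F} (≡.subst (λ i → p ℕ.∣ ∣ i ∣) (≡.sym e) p∣n))
  G : Poly
  G = proj₁ descent

n5-step : ∀ {n p} → IsN5 n → Prime p → p ℕ.∣ n → p % 5 ≢ 0 → p % 5 ≢ 1 →
  ∃ λ m → ∃ λ n′ → p ℕ.∣ m × n ≡ m ℕ.* m ℕ.* n′ × IsN5 n′
n5-step {n} {p} (F , e) pp p∣n z o =
  ∣ m ∣ , ∣ n5 G ∣ , ℤ.∣⇒∣ᵤ {+ p} {m} (proj₁ (proj₂ (proj₂ descent))) , abs-*² m (n5 G) e (proj₂ (proj₂ (proj₂ descent))) , G , n5-abs G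
  where
  descent : ∃ λ m → ∃ λ G → + p ℤ.∣ m × n5 F ≡ m * m * n5 G
  descent = n5-descent F pp (residue-234 p z o) (ℤ.∣ᵤ⇒∣ {+ p} {n5 F} (≡.subst (λ i → p ℕ.∣ ∣ i ∣) (≡.sym e) p∣n))
  m : ℤ
  m = proj₁ descent
  G : Poly
  G = proj₁ (proj₂ descent)

step-square : ∀ {S : ℕ → Set} {n p} → (∃ λ m → ∃ λ n′ → p ℕ.∣ m × n ≡ m ℕ.* m ℕ.* n′ × S n′) → p ℕ.* p ℕ.∣ n
step-square (m , n′ , p∣m , n≡ , _) = ≡.subst (_ ℕ.∣_) (≡.sym n≡) (ℕ.∣m⇒∣m*n n′ (ℕ.*-pres-∣ p∣m p∣m))

∣-mod : ∀ {d i j} → + d ℤ.∣ i ℤ.- j → (d ℕ.∣ ∣ i ∣ → d ℕ.∣ ∣ j ∣) × (d ℕ.∣ ∣ j ∣ → d ℕ.∣ ∣ i ∣)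
∣-mod {d} {i} {j} e =
  (λ d∣i → ℤ.∣⇒∣ᵤ (≡.subst (+ d ℤ.∣_) (lemma₁ i j) (ℤ.∣m∣n⇒∣m-n (ℤ.∣ᵤ⇒∣ {+ d} {i} d∣i) e))) ,
  (λ d∣j → ℤ.∣⇒∣ᵤ (≡.subst (+ d ℤ.∣_) (lemma₂ i j) (ℤ.∣m∣n⇒∣m+n e (ℤ.∣ᵤ⇒∣ {+ d} {j} d∣j))))
  where
  lemma₁ : ∀ i j → i ℤ.- (i ℤ.- j) ≡ j
  lemma₁ = solve-∀
  lemma₂ : ∀ i j → (i ℤ.- j) ℤ.+ j ≡ i
  lemma₂ = solve-∀

prime∣* : ∀ {p i j} → Prime p → p ℕ.∣ ∣ i * j ∣ → p ℕ.∣ ∣ i ∣ ⊎ p ℕ.∣ ∣ j ∣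
prime∣* {p} {i} {j} pp p∣ = euclidsLemma ∣ i ∣ ∣ j ∣ pp (≡.subst (p ℕ.∣_) (ℤ.abs-* i j) p∣)

prime∣square : ∀ {p i} → Prime p → p ℕ.∣ ∣ i * i ∣ → p ℕ.∣ ∣ i ∣
prime∣square {p} {i} pp p∣ = Sum.reduce (prime∣* {p} {i} {i} pp p∣)

prime∣fourth : ∀ {p i} → Prime p → p ℕ.∣ ∣ i * (i * (i * i)) ∣ → p ℕ.∣ ∣ i ∣
prime∣fourth {p} {i} pp p∣ with prime∣* {p} {i} {i * (i * i)} pp p∣
... | inj₁ d = d
... | inj₂ d with prime∣* {p} {i} {i * i} pp d
... | inj₁ d′ = d′
... | inj₂ d′ = prime∣square {p} {i} pp d′

∣-left : ∀ {d} i j → d ℕ.∣ ∣ i ∣ → d ℕ.∣ ∣ i * j ∣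
∣-left {d} i j d∣i = ≡.subst (d ℕ.∣_) (≡.sym (ℤ.abs-* i j)) (ℕ.∣m⇒∣m*n ∣ j ∣ d∣i)

∤⇒≢0 : ∀ {k n} → ¬ k ℕ.∣ n → n ≢ 0
∤⇒≢0 {k} k∤n ≡.refl = k∤n (k ℕ.∣0)

module _ (F : Poly) where

  a₁ a₃ a₅ a₁₅ : ℕ
  a₁ = ∣ n1 F ∣
  a₃ = ∣ n3 F ∣
  a₅ = ∣ n5 F ∣
  a₁₅ = ∣ n15 F ∣

  3∣a₁⇒3∣a₃ : 3 ℕ.∣ a₁ → 3 ℕ.∣ a₃
  3∣a₁⇒3∣a₃ d = proj₂ (∣-mod {3} {n3 F} {n1 F * n1 F} (n3≡n1² F)) (∣-left (n1 F) (n1 F) d)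
  3∣a₃⇒3∣a₁ : 3 ℕ.∣ a₃ → 3 ℕ.∣ a₁
  3∣a₃⇒3∣a₁ d = prime∣square {3} {n1 F} 3-prime (proj₁ (∣-mod {3} {n3 F} {n1 F * n1 F} (n3≡n1² F)) d)
  3∣a₅⇒3∣a₁₅ : 3 ℕ.∣ a₅ → 3 ℕ.∣ a₁₅
  3∣a₅⇒3∣a₁₅ d = proj₂ (∣-mod {3} {n15 F} {n5 F * n5 F} (n15≡n5² F)) (∣-left (n5 F) (n5 F) d)
  3∣a₁₅⇒3∣a₅ : 3 ℕ.∣ a₁₅ → 3 ℕ.∣ a₅
  3∣a₁₅⇒3∣a₅ d = prime∣square {3} {n5 F} 3-prime (proj₁ (∣-mod {3} {n15 F} {n5 F * n5 F} (n15≡n5² F)) d)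
  5∣a₁⇒5∣a₅ : 5 ℕ.∣ a₁ → 5 ℕ.∣ a₅
  5∣a₁⇒5∣a₅ d = proj₂ (∣-mod {5} {n5 F} {n1 F * (n1 F * (n1 F * n1 F))} (n5≡n1⁴ F)) (∣-left (n1 F) _ d)
  5∣a₅⇒5∣a₁ : 5 ℕ.∣ a₅ → 5 ℕ.∣ a₁
  5∣a₅⇒5∣a₁ d = prime∣fourth {5} {n1 F} 5-prime (proj₁ (∣-mod {5} {n5 F} {n1 F * (n1 F * (n1 F * n1 F))} (n5≡n1⁴ F)) d)
  5∣a₃⇒5∣a₁₅ : 5 ℕ.∣ a₃ → 5 ℕ.∣ a₁₅
  5∣a₃⇒5∣a₁₅ d = proj₂ (∣-mod {5} {n15 F} {n3 F * (n3 F * (n3 F * n3 F))} (n15≡n3⁴ F)) (∣-left (n3 F) _ d)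
  5∣a₁₅⇒5∣a₃ : 5 ℕ.∣ a₁₅ → 5 ℕ.∣ a₃
  5∣a₁₅⇒5∣a₃ d = prime∣fourth {5} {n3 F} 5-prime (proj₁ (∣-mod {5} {n15 F} {n3 F * (n3 F * (n3 F * n3 F))} (n15≡n3⁴ F)) d)

  -- 3 is neither 0 nor 1 modulo 5, so the descent for N₅ applies to the prime 3.
  9∣a₅ : 3 ℕ.∣ a₅ → 3 ℕ.* 3 ℕ.∣ a₅
  9∣a₅ d = step-square (n5-step (F , n5-abs F) 3-prime d (λ ()) (λ ()))

  -- 5 ≡ 2 modulo 3, so the descent for N₃ applies to the prime 5.
  25∣a₃ : 5 ℕ.∣ a₃ → 5 ℕ.* 5 ℕ.∣ a₃
  25∣a₃ d = step-square (n3-step (F , n3-abs F) 5-prime d (λ ()) (λ ()))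

  decomposition3 : a₃ ≢ 0 → Decomposition 3 a₃
  decomposition3 = decompose 3-prime IsN3 n3-step a₃ (F , n3-abs F)

  decomposition5 : a₅ ≢ 0 → Decomposition 5 a₅
  decomposition5 = decompose 5-prime IsN5 n5-step a₅ (F , n5-abs F)

%⇒mod : ∀ n d .{{_ : ℕ.NonZero d}} {r} → n % d ≡ r → + n ≡ + r mod (+ d)
%⇒mod n d ≡.refl = ℤ.divides (+ (n ℕ./ d)) (begin
  + n ℤ.- + (n % d)                                     ≡⟨ cong (λ k → + k ℤ.- + (n % d)) (ℕ.m≡m%n+[m/n]*n n d) ⟩
  + (n % d) ℤ.+ + (n ℕ./ d ℕ.* d) ℤ.- + (n % d)         ≡⟨ lemma (+ (n % d)) _ ⟩
  + (n ℕ./ d ℕ.* d)                                     ≡⟨ ℤ.pos-* (n ℕ./ d) d ⟩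
  + (n ℕ./ d) * + d                                     ∎)
  where
  open ≡.≡-Reasoning
  lemma : ∀ a b → a ℤ.+ b ℤ.- a ≡ b
  lemma = solve-∀

-- ±1 are the nonzero squares modulo 5, and 3 is a nonsquare.
nonsquare : ∀ u → ±1mod5 u → Nonsquare5 (+ (3 ℕ.* u))
nonsquare u (inj₁ e) = inj₂ (%⇒mod (3 ℕ.* u) 5 (*-% 3 u 5 ≡.refl e))
nonsquare u (inj₂ e) = inj₁ (%⇒mod (3 ℕ.* u) 5 (*-% 3 u 5 ≡.refl e))

theorem4 : (F : Poly) (m : ℤ) → Coprime 15 ∣ m ∣ →
    (M15 F ≈ω cst (+ 9 * m)) ⊎ (M15 F ≈ω cst (+ 25 * m)) →
    (∃ λ k → (N15 F ≈ω cst k) × NormGood15 k)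
    ⊎ (∃ λ p → Prime p × ((p % 15 ≡ 7) ⊎ (p % 15 ≡ 13)) ×
    ∃ λ n → (N3 F ≈ω cst n) × (+ p ∣ n))
    ⊎ (∃ λ p → Prime p × (p % 15 ≡ 11) ×
    ∃ λ n → (N5 F ≈ω cst n) × (+ p ∣ n))
theorem4 F m coprime = conclude
  where
  Conclusion : Set
  Conclusion = (∃ λ k → (N15 F ≈ω cst k) × NormGood15 k)
    ⊎ (∃ λ p → Prime p × ((p % 15 ≡ 7) ⊎ (p % 15 ≡ 13)) × ∃ λ n → (N3 F ≈ω cst n) × (+ p ∣ n))
    ⊎ (∃ λ p → Prime p × (p % 15 ≡ 11) × ∃ λ n → (N5 F ≈ω cst n) × (+ p ∣ n))

  3∤m : ¬ 3 ℕ.∣ ∣ m ∣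
  3∤m d with coprime (ℕ.divides 5 ≡.refl , d)
  ... | ()
  5∤m : ¬ 5 ℕ.∣ ∣ m ∣
  5∤m d with coprime (ℕ.divides 3 ≡.refl , d)
  ... | ()

  total : ∀ {k} → M15 F ≈ω cst (+ k * m) → a₁ F ℕ.* a₃ F ℕ.* a₅ F ℕ.* a₁₅ F ≡ k ℕ.* ∣ m ∣
  total {k} e = begin
    a₁ F ℕ.* a₃ F ℕ.* a₅ F ℕ.* a₁₅ F           ≡⟨ cong (λ z → z ℕ.* a₅ F ℕ.* a₁₅ F) (ℤ.abs-* (n1 F) (n3 F)) ⟨
    ∣ n1 F * n3 F ∣ ℕ.* a₅ F ℕ.* a₁₅ F         ≡⟨ cong (ℕ._* a₁₅ F) (ℤ.abs-* (n1 F * n3 F) (n5 F)) ⟨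
    ∣ n1 F * n3 F * n5 F ∣ ℕ.* a₁₅ F           ≡⟨ ℤ.abs-* (n1 F * n3 F * n5 F) (n15 F) ⟨
    ∣ n1 F * n3 F * n5 F * n15 F ∣             ≡⟨ cong ∣_∣ (M15-value F (+ k * m) e) ⟩
    ∣ + k * m ∣                                ≡⟨ ℤ.abs-* (+ k) m ⟩
    k ℕ.* ∣ m ∣                                ∎
    where open ≡.≡-Reasoning

  factor-∤ : ∀ {p k} → Prime p → ¬ p ℕ.∣ k → ¬ p ℕ.∣ ∣ m ∣ → a₁ F ℕ.* a₃ F ℕ.* a₅ F ℕ.* a₁₅ F ≡ k ℕ.* ∣ m ∣ →
    ¬ p ℕ.∣ a₃ F × ¬ p ℕ.∣ a₅ F × ¬ p ℕ.∣ a₁₅ F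
  factor-∤ {p} {k} pp p∤k p∤m e =
    (λ d → none (ℕ.∣m⇒∣m*n (a₁₅ F) (ℕ.∣m⇒∣m*n (a₅ F) (ℕ.∣n⇒∣m*n (a₁ F) d)))) ,
    (λ d → none (ℕ.∣m⇒∣m*n (a₁₅ F) (ℕ.∣n⇒∣m*n (a₁ F ℕ.* a₃ F) d))) ,
    (λ d → none (ℕ.∣n⇒∣m*n (a₁ F ℕ.* a₃ F ℕ.* a₅ F) d))
    where
    none : ¬ p ℕ.∣ a₁ F ℕ.* a₃ F ℕ.* a₅ F ℕ.* a₁₅ F
    none d with euclidsLemma k ∣ m ∣ pp (≡.subst (p ℕ.∣_) e d)
    ... | inj₁ p∣k = p∤k p∣k
    ... | inj₂ p∣m = p∤m p∣m

  good-case : ¬ 3 ℕ.∣ a₁₅ F → ¬ 5 ℕ.∣ a₁₅ F → Good F → Conclusion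
  good-case 3∤ 5∤ g = inj₁ (n15 F , N15≈n15 F , coprime-15 3∤ 5∤ , F , g , N15≈n15 F)

  bad3-case : BadPrime Bad3 (a₃ F) → Conclusion
  bad3-case (p , pp , bad , p∣) = inj₂ (inj₁ (p , pp , bad , n3 F , N3≈n3 F , p∣))

  bad5-case : BadPrime Bad5 (a₅ F) → Conclusion
  bad5-case (p , pp , bad , p∣) = inj₂ (inj₂ (p , pp , bad , n5 F , N5≈n5 F , p∣))

  conclude : (M15 F ≈ω cst (+ 9 * m)) ⊎ (M15 F ≈ω cst (+ 25 * m)) → Conclusion
  conclude (inj₁ e) = cases (ramified3 (decomposition3 F (∤⇒≢0 9∤a₃)) 3∣a₃ 9∤a₃ (proj₁ 5∤))
                            (unramified5 (decomposition5 F (∤⇒≢0 3∤a₅)) (proj₁ (proj₂ 5∤)) 3∤a₅)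
    where
    t : a₁ F ℕ.* a₃ F ℕ.* a₅ F ℕ.* a₁₅ F ≡ 3 ℕ.* 3 ℕ.* ∣ m ∣
    t = total {9} e
    3∤a₅ : ¬ 3 ℕ.∣ a₅ F
    3∤a₅ = valuation-y 3-prime {a₁ F} t 3∤m (3∣a₁⇒3∣a₃ F) (3∣a₃⇒3∣a₁ F) (3∣a₅⇒3∣a₁₅ F) (3∣a₁₅⇒3∣a₅ F) (9∣a₅ F)
    3∤a₁₅ : ¬ 3 ℕ.∣ a₁₅ F
    3∤a₁₅ d = 3∤a₅ (3∣a₁₅⇒3∣a₅ F d)
    3∣a₃ : 3 ℕ.∣ a₃ F
    3∣a₃ = valuation-x 3-prime {a₁ F} t 3∤m (3∣a₁⇒3∣a₃ F) (3∣a₃⇒3∣a₁ F) (3∣a₅⇒3∣a₁₅ F) (3∣a₁₅⇒3∣a₅ F) (9∣a₅ F)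
    9∤a₃ : ¬ 3 ℕ.* 3 ℕ.∣ a₃ F
    9∤a₃ = valuation-x² 3-prime {a₁ F} t 3∤m (3∣a₁⇒3∣a₃ F) (3∣a₃⇒3∣a₁ F) (3∣a₅⇒3∣a₁₅ F) (3∣a₁₅⇒3∣a₅ F) (9∣a₅ F)
    5∤ : ¬ 5 ℕ.∣ a₃ F × ¬ 5 ℕ.∣ a₅ F × ¬ 5 ℕ.∣ a₁₅ F
    5∤ = factor-∤ {5} {9} 5-prime (λ d → contradiction (ℕ.n∣m⇒m%n≡0 9 5 d) λ ()) 5∤m t
    cases : BadPrime Bad3 (a₃ F) ⊎ (∃ λ u → a₃ F ≡ 3 ℕ.* u × ±1mod5 u) → BadPrime Bad5 (a₅ F) ⊎ a₅ F % 3 ≡ 1 → Conclusion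
    cases (inj₁ b) _ = bad3-case b
    cases (inj₂ _) (inj₁ b) = bad5-case b
    cases (inj₂ (u , a₃≡ , u±1)) (inj₂ a₅%3) = good-case 3∤a₁₅ (proj₂ (proj₂ 5∤)) (good F
      (≡.subst Nonsquare5 (≡.trans (cong +_ (≡.sym a₃≡)) (≡.sym (n3-abs F))) (nonsquare u u±1))
      (≡.subst (λ n → n ≡ + 1 mod (+ 3)) (≡.sym (n5-abs F)) (%⇒mod (a₅ F) 3 a₅%3)))
  conclude (inj₂ e) = cases (unramified3 (decomposition3 F (∤⇒≢0 5∤a₃)) (proj₁ 3∤) 5∤a₃)
                            (ramified5 (decomposition5 F (∤⇒≢0 25∤a₅)) 5∣a₅ 25∤a₅ (proj₁ (proj₂ 3∤)))
    where
    t : a₁ F ℕ.* a₃ F ℕ.* a₅ F ℕ.* a₁₅ F ≡ 5 ℕ.* 5 ℕ.* ∣ m ∣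
    t = total {25} e
    -- For the prime 5 the norms N₃ and N₅ exchange their roles in the valuation argument.
    t′ : a₁ F ℕ.* a₅ F ℕ.* a₃ F ℕ.* a₁₅ F ≡ 5 ℕ.* 5 ℕ.* ∣ m ∣
    t′ = ≡.trans (cong (ℕ._* a₁₅ F) (swap (a₁ F) (a₅ F) (a₃ F))) t
      where
      swap : ∀ x y z → x ℕ.* y ℕ.* z ≡ x ℕ.* z ℕ.* y
      swap x y z = ≡.trans (ℕ.*-assoc x y z) (≡.trans (cong (x ℕ.*_) (ℕ.*-comm y z)) (≡.sym (ℕ.*-assoc x z y)))
    5∤a₃ : ¬ 5 ℕ.∣ a₃ F
    5∤a₃ = valuation-y 5-prime {a₁ F} t′ 5∤m (5∣a₁⇒5∣a₅ F) (5∣a₅⇒5∣a₁ F) (5∣a₃⇒5∣a₁₅ F) (5∣a₁₅⇒5∣a₃ F) (25∣a₃ F)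
    5∤a₁₅ : ¬ 5 ℕ.∣ a₁₅ F
    5∤a₁₅ d = 5∤a₃ (5∣a₁₅⇒5∣a₃ F d)
    5∣a₅ : 5 ℕ.∣ a₅ F
    5∣a₅ = valuation-x 5-prime {a₁ F} t′ 5∤m (5∣a₁⇒5∣a₅ F) (5∣a₅⇒5∣a₁ F) (5∣a₃⇒5∣a₁₅ F) (5∣a₁₅⇒5∣a₃ F) (25∣a₃ F)
    25∤a₅ : ¬ 5 ℕ.* 5 ℕ.∣ a₅ F
    25∤a₅ = valuation-x² 5-prime {a₁ F} t′ 5∤m (5∣a₁⇒5∣a₅ F) (5∣a₅⇒5∣a₁ F) (5∣a₃⇒5∣a₁₅ F) (5∣a₁₅⇒5∣a₃ F) (25∣a₃ F)
    3∤ : ¬ 3 ℕ.∣ a₃ F × ¬ 3 ℕ.∣ a₅ F × ¬ 3 ℕ.∣ a₁₅ F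
    3∤ = factor-∤ {3} {25} 3-prime (λ d → contradiction (ℕ.n∣m⇒m%n≡0 25 3 d) λ ()) 3∤m t
    cases : BadPrime Bad3 (a₃ F) ⊎ ±1mod5 (a₃ F) → BadPrime Bad5 (a₅ F) ⊎ (∃ λ u → a₅ F ≡ 5 ℕ.* u × u % 3 ≡ 1) → Conclusion
    cases (inj₁ b) _ = bad3-case b
    cases (inj₂ _) (inj₁ b) = bad5-case b
    -- N₃ is a square modulo 5 and N₅ = 5u a nonsquare modulo 3. The factor X - 1 turns these into
    -- 3N₃, a nonsquare, and 5·5u ≡ 1.
    cases (inj₂ a₃±1) (inj₂ (u , a₅≡ , u%3)) = good-case (proj₂ (proj₂ 3∤)) 5∤a₁₅ (good-times-X-1 F
      (≡.subst Nonsquare5 (≡.trans (ℤ.pos-* 3 (a₃ F)) (cong (+ 3 *_) (≡.sym (n3-abs F)))) (nonsquare (a₃ F) a₃±1))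
      (≡.subst (λ n → n ≡ + 1 mod (+ 3)) (≡.trans (ℤ.pos-* 5 (a₅ F)) (cong (+ 5 *_) (≡.sym (n5-abs F))))
        (%⇒mod (5 ℕ.* a₅ F) 3 (≡.trans (cong (λ n → (5 ℕ.* n) % 3) a₅≡) (*-% 5 (5 ℕ.* u) 3 ≡.refl (*-% 5 u 3 ≡.refl u%3))))))
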